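{- Let $G_1$ be an $r_1$-regular graph with $n_1$ vertices and $G_2$ an $r_2$-regular graph with $n_2$ vertices. Then the signless Laplacian spectrum (with multiplicities) of $G_1\underset{=}{\vee}G_2$ consists of: - $n_1+\nu_j(G_2)$ for each $j=2,3,\dots,n_2$; - the two roots of the equation $$x^2+(2r_1-2n_1-n_2-\nu_i(G_1)+2)x+n_1^2-2r_1n_1-2n_1+n_1n_2-r_1n_2-n_2+4r_1+\nu_i(G_1)\big(n_1+r_1-3-\nu_i(G_1)\big)=0$$ for each $i=2,3,\dots,n_1$; - the three roots of the equation $$\begin{aligned}&x^3+(2-3n_1-n_2-2r_2)x^2\\&+(n_1n_2-n_2r_1-n_2+2n_1^2+2r_1n_1-2n_1-2r_1-2r_1^2+4r_2n_1-4r_2+2r_2n_2)x\\&+2n_1r_1^2+2r_1n_1-2r_1n_1^2-2r_2n_1n_2+2r_1r_2n_2+2r_2n_2+4r_2r_1^2+4r_1r_2-4r_1r_2n_1=0.\end{aligned}$$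
   Context: Graphs are finite, undirected and simple. With $A(G)$ the adjacency matrix and $D(G)$ the diagonal degree matrix, $Q(G)=D(G)+A(G)$ is the signless Laplacian; $\nu_1(G)\ge\nu_2(G)\ge\dots\ge\nu_n(G)$ denote its eigenvalues, and the signless Laplacian spectrum is the multiset of these eigenvalues. For vertex-disjoint graphs $G_1$ (with $V(G_1)=\{u_1,\dots,u_{n_1}\}$) and $G_2$, the join $G_1\vee G_2$ is the disjoint union together with all edges between $V(G_1)$ and $V(G_2)$. The NNS (Non Neighbors Splitting) join $G_1\underset{=}{\vee}G_2$ is obtained from $G_1\vee G_2$ by adding new vertices $u_1',\dots,u_{n_1}'$ and joining $u_i'$ to $u_j$ if and only if $i\ne j$ and $u_iu_j\notin E(G_1)$. -}

module Defs where

open import Level using (Level; _⊔_) renaming (suc to lsuc)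
open import Algebra.Bundles using (CommutativeRing)
import Algebra.Definitions as AlgebraDefinitions
import Algebra.Properties.CommutativeMonoid.Sum as Summation
import Algebra.Properties.Monoid.Mult as Multiples
import Algebra.Properties.Semiring.Exp as Powers
open import Data.Bool.Base using (Bool; true; false; not; _∧_; if_then_else_)
open import Data.Fin.Base using (Fin; zero; suc; toℕ; punchIn)
import Data.Fin.Base as Fin
open import Data.Fin.Properties using (_≟_; +↔⊎)
open import Data.Fin.Subset using (Subset; ∣_∣)
open import Data.List.Base using (List; []; _∷_; foldr)
open import Data.Nat.Base using (ℕ; zero; suc)
import Data.Nat.Base as ℕ
open import Data.Product.Base using (∃; _×_)
open import Data.Sum.Base using (_⊎_; inj₁; inj₂)
open import Data.Sum.Function.Propositional using (_⊎-↔_)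
open import Data.Vec.Base using (tabulate)
open import Function.Bundles using (_↔_; Inverse)
open import Function.Construct.Composition using (_↔-∘_)
open import Function.Construct.Identity using (↔-id)
open import Relation.Binary.Core using (Rel)
open import Relation.Binary.PropositionalEquality using (_≡_; refl; sym)
open import Relation.Binary.Structures using (IsDecTotalOrder)
open import Relation.Nullary using (¬_; yes; no; does)
open import Data.Empty using (⊥-elim)

------------------------------------------------------------------------
-- Graphs

record Graph (V : Set) : Set where
  field
    adj        : V → V → Bool
    adj-sym    : ∀ u v → adj u v ≡ adj v u
    adj-irrefl : ∀ u → adj u u ≡ false

open Graph public

neighbours : ∀ {n} → Graph (Fin n) → Fin n → Subset n
neighbours G u = tabulate (adj G u)

degree : ∀ {n} → Graph (Fin n) → Fin n → ℕ
degree G u = ∣ neighbours G u ∣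

Regular : ∀ {n} → Graph (Fin n) → ℕ → Set
Regular G r = ∀ u → degree G u ≡ r

relabel : ∀ {V W : Set} → W ↔ V → Graph V → Graph W
relabel f G = record
  { adj        = λ u v → adj G (to u) (to v)
  ; adj-sym    = λ u v → adj-sym G (to u) (to v)
  ; adj-irrefl = λ u → adj-irrefl G (to u)
  }
  where open Inverse f using (to)

joinAdj : ∀ {V W : Set} → Graph V → Graph W → V ⊎ W → V ⊎ W → Bool
joinAdj G H (inj₁ u) (inj₁ v) = adj G u v
joinAdj G H (inj₁ u) (inj₂ w) = true
joinAdj G H (inj₂ w) (inj₁ u) = true
joinAdj G H (inj₂ w) (inj₂ z) = adj H w z

join : ∀ {V W : Set} → Graph V → Graph W → Graph (V ⊎ W)
join {V} {W} G H = record { adj = joinAdj G H ; adj-sym = s ; adj-irrefl = i }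
  where
  s : ∀ x y → joinAdj G H x y ≡ joinAdj G H y x
  s (inj₁ u) (inj₁ v) = adj-sym G u v
  s (inj₁ u) (inj₂ w) = refl
  s (inj₂ w) (inj₁ u) = refl
  s (inj₂ w) (inj₂ z) = adj-sym H w z

  i : ∀ x → joinAdj G H x x ≡ false
  i (inj₁ u) = adj-irrefl G u
  i (inj₂ w) = adj-irrefl H w

nonNeighbour : ∀ {n} → Graph (Fin n) → Fin n → Fin n → Bool
nonNeighbour G i j = not (does (i ≟ j)) ∧ not (adj G i j)

nonNeighbour-sym : ∀ {n} (G : Graph (Fin n)) i j →
                   nonNeighbour G i j ≡ nonNeighbour G j i
nonNeighbour-sym G i j with i ≟ j | j ≟ i
... | yes _ | yes _ = refl
... | yes p | no ¬p = ⊥-elim (¬p (sym p))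
... | no ¬p | yes p = ⊥-elim (¬p (sym p))
... | no _  | no _  rewrite adj-sym G i j = refl

-- Vertices: inj₁ (inj₁ i) is uᵢ, inj₁ (inj₂ w) is the vertex w of H,
-- and inj₂ i is the new vertex uᵢ′.
nnsAdj : ∀ {n} {W : Set} → Graph (Fin n) → Graph W →
         (Fin n ⊎ W) ⊎ Fin n → (Fin n ⊎ W) ⊎ Fin n → Bool
nnsAdj G H (inj₁ x)        (inj₁ y)        = adj (join G H) x y
nnsAdj G H (inj₁ (inj₁ j)) (inj₂ i)        = nonNeighbour G i j
nnsAdj G H (inj₁ (inj₂ w)) (inj₂ i)        = false
nnsAdj G H (inj₂ i)        (inj₁ (inj₁ j)) = nonNeighbour G i j
nnsAdj G H (inj₂ i)        (inj₁ (inj₂ w)) = false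
nnsAdj G H (inj₂ i)        (inj₂ j)        = false

nnsJoin⊎ : ∀ {n} {W : Set} → Graph (Fin n) → Graph W →
           Graph ((Fin n ⊎ W) ⊎ Fin n)
nnsJoin⊎ G H = record { adj = nnsAdj G H ; adj-sym = s ; adj-irrefl = i }
  where
  s : ∀ x y → nnsAdj G H x y ≡ nnsAdj G H y x
  s (inj₁ x)        (inj₁ y)        = adj-sym (join G H) x y
  s (inj₁ (inj₁ j)) (inj₂ i)        = refl
  s (inj₁ (inj₂ w)) (inj₂ i)        = refl
  s (inj₂ i)        (inj₁ (inj₁ j)) = refl
  s (inj₂ i)        (inj₁ (inj₂ w)) = refl
  s (inj₂ i)        (inj₂ j)        = refl

  i : ∀ x → nnsAdj G H x x ≡ false
  i (inj₁ x) = adj-irrefl (join G H) x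
  i (inj₂ _) = refl

nnsJoin : ∀ {n₁ n₂} → Graph (Fin n₁) → Graph (Fin n₂) →
          Graph (Fin ((n₁ ℕ.+ n₂) ℕ.+ n₁))
nnsJoin {n₁} {n₂} G H =
  relabel ((+↔⊎ ⊎-↔ ↔-id (Fin n₁)) ↔-∘ +↔⊎) (nnsJoin⊎ G H)

------------------------------------------------------------------------
-- The real numbers enter only as a real closed field: a discrete ordered
-- field with the intermediate value property for polynomials.  Classically
-- ℝ is an instance, and over every such field the characteristic polynomial
-- of a symmetric matrix splits into linear factors.

record RealClosedField (c ℓ₁ ℓ₂ : Level) : Set (lsuc (c ⊔ ℓ₁ ⊔ ℓ₂)) where
  field
    commutativeRing : CommutativeRing c ℓ₁

  open CommutativeRing commutativeRing public hiding (zero)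
  open AlgebraDefinitions _≈_ using (Invertible)

  infix 4 _≤_

  field
    _≤_             : Rel Carrier ℓ₂
    isDecTotalOrder : IsDecTotalOrder _≈_ _≤_
    0≉1             : ¬ (0# ≈ 1#)
    invertible      : ∀ {x} → ¬ (x ≈ 0#) → Invertible 1# _*_ x
    +-monoʳ-≤       : ∀ x {y z} → y ≤ z → x + y ≤ x + z
    *-nonneg        : ∀ {x y} → 0# ≤ x → 0# ≤ y → 0# ≤ x * y

  -- Coefficients are listed from the constant term upwards.
  eval : List Carrier → Carrier → Carrier
  eval p x = foldr (λ a v → a + x * v) 0# p

  field
    intermediateValue : ∀ p {a b} → a ≤ b → eval p a ≤ 0# → 0# ≤ eval p b →
                        ∃ λ z → a ≤ z × z ≤ b × eval p z ≈ 0#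

------------------------------------------------------------------------
-- Matrices and spectra

module Spectral {c ℓ₁ ℓ₂} (F : RealClosedField c ℓ₁ ℓ₂) where

  open RealClosedField F
  open Summation +-commutativeMonoid using (sum)
  open Powers semiring using (_^_)

  ι : ℕ → Carrier
  ι n = n · 1#
    where open Multiples +-monoid renaming (_×_ to _·_)

  Matrix : ℕ → Set c
  Matrix n = Fin n → Fin n → Carrier

  -- Laplace expansion along the first row.
  det : ∀ {n} → Matrix n → Carrier
  det {zero}  M = 1#
  det {suc n} M = sum λ j →
    (- 1#) ^ toℕ j * (M zero j * det λ k l → M (suc k) (punchIn j l))

  diagonal : ∀ {n} → (Fin n → Carrier) → Matrix n
  diagonal d i j = if does (i ≟ j) then d i else 0#

  adjacency : ∀ {n} → Graph (Fin n) → Matrix n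
  adjacency G i j = if adj G i j then 1# else 0#

  signlessLaplacian : ∀ {n} → Graph (Fin n) → Matrix n
  signlessLaplacian G i j =
    diagonal (λ u → ι (degree G u)) i j + adjacency G i j

  charPoly : ∀ {n} → Matrix n → Carrier → Carrier
  charPoly M x = det λ i j → diagonal (λ _ → x) i j - M i j

  -- For a monic polynomial function f: the list contains all roots of f,
  -- each repeated according to its multiplicity.  As the field is infinite,
  -- agreeing at every point is the same as equality of polynomials; in
  -- particular the length of the list is the degree of f.
  Roots : (Carrier → Carrier) → List Carrier → Set (c ⊔ ℓ₁)
  Roots f ρs = ∀ x → f x ≈ foldr (λ ρ v → (x - ρ) * v) 1# ρs

  -- The multiset of eigenvalues, with algebraic multiplicity, in any order.
  Spectrum : ∀ {n} → Matrix n → List Carrier → Set (c ⊔ ℓ₁)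
  Spectrum M = Roots (charPoly M)

  Decreasing : ∀ {n} → (Fin n → Carrier) → Set ℓ₂
  Decreasing ν = ∀ {i j} → i Fin.≤ j → ν j ≤ ν i

{-# OPTIONS --safe #-}
module Submission where

-- For all large x the matrix x I - Q of the NNS join can be reduced by two Schur complements: first along the
-- scalar block w I of the new vertices, then along the block of G₂, whose constant column sums y let the
-- all-ones border be cleared.  What remains is w X = - ((p I - A)(q I - A) + e J), where A is the adjacency
-- matrix of G₁ and p, q are the roots of λ² + (w + 2) λ + 1 - w (x - n₁ - n₂ + 1); they lie in the field
-- because x is large.  Determinants being multiplicative, the characteristic polynomial of the join is
-- expressed through those of Q(G₁) and Q(G₂) at p + r₁, q + r₁ and x - n₁.  The factors belonging to the
-- all-ones vectors, that is to ν₁ = 2r₁ and μ₁ = 2r₂, combine with e into the cubic.  Both sides being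
-- polynomials, the identity for large x holds for all x.
--
-- That 2r is the largest signless Laplacian eigenvalue of an r-regular graph follows from x I - Q being a
-- nonsingular M-matrix for x > 2r.

open import Defs
open import Level using (_⊔_)
import Algebra.Properties.CommutativeMonoid.Sum as CommutativeMonoidSum
import Algebra.Properties.Monoid.Mult as MonoidMultiples
import Algebra.Properties.Ring as RingProperties
import Algebra.Properties.Semiring.Exp as Powers
import Algebra.Properties.Semiring.Mult as Multiples
import Algebra.Properties.Semiring.Sum as SemiringSum
import Algebra.Solver.Ring
open import Algebra.Solver.Ring.AlmostCommutativeRing using (fromCommutativeRing; _-Raw-AlmostCommutative⟶_)
open import Data.Bool.Base using (Bool; true; false; if_then_else_)
open import Data.Fin.Base using (Fin; zero; suc; toℕ; punchIn; punchOut; splitAt; _↑ˡ_; _↑ʳ_)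
open import Data.Fin.Properties using (suc-injective; punchIn-punchOut; splitAt-↑ˡ; splitAt-↑ʳ; toℕ-↑ˡ)
  renaming (_≟_ to _≟ꟳ_)
open import Data.Fin.Subset using (∣_∣)
open import Data.Integer.Base as ℤ using (ℤ; +_; -[1+_]; +0; +[1+_])
import Data.Integer.Properties as ℤP
open import Data.List.Base using (List; []; _∷_; _++_; foldr; length; map; tabulate; concat)
open import Data.Maybe.Base using (just; nothing)
open import Data.Nat.Base as ℕ using (ℕ; zero; suc; z≤n)
import Data.Nat.Properties as ℕP
open import Data.Product.Base using (∃; Σ-syntax; ∃-syntax; _×_; _,_; proj₁; proj₂)
open import Data.Sum.Base as Sum using (_⊎_; inj₁; inj₂)
import Data.Vec.Base as Vec
open import Data.Vec.Functional using (tail; insertAt; removeAt; updateAt) renaming (_∷_ to infixr 5 _∷ᵛ_)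
open import Data.Vec.Functional.Properties
  using (updateAt-updates; updateAt-minimal; insertAt-lookup; insertAt-punchIn)
open import Function.Base using (_∘_; const)
open import Relation.Binary.Definitions using (WeaklyDecidable)
open import Relation.Binary.PropositionalEquality as ≡ using (_≡_; _≢_; _≗_)
open import Relation.Binary.Structures using (IsDecTotalOrder)
open import Relation.Nullary using (¬_; yes; no; contradiction)

-- Spectra are given as factorisations of characteristic polynomials, so no eigenvectors occur and
-- every step is an identity of determinants. Hence the splitting (p I - A)(q I - A): its
-- determinant consists of two values of the characteristic polynomial of Q(G₁) = r₁ I + A, and each
-- eigenvalue ν enters through (p + r₁ - ν)(q + r₁ - ν), up to sign the quadratic of the statement.
-- The J terms come from the borders of G₂ and from the square of J - I - A, where A J = r₁ J. They
-- are absorbed because the product has constant row sums: adding e J to it is multiplying it by I +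
-- g J with g = e / ((p - r₁)(q - r₁)). Large x also keeps every divisor away from zero. The
-- statement asks for the roots themselves, so the quadratics and the cubic must be shown to split:
-- the discriminants are sums of two squares, and the cubic changes sign at explicit points.
-- Determinants are Laplace expansions along the first row; their multiplicativity is derived from
-- the uniqueness of alternating forms.

module Field {c ℓ₁ ℓ₂} (F : RealClosedField c ℓ₁ ℓ₂) where

  -- Integer coefficients for the ring solver

  open RealClosedField F
  open Spectral F using (ι)
  open Multiples semiring using (×-homo-+)
  open RingProperties ring
  open import Relation.Binary.Reasoning.Setoid setoid

  -- The value at 1 is singled out so that the solver's constant 1 is 1# itself and not ι 1 = 1# + 0#.
  fromℤ : ℤ → Carrier
  fromℤ +0        = 0#
  fromℤ +[1+ 0 ]  = 1#
  fromℤ +[1+ suc n ] = ι (2 ℕ.+ n)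
  fromℤ -[1+ n ]  = - ι (suc n)

  private
    fromℤ-+ : ∀ n → fromℤ (+ n) ≈ ι n
    fromℤ-+ zero          = refl
    fromℤ-+ (suc zero)    = sym (+-identityʳ 1#)
    fromℤ-+ (suc (suc n)) = refl

    ι-⊖ : ∀ m n → fromℤ (m ℤ.⊖ n) ≈ ι m - ι n
    ι-⊖ zero    zero    = sym (-‿inverseʳ 0#)
    ι-⊖ zero    (suc n) = sym (+-identityˡ _)
    ι-⊖ (suc m) zero    = trans (fromℤ-+ (suc m)) (sym (trans (+-congˡ -0#≈0#) (+-identityʳ _)))
    ι-⊖ (suc m) (suc n) = begin
      fromℤ (suc m ℤ.⊖ suc n)       ≡⟨ ≡.cong fromℤ (ℤP.[1+m]⊖[1+n]≡m⊖n m n) ⟩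
      fromℤ (m ℤ.⊖ n)               ≈⟨ ι-⊖ m n ⟩
      ι m - ι n                     ≈⟨ +-congʳ (+-identityˡ _) ⟨
      0# + ι m - ι n                ≈⟨ +-congʳ (+-congʳ (-‿inverseʳ 1#)) ⟨
      1# - 1# + ι m - ι n           ≈⟨ +-congʳ (+-assoc _ _ _) ⟩
      1# + (- 1# + ι m) - ι n       ≈⟨ +-congʳ (+-congˡ (+-comm _ _)) ⟩
      1# + (ι m - 1#) - ι n         ≈⟨ +-congʳ (+-assoc _ _ _) ⟨
      1# + ι m - 1# - ι n           ≈⟨ +-assoc _ _ _ ⟩
      1# + ι m + (- 1# - ι n)       ≈⟨ +-congˡ (-‿+-comm 1# (ι n)) ⟩
      ι (suc m) - ι (suc n)         ∎

    fromℤ-neg : ∀ i → fromℤ (ℤ.- i) ≈ - fromℤ i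
    fromℤ-neg +0              = sym -0#≈0#
    fromℤ-neg +[1+ zero ]     = -‿cong (+-identityʳ 1#)
    fromℤ-neg +[1+ suc n ]    = refl
    fromℤ-neg -[1+ zero ]     = trans (sym (+-identityʳ 1#)) (sym (-‿involutive _))
    fromℤ-neg -[1+ suc n ]    = sym (-‿involutive _)

    fromℤ-homo-+ : ∀ i j → fromℤ (i ℤ.+ j) ≈ fromℤ i + fromℤ j
    fromℤ-homo-+ (+ m) (+ n) = begin
      fromℤ (+ (m ℕ.+ n))    ≈⟨ fromℤ-+ (m ℕ.+ n) ⟩
      ι (m ℕ.+ n)            ≈⟨ ×-homo-+ 1# m n ⟩
      ι m + ι n              ≈⟨ +-cong (fromℤ-+ m) (fromℤ-+ n) ⟨
      fromℤ (+ m) + fromℤ (+ n) ∎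
    fromℤ-homo-+ (+ m) -[1+ n ] = trans (ι-⊖ m (suc n)) (+-congʳ (sym (fromℤ-+ m)))
    fromℤ-homo-+ -[1+ m ] (+ n) =
      trans (ι-⊖ n (suc m)) (trans (+-congʳ (sym (fromℤ-+ n))) (+-comm _ _))
    fromℤ-homo-+ -[1+ m ] -[1+ n ] = begin
      - ι (suc (suc (m ℕ.+ n)))  ≡⟨ ≡.cong (λ k → - ι (suc k)) (ℕP.+-suc m n) ⟨
      - ι (suc m ℕ.+ suc n)      ≈⟨ -‿cong (×-homo-+ 1# (suc m) (suc n)) ⟩
      - (ι (suc m) + ι (suc n))  ≈⟨ -‿+-comm _ _ ⟨
      - ι (suc m) - ι (suc n)    ∎

    fromℤ-homo-+* : ∀ m j → fromℤ (+ m ℤ.* j) ≈ ι m * fromℤ j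
    fromℤ-homo-+* zero    j = sym (zeroˡ _)
    fromℤ-homo-+* (suc m) j = begin
      fromℤ (+ suc m ℤ.* j)            ≡⟨ ≡.cong fromℤ (ℤP.suc-* (+ m) j) ⟩
      fromℤ (j ℤ.+ + m ℤ.* j)          ≈⟨ fromℤ-homo-+ j (+ m ℤ.* j) ⟩
      fromℤ j + fromℤ (+ m ℤ.* j)      ≈⟨ +-cong (sym (*-identityˡ _)) (fromℤ-homo-+* m j) ⟩
      1# * fromℤ j + ι m * fromℤ j     ≈⟨ distribʳ _ _ _ ⟨
      ι (suc m) * fromℤ j              ∎

    fromℤ-homo-* : ∀ i j → fromℤ (i ℤ.* j) ≈ fromℤ i * fromℤ j
    fromℤ-homo-* (+ m) j = trans (fromℤ-homo-+* m j) (*-congʳ (sym (fromℤ-+ m)))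
    fromℤ-homo-* -[1+ m ] j = begin
      fromℤ (-[1+ m ] ℤ.* j)           ≡⟨ ≡.cong fromℤ (ℤP.neg-distribˡ-* (+ suc m) j) ⟨
      fromℤ (ℤ.- (+ suc m ℤ.* j))      ≈⟨ fromℤ-neg (+ suc m ℤ.* j) ⟩
      - fromℤ (+ suc m ℤ.* j)          ≈⟨ -‿cong (fromℤ-homo-+* (suc m) j) ⟩
      - (ι (suc m) * fromℤ j)          ≈⟨ -‿distribˡ-* _ _ ⟩
      - ι (suc m) * fromℤ j            ∎

    fromℤ-homomorphism : ℤ.+-*-rawRing -Raw-AlmostCommutative⟶ fromCommutativeRing commutativeRing
    fromℤ-homomorphism = record
      { ⟦_⟧    = fromℤ
      ; +-homo = fromℤ-homo-+
      ; *-homo = fromℤ-homo-*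
      ; -‿homo = fromℤ-neg
      ; 0-homo = refl
      ; 1-homo = refl
      }

    fromℤ-≟ : WeaklyDecidable (λ i j → fromℤ i ≈ fromℤ j)
    fromℤ-≟ i j with i ℤP.≟ j
    ... | yes ≡.refl = just refl
    ... | no  _      = nothing

  open Algebra.Solver.Ring ℤ.+-*-rawRing (fromCommutativeRing commutativeRing)
    fromℤ-homomorphism fromℤ-≟ public
    using (Polynomial; solve; con; _:=_; _:+_; _:*_; _:-_; :-_)

  :1 :2 : ∀ {n} → Polynomial n
  :1 = con (+ 1)
  :2 = con (+ 2)

  -- Arithmetic of the ordered field

  module ≤ = IsDecTotalOrder isDecTotalOrder
  open ≤ public using (_≟_)

  Positive : Carrier → Set _
  Positive x = 0# ≤ x × ¬ (x ≈ 0#)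

  opaque
    ≤-resp : ∀ {x y x′ y′} → x ≈ x′ → y ≈ y′ → x ≤ y → x′ ≤ y′
    ≤-resp x≈x′ y≈y′ x≤y = ≤.trans (≤.reflexive (sym x≈x′)) (≤.trans x≤y (≤.reflexive y≈y′))

    +-nonneg : ∀ {x y} → 0# ≤ x → 0# ≤ y → 0# ≤ x + y
    +-nonneg {x} 0≤x 0≤y = ≤.trans 0≤x (≤-resp (+-identityʳ x) refl (+-monoʳ-≤ x 0≤y))

    x≤y⇒0≤y-x : ∀ {x y} → x ≤ y → 0# ≤ y - x
    x≤y⇒0≤y-x {x} {y} x≤y = ≤-resp (-‿inverseˡ x) (+-comm (- x) y) (+-monoʳ-≤ (- x) x≤y)

    0≤y-x⇒x≤y : ∀ {x y} → 0# ≤ y - x → x ≤ y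
    0≤y-x⇒x≤y {x} {y} p = ≤-resp (+-identityʳ x) (solve 2 (λ x y → x :+ (y :- x) := y) refl x y) (+-monoʳ-≤ x p)

    x≤0⇒0≤-x : ∀ {x} → x ≤ 0# → 0# ≤ - x
    x≤0⇒0≤-x p = ≤-resp refl (+-identityˡ _) (x≤y⇒0≤y-x p)

    0≤-x⇒x≤0 : ∀ {x} → 0# ≤ - x → x ≤ 0#
    0≤-x⇒x≤0 p = 0≤y-x⇒x≤y (≤-resp refl (sym (+-identityˡ _)) p)

    square-nonneg : ∀ x → 0# ≤ x * x
    square-nonneg x with ≤.total 0# x
    ... | inj₁ 0≤x = *-nonneg 0≤x 0≤x
    ... | inj₂ x≤0 = ≤-resp refl (solve 1 (λ x → :- x :* :- x := x :* x) refl x)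
                            (*-nonneg (x≤0⇒0≤-x x≤0) (x≤0⇒0≤-x x≤0))

    positive-resp : ∀ {x y} → x ≈ y → Positive x → Positive y
    positive-resp x≈y (0≤x , x≉0) = ≤-resp refl x≈y 0≤x , λ y≈0 → x≉0 (trans x≈y y≈0)

    0≤1 : 0# ≤ 1#
    0≤1 = ≤-resp refl (*-identityˡ 1#) (square-nonneg 1#)

    1-positive : Positive 1#
    1-positive = 0≤1 , λ 1≈0 → 0≉1 (sym 1≈0)

    positive-+-nonneg : ∀ {x y} → Positive x → 0# ≤ y → Positive (x + y)
    positive-+-nonneg {x} {y} (0≤x , x≉0) 0≤y = +-nonneg 0≤x 0≤y , λ x+y≈0 →
      x≉0 (≤.antisym (≤-resp (+-identityʳ x) x+y≈0 (+-monoʳ-≤ x 0≤y)) 0≤x)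

    ι-nonneg : ∀ n → 0# ≤ ι n
    ι-nonneg zero    = ≤.refl
    ι-nonneg (suc n) = +-nonneg 0≤1 (ι-nonneg n)

    ι-suc-positive : ∀ n → Positive (ι (suc n))
    ι-suc-positive n = positive-+-nonneg 1-positive (ι-nonneg n)

    _⁻¹⟨_⟩ : ∀ x → ¬ (x ≈ 0#) → Carrier
    x ⁻¹⟨ x≉0 ⟩ = proj₁ (invertible x≉0)

    *-inverseʳ : ∀ {x} (x≉0 : ¬ (x ≈ 0#)) → x * x ⁻¹⟨ x≉0 ⟩ ≈ 1#
    *-inverseʳ x≉0 = proj₂ (proj₂ (invertible x≉0))

    *-cancelˡ-0 : ∀ {x y} → ¬ (x ≈ 0#) → x * y ≈ 0# → y ≈ 0#
    *-cancelˡ-0 {x} {y} x≉0 xy≈0 = begin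
      y              ≈⟨ *-identityˡ y ⟨
      1# * y         ≈⟨ *-congʳ (*-inverseʳ x≉0) ⟨
      x * x′ * y     ≈⟨ solve 3 (λ x x′ y → x :* x′ :* y := x′ :* (x :* y)) refl x x′ y ⟩
      x′ * (x * y)   ≈⟨ *-congˡ xy≈0 ⟩
      x′ * 0#        ≈⟨ zeroʳ x′ ⟩
      0#             ∎
      where
      x′ : Carrier
      x′ = x ⁻¹⟨ x≉0 ⟩

    *-cancelˡ : ∀ {x y z} → ¬ (x ≈ 0#) → x * y ≈ x * z → y ≈ z
    *-cancelˡ {x} {y} {z} x≉0 p = x∙y⁻¹≈ε⇒x≈y y z (*-cancelˡ-0 x≉0 (begin
      x * (y - z)    ≈⟨ solve 3 (λ x y z → x :* (y :- z) := x :* y :- x :* z) refl x y z ⟩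
      x * y - x * z  ≈⟨ +-congʳ p ⟩
      x * z - x * z  ≈⟨ -‿inverseʳ _ ⟩
      0#             ∎))

    *-≉0 : ∀ {x y} → ¬ (x ≈ 0#) → ¬ (y ≈ 0#) → ¬ (x * y ≈ 0#)
    *-≉0 x≉0 y≉0 xy≈0 = y≉0 (*-cancelˡ-0 x≉0 xy≈0)

    *-positive : ∀ {x y} → Positive x → Positive y → Positive (x * y)
    *-positive (0≤x , x≉0) (0≤y , y≉0) = *-nonneg 0≤x 0≤y , *-≉0 x≉0 y≉0

    -- The inverse equals x times its own square.
    inverse-nonneg : ∀ {x} (x>0 : Positive x) → 0# ≤ x ⁻¹⟨ proj₂ x>0 ⟩
    inverse-nonneg {x} (0≤x , x≉0) = ≤-resp refl
      (trans (solve 2 (λ x x′ → x :* (x′ :* x′) := x′ :* (x :* x′)) refl x x′)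
             (trans (*-congˡ (*-inverseʳ x≉0)) (*-identityʳ x′)))
      (*-nonneg 0≤x (square-nonneg x′))
      where
      x′ : Carrier
      x′ = x ⁻¹⟨ x≉0 ⟩

    -- The polynomial z² - d takes the value - d at 0 and 1 + d + d² at 1 + d, so the intermediate
    -- value property applies between these points.
    square-root : ∀ {d} → 0# ≤ d → ∃ λ z → z * z ≈ d
    square-root {d} 0≤d =
      let 0≤1+d = +-nonneg 0≤1 0≤d
          (z , _ , _ , p) = intermediateValue (- d ∷ 0# ∷ 1# ∷ []) 0≤1+d
            (0≤-x⇒x≤0 (≤-resp refl (solve 1 (λ d → d := :- ev d (con +0)) refl d) 0≤d))
            (≤-resp refl (solve 1 (λ d → :1 :+ d :+ d :* d := ev d (:1 :+ d)) refl d)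
                    (+-nonneg (+-nonneg 0≤1 0≤d) (*-nonneg 0≤d 0≤d)))
      in z , (begin
        z * z                ≈⟨ solve 2 (λ z d → z :* z := d :+ ev d z) refl z d ⟩
        d + eval (- d ∷ 0# ∷ 1# ∷ []) z  ≈⟨ +-congˡ p ⟩
        d + 0#               ≈⟨ +-identityʳ d ⟩
        d                    ∎)
      where
      ev : ∀ {n} → Polynomial n → Polynomial n → Polynomial n
      ev d x = :- d :+ x :* (con +0 :+ x :* (:1 :+ x :* con +0))

-- Every index is either j or in the image of `punchIn j`; this is the case distinction for vectors
-- built with `insertAt`.
punchIn-elim : ∀ {n p} (P : Fin (suc n) → Set p) j → P j → (∀ l → P (punchIn j l)) → ∀ l → P l
punchIn-elim P j Pj Pp l with j ≟ꟳ l
... | yes ≡.refl = Pj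
... | no  j≢l    = ≡.subst P (punchIn-punchOut j≢l) (Pp (punchOut j≢l))

-- Deleting a column of the left block leaves a block matrix with the same right block. Needed when
-- a glued matrix is expanded along its first row.
splitAt-punchIn : ∀ p {q} (j : Fin (suc p)) (l : Fin (p ℕ.+ q)) →
                  splitAt (suc p) (punchIn (j ↑ˡ q) l) ≡ Sum.map₁ (punchIn j) (splitAt p l)
splitAt-punchIn p       zero    l       = ≡.refl
splitAt-punchIn (suc p) (suc j) zero    = ≡.refl
splitAt-punchIn (suc p) (suc j) (suc l) rewrite splitAt-punchIn p j l with splitAt p l
... | inj₁ _ = ≡.refl
... | inj₂ _ = ≡.refl

-- Finite sums, and the determinant as an alternating form

module Determinant {c ℓ₁ ℓ₂} (F : RealClosedField c ℓ₁ ℓ₂) where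

  open RealClosedField F
  open Spectral F
  open Field F
  open CommutativeMonoidSum +-commutativeMonoid
    using (sum; sum-cong-≋; sum-replicate; sum-replicate-zero; ∑-distrib-+; ∑-comm)
  open SemiringSum semiring using (*-distribˡ-sum; *-distribʳ-sum)
  open Powers semiring public using (_^_)
  open Multiples semiring using (×-assoc-*)
  open MonoidMultiples +-monoid using (×-congʳ)
  open RingProperties ring
  open import Relation.Binary.Reasoning.Setoid setoid

  δ : ∀ {n} → Matrix n
  δ = diagonal (λ _ → 1#)

  minor : ∀ {n} → Matrix (suc n) → Fin (suc n) → Matrix n
  minor M j k l = M (suc k) (punchIn j l)

  sign : ∀ {n} → Fin n → Carrier
  sign j = (- 1#) ^ toℕ j

  -- Opaque copies of sum and det: the originals unfold at a successor, and then
  -- their arguments can no longer be inferred.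
  opaque
    ∑ : ∀ {n} → (Fin n → Carrier) → Carrier
    ∑ = sum

    ∑-empty : (f : Fin 0 → Carrier) → ∑ f ≈ 0#
    ∑-empty f = refl

    ∑-suc : ∀ {n} (f : Fin (suc n) → Carrier) → ∑ f ≈ f zero + ∑ (f ∘ suc)
    ∑-suc f = refl

    ∑-cong : ∀ {n} {f g : Fin n → Carrier} → (∀ i → f i ≈ g i) → ∑ f ≈ ∑ g
    ∑-cong = sum-cong-≋

    ∑-zero : ∀ {n} {f : Fin n → Carrier} → (∀ i → f i ≈ 0#) → ∑ f ≈ 0#
    ∑-zero {n} f≈0 = trans (sum-cong-≋ f≈0) (sum-replicate-zero n)

    ∑-const : ∀ n x → ∑ {n} (λ _ → x) ≈ ι n * x
    ∑-const n x = trans (sum-replicate n) (sym (trans (×-assoc-* n 1# x) (×-congʳ n (*-identityˡ x))))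

    ∑-+ : ∀ {n} (f g : Fin n → Carrier) → ∑ (λ i → f i + g i) ≈ ∑ f + ∑ g
    ∑-+ = ∑-distrib-+

    ∑-swap : ∀ {m n} (f : Fin m → Fin n → Carrier) → ∑ (λ i → ∑ (f i)) ≈ ∑ (λ j → ∑ (λ i → f i j))
    ∑-swap = ∑-comm

    *-distribˡ-∑ : ∀ {n} x (f : Fin n → Carrier) → x * ∑ f ≈ ∑ (λ i → x * f i)
    *-distribˡ-∑ = *-distribˡ-sum

    *-distribʳ-∑ : ∀ {n} x (f : Fin n → Carrier) → ∑ f * x ≈ ∑ (λ i → f i * x)
    *-distribʳ-∑ = *-distribʳ-sum

    ∑-δˡ : ∀ {n} i (f : Fin n → Carrier) → ∑ (λ k → δ i k * f k) ≈ f i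
    ∑-δˡ zero    f = trans (+-cong (*-identityˡ _) (∑-zero (λ k → zeroˡ (f (suc k))))) (+-identityʳ _)
    ∑-δˡ (suc i) f = trans (+-cong (zeroˡ _) (∑-δˡ i (f ∘ suc))) (+-identityˡ _)

    ∑-δʳ : ∀ {n} j (f : Fin n → Carrier) → ∑ (λ k → f k * δ k j) ≈ f j
    ∑-δʳ zero    f = trans (+-cong (*-identityʳ _) (∑-zero (λ k → zeroʳ (f (suc k))))) (+-identityʳ _)
    ∑-δʳ (suc j) f = trans (+-cong (zeroʳ _) (∑-δʳ j (f ∘ suc))) (+-identityˡ _)

    ∑-↑ : ∀ p {q} (f : Fin (p ℕ.+ q) → Carrier) →
          ∑ f ≈ ∑ (λ i → f (i ↑ˡ q)) + ∑ (λ j → f (p ↑ʳ j))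
    ∑-↑ zero    f = sym (+-identityˡ _)
    ∑-↑ (suc p) f = trans (+-congˡ (∑-↑ p (f ∘ suc))) (sym (+-assoc _ _ _))

    Det : ∀ {n} → Matrix n → Carrier
    Det = det

    Det≈det : ∀ {n} (M : Matrix n) → Det M ≈ det M
    Det≈det M = refl

    Det-empty : (M : Matrix 0) → Det M ≈ 1#
    Det-empty M = refl

    Det-expand : ∀ {n} (M : Matrix (suc n)) → Det M ≈ ∑ (λ j → sign j * (M zero j * Det (minor M j)))
    Det-expand M = refl

  ∑-neg : ∀ {n} (f : Fin n → Carrier) → ∑ (λ i → - f i) ≈ - ∑ f
  ∑-neg f = trans (∑-cong (λ i → sym (-1*x≈-x (f i)))) (trans (sym (*-distribˡ-∑ (- 1#) f)) (-1*x≈-x _))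

  ∑-splitAt : ∀ p {q} (f : Fin p ⊎ Fin q → Carrier) → ∑ (f ∘ splitAt p) ≈ ∑ (f ∘ inj₁) + ∑ (f ∘ inj₂)
  ∑-splitAt p {q} f = trans (∑-↑ p (f ∘ splitAt p)) (+-cong
    (∑-cong (λ i → reflexive (≡.cong f (splitAt-↑ˡ p i q))))
    (∑-cong (λ j → reflexive (≡.cong f (splitAt-↑ʳ p q j)))))

  infix 4 _≈ᴹ_
  _≈ᴹ_ : ∀ {m n} (M N : Fin m → Fin n → Carrier) → Set ℓ₁
  M ≈ᴹ N = ∀ i j → M i j ≈ N i j

  Det-cong : ∀ {n} {M N : Matrix n} → M ≈ᴹ N → Det M ≈ Det N
  Det-cong {zero}  {M} {N} M≈N = trans (Det-empty M) (sym (Det-empty N))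
  Det-cong {suc n} {M} {N} M≈N = begin
    Det M                                         ≈⟨ Det-expand M ⟩
    ∑ (λ j → sign j * (M zero j * Det (minor M j)))
      ≈⟨ ∑-cong (λ j → *-congˡ (*-cong (M≈N zero j) (Det-cong λ k l → M≈N (suc k) (punchIn j l)))) ⟩
    ∑ (λ j → sign j * (N zero j * Det (minor N j))) ≈⟨ Det-expand N ⟨
    Det N                                         ∎

  -- The determinant as the alternating multilinear form of the rows

  AgreeOff : ∀ {n} → Fin n → Matrix n → Matrix n → Set ℓ₁
  AgreeOff i M N = ∀ {k} → k ≢ i → ∀ j → M k j ≈ N k j

  -- Additivity and homogeneity in a row are one axiom. It speaks of any three matrices that agree
  -- elsewhere, so it applies without first bringing them into the form of row updates.
  record Multilinear {n} (D : Matrix n → Carrier) : Set (c ⊔ ℓ₁) where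
    field
      cong   : ∀ {M N} → M ≈ᴹ N → D M ≈ D N
      linear : ∀ i {L M N} a → AgreeOff i L N → AgreeOff i M N →
               (∀ j → N i j ≈ L i j + a * M i j) → D N ≈ D L + a * D M

  record Alternating {n} (D : Matrix n → Carrier) : Set (c ⊔ ℓ₁) where
    field
      multilinear : Multilinear D
      alternating : ∀ {i j} → i ≢ j → ∀ M → (∀ k → M i k ≈ M j k) → D M ≈ 0#
    open Multilinear multilinear public

  module _ {n} {D : Matrix n → Carrier} (multilinear : Multilinear D) where
    open Multilinear multilinear

    -- With u + v in both rows, D vanishes and expands into D(u,u) + D(u,v) + D(v,u) + D(v,v), whose
    -- outer terms vanish too. Vanishing is assumed for this pair of rows only, so that the lemma
    -- can already be applied while `Det-alternating` is being proved.
    antisymmetric : ∀ {i j} → i ≢ j → (∀ M → (∀ k → M i k ≈ M j k) → D M ≈ 0#) →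
                    ∀ {M N} → (∀ k → N i k ≈ M j k) → (∀ k → N j k ≈ M i k) →
                    (∀ {t} → t ≢ i → t ≢ j → ∀ k → N t k ≈ M t k) → D N ≈ - D M
    antisymmetric {i} {j} i≢j alt {M} {N} Ni Nj Nt = begin
      D N                                  ≈⟨ solve 2 (λ x y → y := (con +0 :+ x) :+ (y :+ con +0) :- x) refl (D M) (D N) ⟩
      (0# + D M) + (D N + 0#) - D M        ≈⟨ +-congʳ expansion ⟨
      0# - D M                             ≈⟨ +-identityˡ _ ⟩
      - D M                                ∎
      where
      u v w : Fin n → Carrier
      u = M i
      v = M j
      w k = u k + 1# * v k

      K : (a b : Fin n → Carrier) → Matrix n
      K a b = updateAt (updateAt M j (const b)) i (const a)

      Ki : ∀ {a b} → K a b i ≡ a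
      Ki = updateAt-updates i _
      Kt : ∀ {a b t} → t ≢ i → K a b t ≡ updateAt M j (const b) t
      Kt t≢i = updateAt-minimal _ i _ t≢i
      Kj : ∀ {a b} → K a b j ≡ b
      Kj = ≡.trans (Kt (i≢j ∘ ≡.sym)) (updateAt-updates j M)
      Koff : ∀ {a b t} → t ≢ i → t ≢ j → K a b t ≡ M t
      Koff t≢i t≢j = ≡.trans (Kt t≢i) (updateAt-minimal _ j M t≢j)

      at : ∀ {a b : Fin n → Carrier} → a ≡ b → ∀ k → a k ≈ b k
      at a≡b k = reflexive (≡.cong (λ f → f k) a≡b)

      diag : ∀ a → D (K a a) ≈ 0#
      diag a = alt (K a a) (at (≡.trans Ki (≡.sym Kj)))

      linearˡ : ∀ b → D (K w b) ≈ D (K u b) + 1# * D (K v b)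
      linearˡ b = linear i 1# (λ t≢i → at (≡.trans (Kt t≢i) (≡.sym (Kt t≢i))))
                              (λ t≢i → at (≡.trans (Kt t≢i) (≡.sym (Kt t≢i))))
        λ k → trans (at Ki k) (sym (+-cong (at Ki k) (*-congˡ (at Ki k))))

      agreeʳ : ∀ a {b b′} → AgreeOff j (K a b) (K a b′)
      agreeʳ a {_} {_} {t} t≢j with t ≟ꟳ i
      ... | yes ≡.refl = at (≡.trans Ki (≡.sym Ki))
      ... | no  t≢i    = at (≡.trans (Koff t≢i t≢j) (≡.sym (Koff t≢i t≢j)))

      linearʳ : ∀ a → D (K a w) ≈ D (K a u) + 1# * D (K a v)
      linearʳ a = linear j 1# (agreeʳ a) (agreeʳ a)
        λ k → trans (at Kj k) (sym (+-cong (at Kj k) (*-congˡ (at Kj k))))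

      by-rows : ∀ {A B : Matrix n} → (∀ k → A i k ≈ B i k) → (∀ k → A j k ≈ B j k) →
                (∀ {t} → t ≢ i → t ≢ j → ∀ k → A t k ≈ B t k) → D A ≈ D B
      by-rows {A} {B} pi pj pt = cong go
        where
        go : A ≈ᴹ B
        go t k with t ≟ꟳ i | t ≟ꟳ j
        ... | yes ≡.refl | _          = pi k
        ... | no  _      | yes ≡.refl = pj k
        ... | no  t≢i    | no  t≢j    = pt t≢i t≢j k

      expansion : 0# ≈ (0# + D M) + (D N + 0#)
      expansion = begin
        0#                                    ≈⟨ diag w ⟨
        D (K w w)                             ≈⟨ linearˡ w ⟩
        D (K u w) + 1# * D (K v w)            ≈⟨ +-cong (linearʳ u) (trans (*-identityˡ _) (linearʳ v)) ⟩
        (D (K u u) + 1# * D (K u v)) + (D (K v u) + 1# * D (K v v))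
          ≈⟨ +-cong (+-cong (diag u) (trans (*-identityˡ _)
               (by-rows (at Ki) (at Kj) (λ t≢i t≢j → at (Koff t≢i t≢j)))))
             (+-cong (by-rows (λ k → trans (at Ki k) (sym (Ni k))) (λ k → trans (at Kj k) (sym (Nj k)))
               (λ t≢i t≢j k → trans (at (Koff t≢i t≢j) k) (sym (Nt t≢i t≢j k))))
                     (trans (*-identityˡ _) (diag v))) ⟩
        (0# + D M) + (D N + 0#)               ∎

  AgreeOff-zero : ∀ {n} {a b : Fin (suc n) → Carrier} {M N : Fin n → Fin (suc n) → Carrier} →
                  M ≈ᴹ N → AgreeOff zero (a ∷ᵛ M) (b ∷ᵛ N)
  AgreeOff-zero M≈N {zero}  0≢0 = contradiction ≡.refl 0≢0
  AgreeOff-zero M≈N {suc k} _   = M≈N k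

  module _ {n} {D : Matrix (suc n) → Carrier} (multilinear : Multilinear D) where
    open Multilinear multilinear

    linear-sum : ∀ {p} (a : Fin p → Carrier) (W : Fin p → Fin (suc n) → Carrier) {r N} →
                 (∀ k → r k ≈ ∑ (λ t → a t * W t k)) →
                 D (r ∷ᵛ N) ≈ ∑ (λ t → a t * D (W t ∷ᵛ N))
    linear-sum {zero} a W {r} {N} r≈0 = begin
      -- The empty sum makes r a zero row, so r = r + (-1) r and D takes the value D - D.
      D (r ∷ᵛ N)                     ≈⟨ linear zero {r ∷ᵛ N} {r ∷ᵛ N} (- 1#) (λ _ _ → refl) (λ _ _ → refl) (λ k → begin
                                         r k                 ≈⟨ trans (r≈0 k) (∑-empty _) ⟩
                                         0#                  ≈⟨ -‿inverseʳ (r k) ⟨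
                                         r k - r k           ≈⟨ +-congˡ (-1*x≈-x _) ⟨
                                         r k + - 1# * r k    ∎) ⟩
      D (r ∷ᵛ N) + - 1# * D (r ∷ᵛ N)  ≈⟨ +-congˡ (-1*x≈-x _) ⟩
      D (r ∷ᵛ N) - D (r ∷ᵛ N)         ≈⟨ -‿inverseʳ _ ⟩
      0#                            ≈⟨ ∑-empty _ ⟨
      ∑ (λ t → a t * D (W t ∷ᵛ N))   ∎
    linear-sum {suc p} a W {r} {N} r≈ = begin
      D (r ∷ᵛ N)                                  ≈⟨ linear zero {r′ ∷ᵛ N} {W zero ∷ᵛ N} (a zero)
                                                      (AgreeOff-zero {M = N} (λ _ _ → refl)) (AgreeOff-zero {M = N} (λ _ _ → refl))
                                                      (λ k → trans (r≈ k) (trans (∑-suc _) (+-comm _ _))) ⟩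
      D (r′ ∷ᵛ N) + a zero * D (W zero ∷ᵛ N)       ≈⟨ +-congʳ (linear-sum (a ∘ suc) (W ∘ suc) {r′} {N} (λ _ → refl)) ⟩
      ∑ (λ t → a (suc t) * D (W (suc t) ∷ᵛ N)) + a zero * D (W zero ∷ᵛ N)  ≈⟨ trans (∑-suc _) (+-comm _ _) ⟨
      ∑ (λ t → a t * D (W t ∷ᵛ N))              ∎
      where
      r′ : Fin (suc n) → Carrier
      r′ k = ∑ (λ t → a (suc t) * W (suc t) k)

  Det-multilinear : ∀ {n} → Multilinear (Det {n})
  Det-multilinear = record { cong = Det-cong ; linear = linear }
    where
    linear : ∀ {n} (i : Fin n) {L M N} a → AgreeOff i L N → AgreeOff i M N →
             (∀ j → N i j ≈ L i j + a * M i j) → Det N ≈ Det L + a * Det M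
    linear {suc n} i {L} {M} {N} a L≈N M≈N Ni = begin
      Det N
        ≈⟨ trans (Det-expand N) (∑-cong (term i L≈N M≈N Ni)) ⟩
      ∑ (λ j → sign j * (L zero j * Det (minor L j)) + a * (sign j * (M zero j * Det (minor M j))))
        ≈⟨ trans (∑-+ _ _) (+-congʳ (sym (Det-expand L))) ⟩
      Det L + ∑ (λ j → a * (sign j * (M zero j * Det (minor M j))))
        ≈⟨ +-congˡ (trans (*-congˡ (Det-expand M)) (*-distribˡ-∑ a _)) ⟨
      Det L + a * Det M ∎
      where
      term : ∀ i → AgreeOff i L N → AgreeOff i M N → (∀ j → N i j ≈ L i j + a * M i j) → ∀ j →
             sign j * (N zero j * Det (minor N j)) ≈
             sign j * (L zero j * Det (minor L j)) + a * (sign j * (M zero j * Det (minor M j)))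
      term zero L≈N M≈N Ni j = begin
        s * (N zero j * Det (minor N j))                     ≈⟨ *-congˡ (*-congʳ (Ni j)) ⟩
        s * ((L zero j + a * M zero j) * Det (minor N j))
          ≈⟨ solve 5 (λ s l a m d → s :* ((l :+ a :* m) :* d) := s :* (l :* d) :+ a :* (s :* (m :* d)))
               refl s (L zero j) a (M zero j) _ ⟩
        s * (L zero j * Det (minor N j)) + a * (s * (M zero j * Det (minor N j)))
          ≈⟨ +-cong (*-congˡ (*-congˡ (Det-cong λ k l → L≈N {suc k} (λ ()) (punchIn j l))))
                    (*-congˡ (*-congˡ (*-congˡ (Det-cong λ k l → M≈N {suc k} (λ ()) (punchIn j l))))) ⟨
        s * (L zero j * Det (minor L j)) + a * (s * (M zero j * Det (minor M j))) ∎
        where s = sign j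
      term (suc i) L≈N M≈N Ni j = begin
        s * (N zero j * Det (minor N j))
          ≈⟨ *-congˡ (*-congˡ (linear i a (λ k≢i l → L≈N (k≢i ∘ suc-injective) (punchIn j l))
                                          (λ k≢i l → M≈N (k≢i ∘ suc-injective) (punchIn j l)) (λ l → Ni (punchIn j l)))) ⟩
        s * (N zero j * (Det (minor L j) + a * Det (minor M j)))
          ≈⟨ solve 5 (λ s n x a y → s :* (n :* (x :+ a :* y)) := s :* (n :* x) :+ a :* (s :* (n :* y))) refl
               s (N zero j) (Det (minor L j)) a (Det (minor M j)) ⟩
        s * (N zero j * Det (minor L j)) + a * (s * (N zero j * Det (minor M j)))
          ≈⟨ +-cong (*-congˡ (*-congʳ (L≈N {zero} (λ ()) j))) (*-congˡ (*-congˡ (*-congʳ (M≈N {zero} (λ ()) j)))) ⟨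
        s * (L zero j * Det (minor L j)) + a * (s * (M zero j * Det (minor M j))) ∎
        where s = sign j

  -- d stands for the complementary minor of a pair of columns.  The terms for the ordered pairs
  -- (zero , suc k) and (suc k , zero) cancel; the others are the same sum with d ∘ lift.
  laplace-cancel : ∀ m (v : Fin (suc (suc m)) → Carrier) (d : (Fin m → Fin (suc (suc m))) → Carrier) →
    (∀ {σ τ} → σ ≗ τ → d σ ≈ d τ) →
    ∑ (λ j → sign j * (v j * ∑ (λ k →
      sign k * (v (punchIn j k) * d (λ l → punchIn j (punchIn k l)))))) ≈ 0#
  laplace-cancel m v d d-cong = begin
    ∑ (λ j → sign j * (v j * ∑ (λ k → sign k * (v (punchIn j k) * d (λ l → punchIn j (punchIn k l))))))
      ≈⟨ trans (∑-suc _) (+-congˡ (∑-cong (λ j → *-congˡ (*-congˡ (∑-suc _))))) ⟩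
    1# * (v zero * ∑ (λ k → sign k * (v (suc k) * d (λ l → suc (punchIn k l))))) +
    ∑ (λ j → - 1# * sign j * (v (suc j) * (1# * (v zero * d (λ l → punchIn (suc j) (suc l))) + rest j)))
      ≈⟨ +-cong (trans (*-identityˡ _) (*-distribˡ-∑ (v zero) _)) (∑-cong λ j →
           solve 5 (λ s vj v0 d r → :- :1 :* s :* (vj :* (:1 :* (v0 :* d) :+ r)) :=
                      :- (v0 :* (s :* (vj :* d))) :+ :- :1 :* s :* (vj :* r)) refl
             (sign j) (v (suc j)) (v zero) (d (λ l → suc (punchIn j l))) (rest j)) ⟩
    ∑ first + ∑ (λ j → - first j + - 1# * sign j * (v (suc j) * rest j))
      ≈⟨ +-congˡ (∑-+ (λ j → - first j) _) ⟩
    ∑ first + (∑ (λ j → - first j) + ∑ (λ j → - 1# * sign j * (v (suc j) * rest j)))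
      ≈⟨ +-assoc _ _ _ ⟨
    ∑ first + ∑ (λ j → - first j) + ∑ (λ j → - 1# * sign j * (v (suc j) * rest j))
      ≈⟨ +-congʳ (trans (sym (∑-+ first _)) (∑-zero (λ j → -‿inverseʳ (first j)))) ⟩
    0# + ∑ (λ j → - 1# * sign j * (v (suc j) * rest j))
      ≈⟨ +-identityˡ _ ⟩
    ∑ (λ j → - 1# * sign j * (v (suc j) * rest j))
      ≈⟨ smaller m v d d-cong ⟩
    0# ∎
    where
    first : Fin (suc m) → Carrier
    first k = v zero * (sign k * (v (suc k) * d (λ l → suc (punchIn k l))))
    rest : Fin (suc m) → Carrier
    rest j = ∑ (λ k → - 1# * sign k *
      (v (suc (punchIn j k)) * d (λ l → punchIn (suc j) (punchIn (suc k) l))))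

    smaller : ∀ m (v : Fin (suc (suc m)) → Carrier) (d : (Fin m → Fin (suc (suc m))) → Carrier) →
      (∀ {σ τ} → σ ≗ τ → d σ ≈ d τ) →
      ∑ (λ j → - 1# * sign j * (v (suc j) * ∑ (λ k → - 1# * sign k *
        (v (suc (punchIn j k)) * d (λ l → punchIn (suc j) (punchIn (suc k) l)))))) ≈ 0#
    smaller zero    v d d-cong = ∑-zero λ j → trans (*-congˡ (trans (*-congˡ (∑-empty _)) (zeroʳ (v (suc j))))) (zeroʳ _)
    smaller (suc m) v d d-cong = begin
      ∑ (λ j → - 1# * sign j * (v (suc j) * ∑ (λ k → - 1# * sign k *
        (v (suc (punchIn j k)) * d (λ l → punchIn (suc j) (punchIn (suc k) l))))))
        ≈⟨ ∑-cong (λ j → trans (*-congˡ (*-congˡ (trans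
             (∑-cong (λ k → trans
               (*-congˡ (*-congˡ (d-cong (punchIn-lift j k))))
               (*-assoc _ _ _)))
             (sym (*-distribˡ-∑ (- 1#) _)))))
             (solve 3 (λ s x y → :- :1 :* s :* (x :* (:- :1 :* y)) := s :* (x :* y)) refl
               (sign j) (v (suc j)) _)) ⟩
      ∑ (λ j → sign j * (v (suc j) * ∑ (λ k →
        sign k * (v (suc (punchIn j k)) * d (lift (λ l → punchIn j (punchIn k l)))))))
        ≈⟨ laplace-cancel m (v ∘ suc) (d ∘ lift) (λ σ≗τ → d-cong
             (λ { zero → ≡.refl ; (suc l) → ≡.cong suc (σ≗τ l) })) ⟩
      0# ∎
      where
      lift : (Fin m → Fin (suc (suc m))) → Fin (suc m) → Fin (suc (suc (suc m)))
      lift σ zero    = zero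
      lift σ (suc l) = suc (σ l)
      punchIn-lift : ∀ j k → (λ l → punchIn (suc j) (punchIn (suc k) l)) ≗ lift (λ l → punchIn j (punchIn k l))
      punchIn-lift j k zero    = ≡.refl
      punchIn-lift j k (suc l) = ≡.refl

  -- Induction on the size. If neither of the equal rows is the first, every minor has two equal
  -- rows. Rows 0 and 1 are settled by `laplace-cancel`, and row 0 paired with a later row is
  -- reduced to that case by a swap.
  Det-alternating : ∀ {n} → Alternating (Det {n})
  Det-alternating = record { multilinear = Det-multilinear ; alternating = λ {i} {j} → alternating _ i j }
    where
    minors : ∀ {n} (M : Matrix (suc n)) → (∀ j → Det (minor M j) ≈ 0#) → Det M ≈ 0#
    minors M p = trans (Det-expand M)
      (∑-zero λ j → trans (*-congˡ (trans (*-congˡ (p j)) (zeroʳ _))) (zeroʳ (sign j)))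

    first-two : ∀ {n} (M : Matrix (suc (suc n))) → (∀ k → M zero k ≈ M (suc zero) k) → Det M ≈ 0#
    first-two {n} M p = begin
      Det M
        ≈⟨ trans (Det-expand M) (∑-cong λ j → *-congˡ (*-congˡ (Det-expand (minor M j)))) ⟩
      ∑ (λ j → sign j * (M zero j * ∑ (λ k → sign k * (M (suc zero) (punchIn j k) * d (λ l → punchIn j (punchIn k l))))))
        ≈⟨ ∑-cong (λ j → *-congˡ (*-congˡ (∑-cong λ k → *-congˡ (*-congʳ (p (punchIn j k)))))) ⟨
      ∑ (λ j → sign j * (M zero j * ∑ (λ k → sign k * (M zero (punchIn j k) * d (λ l → punchIn j (punchIn k l))))))
        ≈⟨ laplace-cancel n (M zero) d (λ σ≗τ → Det-cong λ k l → reflexive (≡.cong (M (suc (suc k))) (σ≗τ l))) ⟩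
      0# ∎
      where
      d : (Fin n → Fin (suc (suc n))) → Carrier
      d σ = Det (λ k l → M (suc (suc k)) (σ l))

    VanishesOnRepeatedRows : ℕ → Set (c ⊔ ℓ₁)
    VanishesOnRepeatedRows n =
      ∀ (i j : Fin n) → i ≢ j → (M : Matrix n) → (∀ k → M i k ≈ M j k) → Det M ≈ 0#

    -- N is M with rows 1 and j + 2 exchanged. In each minor along row 0 this is a swap of two rows,
    -- which changes the sign by the induction hypothesis; the first two rows of N are equal.
    far : ∀ {n} → VanishesOnRepeatedRows (suc n) → (j : Fin n) (M : Matrix (suc (suc n))) → (∀ k → M zero k ≈ M (suc (suc j)) k) → Det M ≈ 0#
    far {n} minors-alternating j M p = begin
      Det M     ≈⟨ trans (Det-expand M) (∑-cong (λ l → trans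
                     (*-congˡ {x = sign l} (trans
                       (*-congˡ (antisymmetric Det-multilinear {zero} {suc j} (λ ())
                         (minors-alternating zero (suc j) (λ ())) {minor N l} {minor M l}
                         (λ k → reflexive (≡.cong (λ f → f (punchIn l k)) (≡.sym Nj)))
                         (λ _ → refl)
                         (λ {t} t≢0 t≢j k → reflexive (≡.cong (λ f → f (punchIn l k)) (≡.sym (Nt t t≢0 t≢j))))))
                       (sym (-‿distribʳ-* _ _))))
                     (trans (sym (-‿distribʳ-* _ _)) (sym (-1*x≈-x _))))) ⟩
      ∑ (λ l → - 1# * (sign l * (N zero l * Det (minor N l)))) ≈⟨ trans (*-congˡ (Det-expand N)) (*-distribˡ-∑ (- 1#) _) ⟨
      - 1# * Det N ≈⟨ *-congˡ (first-two N p) ⟩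
      - 1# * 0#    ≈⟨ zeroʳ _ ⟩
      0#           ∎
      where
      N : Matrix (suc (suc n))
      N zero          = M zero
      N (suc zero)    = M (suc (suc j))
      N (suc (suc k)) = updateAt (tail (tail M)) j (const (M (suc zero))) k
      Nj : N (suc (suc j)) ≡ M (suc zero)
      Nj = updateAt-updates j _
      Nt : ∀ t → t ≢ zero → t ≢ suc j → N (suc t) ≡ M (suc t)
      Nt zero    t≢0 _   = contradiction ≡.refl t≢0
      Nt (suc t) _   t≢j = updateAt-minimal t j _ (t≢j ∘ ≡.cong suc)

    alternating : ∀ n → VanishesOnRepeatedRows n
    alternating _             zero          zero          i≢j M p = contradiction ≡.refl i≢j
    alternating _             zero          (suc zero)    i≢j M p = first-two M p
    alternating (suc (suc n)) zero          (suc (suc j)) i≢j M p = far (alternating (suc n)) j M p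
    alternating _             (suc zero)    zero          i≢j M p = first-two M (λ k → sym (p k))
    alternating (suc (suc n)) (suc (suc i)) zero          i≢j M p = far (alternating (suc n)) i M (λ k → sym (p k))
    alternating (suc n)       (suc i)       (suc j)       i≢j M p =
      minors M λ l → alternating n i j (i≢j ∘ ≡.cong suc) (minor M l) (λ k → p (punchIn l k))

-- Uniqueness of alternating forms and multiplicativity

module Multiplicativity {c ℓ₁ ℓ₂} (F : RealClosedField c ℓ₁ ℓ₂) where

  open RealClosedField F
  open Spectral F
  open Field F
  open Determinant F
  open RingProperties ring
  open import Relation.Binary.Reasoning.Setoid setoid

  -- A change that E tolerates in one row while the others stay fixed may be made in all rows, one
  -- after the other. The matrices may be rectangular because in the application the top row is kept
  -- apart.
  row-by-row : ∀ {m n ℓ} (R : (a b : Fin n → Carrier) → Set ℓ) (E : (Fin m → Fin n → Carrier) → Carrier) →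
    (∀ {M N} → M ≈ᴹ N → E M ≈ E N) →
    (∀ k {M N} → (∀ {t} → t ≢ k → ∀ l → M t l ≈ N t l) → R (M k) (N k) → E M ≈ E N) →
    ∀ {M N} → (∀ k → R (M k) (N k)) → E M ≈ E N
  row-by-row {zero}  R E E-cong step MRN = E-cong λ ()
  row-by-row {suc m} R E E-cong step {M} {N} MRN = begin
    E M                    ≈⟨ step zero (λ { {zero} 0≢0 → contradiction ≡.refl 0≢0 ; {suc t} _ _ → refl }) (MRN zero) ⟩
    E (N zero ∷ᵛ tail M)    ≈⟨ row-by-row R (λ K → E (N zero ∷ᵛ K))
                                (λ p → E-cong λ { zero _ → refl ; (suc i) l → p i l })
                                (λ k p → step (suc k) λ { {zero} _ _ → refl ; {suc t} s → p (s ∘ ≡.cong suc) })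
                                (MRN ∘ suc) ⟩
    E (N zero ∷ᵛ tail N)    ≈⟨ E-cong (λ { zero _ → refl ; (suc _) _ → refl }) ⟩
    E N                    ∎

  δ-refl : ∀ {n} (j : Fin n) → δ j j ≈ 1#
  δ-refl zero    = refl
  δ-refl (suc j) = δ-refl j

  δ-punchIn : ∀ {n} (j : Fin (suc n)) l → δ j (punchIn j l) ≈ 0#
  δ-punchIn zero    l       = refl
  δ-punchIn (suc j) zero    = refl
  δ-punchIn (suc j) (suc l) = δ-punchIn j l

  insertAt-lookup-≈ : ∀ {n} (v : Fin n → Carrier) j {x} → insertAt v j x j ≈ x
  insertAt-lookup-≈ v j = reflexive (insertAt-lookup v j _)

  insertAt-punchIn-≈ : ∀ {n} (v : Fin n → Carrier) j {x} l → insertAt v j x (punchIn j l) ≈ v l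
  insertAt-punchIn-≈ v j l = reflexive (insertAt-punchIn v j _ l)

  insertAt-cong : ∀ {n} {u v : Fin n → Carrier} j {x} → (∀ l → u l ≈ v l) → ∀ l → insertAt u j x l ≈ insertAt v j x l
  insertAt-cong {u = u} {v} j u≈v = punchIn-elim _ j
    (trans (insertAt-lookup-≈ u j) (sym (insertAt-lookup-≈ v j)))
    (λ l → trans (insertAt-punchIn-≈ u j l) (trans (u≈v l) (sym (insertAt-punchIn-≈ v j l))))

  module _ {n} (D : Matrix (suc n) → Carrier) (j : Fin (suc n)) where

    -- K with a column of zeros inserted at position j and the unit vector δ j put on top. Through
    -- this embedding an alternating form of size n + 1 gives one of size n, which is what the
    -- induction in `det-unique` runs on.
    restrictRows : Matrix n → Matrix (suc n)
    restrictRows K = δ j ∷ᵛ λ k → insertAt (K k) j 0#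

    restrict : Matrix n → Carrier
    restrict K = D (restrictRows K)

  module _ {n} {D : Matrix (suc n) → Carrier} (D-alternating : Alternating D) (j : Fin (suc n)) where
    open Alternating D-alternating

    restrict-alternating : Alternating (restrict D j)
    restrict-alternating = record
      { multilinear = record
        { cong   = λ M≈N → cong λ { zero _ → refl ; (suc k) → insertAt-cong j (M≈N k) }
        ; linear = λ i {L} {M} {N} a L≈N M≈N Ni → linear (suc i) a
            (λ { {zero} _ _ → refl ; {suc k} s → insertAt-cong j (L≈N (s ∘ ≡.cong suc)) })
            (λ { {zero} _ _ → refl ; {suc k} s → insertAt-cong j (M≈N (s ∘ ≡.cong suc)) })
            (insertAt-linear (L i) (M i) (N i) a Ni)
        }
      ; alternating = λ i≢j M Mi≈Mj → alternating (i≢j ∘ suc-injective) _ (insertAt-cong j Mi≈Mj)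
      }
      where
      insertAt-linear : ∀ (u v w : Fin n → Carrier) a → (∀ l → w l ≈ u l + a * v l) →
                        ∀ l → insertAt w j 0# l ≈ insertAt u j 0# l + a * insertAt v j 0# l
      insertAt-linear u v w a w≈ = punchIn-elim _ j
        (begin
          insertAt w j 0# j                          ≈⟨ insertAt-lookup-≈ w j ⟩
          0#                                         ≈⟨ solve 1 (λ a → con +0 := con +0 :+ a :* con +0) refl a ⟩
          0# + a * 0#                                ≈⟨ +-cong (insertAt-lookup-≈ u j) (*-congˡ (insertAt-lookup-≈ v j)) ⟨
          insertAt u j 0# j + a * insertAt v j 0# j  ∎)
        (λ l → trans (insertAt-punchIn-≈ w j l) (trans (w≈ l)
          (sym (+-cong (insertAt-punchIn-≈ u j l) (*-congˡ (insertAt-punchIn-≈ v j l))))))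

    -- Adding multiples of the top row δ j to the other rows does not change D and makes their
    -- entries in column j zero.
    clear-column : ∀ N → D (δ j ∷ᵛ N) ≈ restrict D j (λ k → removeAt (N k) j)
    clear-column N = row-by-row (λ u v → ∃ λ a → ∀ l → v l ≈ u l + a * δ j l) (λ K → D (δ j ∷ᵛ K))
      (λ p → cong λ { zero _ → refl ; (suc i) l → p i l })
      step (λ k → - N k j , cleared (N k))
      where
      cleared : ∀ (v : Fin (suc n) → Carrier) l → insertAt (removeAt v j) j 0# l ≈ v l + - v j * δ j l
      cleared v = punchIn-elim _ j
        (begin
          insertAt (removeAt v j) j 0# j  ≈⟨ insertAt-lookup-≈ (removeAt v j) j ⟩
          0#                              ≈⟨ solve 1 (λ x → con +0 := x :+ :- x :* :1) refl (v j) ⟩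
          v j + - v j * 1#                ≈⟨ +-congˡ (*-congˡ (δ-refl j)) ⟨
          v j + - v j * δ j j             ∎)
        (λ l → begin
          insertAt (removeAt v j) j 0# (punchIn j l)   ≈⟨ insertAt-punchIn-≈ (removeAt v j) j l ⟩
          v (punchIn j l)                              ≈⟨ solve 2 (λ x y → y := y :+ :- x :* con +0) refl (v j) _ ⟩
          v (punchIn j l) + - v j * 0#                 ≈⟨ +-congˡ (*-congˡ (δ-punchIn j l)) ⟨
          v (punchIn j l) + - v j * δ j (punchIn j l)  ∎)

      step : ∀ k {M N} → (∀ {t} → t ≢ k → ∀ l → M t l ≈ N t l) → (∃ λ a → ∀ l → N k l ≈ M k l + a * δ j l) →
             D (δ j ∷ᵛ M) ≈ D (δ j ∷ᵛ N)
      step k {M} {N} M≈N (a , Nk) = begin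
        D (δ j ∷ᵛ M)                        ≈⟨ solve 2 (λ x a → x := x :+ a :* con +0) refl _ a ⟩
        D (δ j ∷ᵛ M) + a * 0#               ≈⟨ +-congˡ (*-congˡ (alternating {zero} {suc k} (λ ()) (δ j ∷ᵛ K)
                                                (λ l → reflexive (≡.cong (λ f → f l) (≡.sym Kk))))) ⟨
        D (δ j ∷ᵛ M) + a * D (δ j ∷ᵛ K)      ≈⟨ linear (suc k) {δ j ∷ᵛ M} {δ j ∷ᵛ K} {δ j ∷ᵛ N} a
                                                (λ { {zero} _ _ → refl ; {suc t} s → M≈N (s ∘ ≡.cong suc) })
                                                (λ { {zero} _ _ → refl ; {suc t} s l →
                                                   reflexive (≡.cong (λ f → f l) (updateAt-minimal t k N (s ∘ ≡.cong suc))) })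
                                                (λ l → trans (Nk l) (+-congˡ (*-congˡ
                                                   (reflexive (≡.cong (λ f → f l) (≡.sym Kk)))))) ⟨
        D (δ j ∷ᵛ N)                        ∎
        where
        K : Fin n → Fin (suc n) → Carrier
        K = updateAt N k (const (δ j))
        Kk : K k ≡ δ j
        Kk = updateAt-updates k N

  -- Here the rows are those of the identity with row j moved to the top. Exchanging the two top
  -- rows costs one sign and brings δ 0 to the top; what remains is the same problem for j - 1 and
  -- the form `restrict D zero`.
  restrict-δ : ∀ {n} {D : Matrix (suc n) → Carrier} → Alternating D → ∀ j → restrict D j δ ≈ sign j * D δ
  restrict-δ {n} {D} D-alternating zero = trans (cong eq) (sym (*-identityˡ _))
    where
    open Alternating D-alternating
    eq : restrictRows D zero δ ≈ᴹ δ
    eq zero    l       = refl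
    eq (suc k) zero    = refl
    eq (suc k) (suc l) = refl
  restrict-δ {suc n} {D} D-alternating (suc j) = begin
    D A                        ≈⟨ antisymmetric multilinear {zero} {suc zero} (λ ())
                                    (alternating {zero} {suc zero} (λ ())) {B} {A}
                                    A₀ A₁ A₂ ⟩
    - D B                      ≈⟨ -‿cong (restrict-δ (restrict-alternating D-alternating zero) j) ⟩
    - (sign j * restrict D zero δ)  ≈⟨ -‿cong (*-congˡ (trans (restrict-δ D-alternating zero) (*-identityˡ _))) ⟩
    - (sign j * D δ)           ≈⟨ solve 2 (λ s d → :- (s :* d) := :- :1 :* s :* d) refl (sign j) (D δ) ⟩
    sign (suc j) * D δ         ∎
    where
    open Alternating D-alternating
    A B : Matrix (suc (suc n))
    A = restrictRows D (suc j) δ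
    B = restrictRows D zero (restrictRows (restrict D zero) j δ)
    A₀ : ∀ l → A zero l ≈ B (suc zero) l
    A₀ zero    = refl
    A₀ (suc l) = refl
    A₁ : ∀ l → A (suc zero) l ≈ B zero l
    A₁ zero    = refl
    A₁ (suc l) = go j l
      where
      go : ∀ {n} (j : Fin (suc n)) l → insertAt {n = n} (λ _ → 0#) j 0# l ≈ 0#
      go j = punchIn-elim _ j (insertAt-lookup-≈ (λ _ → 0#) j) (insertAt-punchIn-≈ (λ _ → 0#) j)
    A₂ : ∀ {t} → t ≢ zero → t ≢ suc zero → ∀ l → A t l ≈ B t l
    A₂ {zero}        t≢0 _   l       = contradiction ≡.refl t≢0
    A₂ {suc zero}    _   t≢1 l       = contradiction ≡.refl t≢1
    A₂ {suc (suc t)} _   _   zero    = refl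
    A₂ {suc (suc t)} _   _   (suc l) = refl

  -- Expanding D along the first row gives the Laplace recursion for det.
  det-unique : ∀ {n} {D : Matrix n → Carrier} → Alternating D → ∀ M → D M ≈ Det M * D δ
  det-unique {zero}  {D} D-alternating M =
    trans (Alternating.cong D-alternating λ ()) (sym (trans (*-congʳ (Det-empty M)) (*-identityˡ _)))
  det-unique {suc n} {D} D-alternating M = begin
    D M                                             ≈⟨ cong (λ { zero _ → refl ; (suc _) _ → refl }) ⟩
    D (M zero ∷ᵛ tail M)                             ≈⟨ linear-sum multilinear (M zero) δ (λ k → sym (∑-δʳ k (M zero))) ⟩
    ∑ (λ j → M zero j * D (δ j ∷ᵛ tail M))           ≈⟨ ∑-cong (λ j → *-congˡ (begin
      D (δ j ∷ᵛ tail M)                                ≈⟨ clear-column D-alternating j (tail M) ⟩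
      restrict D j (minor M j)                        ≈⟨ det-unique (restrict-alternating D-alternating j) (minor M j) ⟩
      Det (minor M j) * restrict D j δ                ≈⟨ *-congˡ (restrict-δ D-alternating j) ⟩
      Det (minor M j) * (sign j * D δ)                ∎)) ⟩
    ∑ (λ j → M zero j * (Det (minor M j) * (sign j * D δ)))
      ≈⟨ ∑-cong (λ j → solve 4 (λ m d s x → m :* (d :* (s :* x)) := s :* (m :* d) :* x) refl
           (M zero j) (Det (minor M j)) (sign j) (D δ)) ⟩
    ∑ (λ j → sign j * (M zero j * Det (minor M j)) * D δ)  ≈⟨ *-distribʳ-∑ (D δ) _ ⟨
    ∑ (λ j → sign j * (M zero j * Det (minor M j))) * D δ  ≈⟨ *-congʳ (Det-expand M) ⟨
    Det M * D δ                                     ∎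
    where open Alternating D-alternating

  infixl 7 _⊗_
  _⊗_ : ∀ {l m n} → (Fin l → Fin m → Carrier) → (Fin m → Fin n → Carrier) → Fin l → Fin n → Carrier
  (M ⊗ N) i k = ∑ λ j → M i j * N j k

  ⊗-congʳ : ∀ {l m n} {M M′ : Fin l → Fin m → Carrier} {N : Fin m → Fin n → Carrier} → M ≈ᴹ M′ → M ⊗ N ≈ᴹ M′ ⊗ N
  ⊗-congʳ M≈M′ i k = ∑-cong λ j → *-congʳ (M≈M′ i j)

  δ-⊗ : ∀ {m n} (N : Fin m → Fin n → Carrier) → δ ⊗ N ≈ᴹ N
  δ-⊗ N i k = ∑-δˡ i (λ j → N j k)

  ⊗-δ : ∀ {m n} (N : Fin m → Fin n → Carrier) → N ⊗ δ ≈ᴹ N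
  ⊗-δ N i k = ∑-δʳ k (N i)

  -- For fixed N the map M ↦ Det (M N) is alternating in the rows of M and takes the value Det N at
  -- the identity, so `det-unique` determines it.
  Det-⊗ : ∀ {n} (M N : Matrix n) → Det (M ⊗ N) ≈ Det M * Det N
  Det-⊗ M N = trans (det-unique ⊗-alternating M) (*-congˡ (Det-cong (δ-⊗ N)))
    where
    ⊗-alternating : Alternating (λ M → Det (M ⊗ N))
    ⊗-alternating = record
      { multilinear = record
        { cong   = λ M≈M′ → Det-cong (⊗-congʳ M≈M′)
        ; linear = λ i {K} {L} {M} a K≈M L≈M Mi → Alternating.linear Det-alternating i a
            (λ t≢i k → ∑-cong λ j → *-congʳ (K≈M t≢i j))
            (λ t≢i k → ∑-cong λ j → *-congʳ (L≈M t≢i j))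
            (λ k → begin
              ∑ (λ j → M i j * N j k)                           ≈⟨ ∑-cong (λ j → trans (*-congʳ (Mi j))
                 (solve 4 (λ x a y n → (x :+ a :* y) :* n := x :* n :+ a :* (y :* n)) refl (K i j) a (L i j) (N j k))) ⟩
              ∑ (λ j → K i j * N j k + a * (L i j * N j k))     ≈⟨ ∑-+ _ _ ⟩
              ∑ (λ j → K i j * N j k) + ∑ (λ j → a * (L i j * N j k))  ≈⟨ +-congˡ (*-distribˡ-∑ a _) ⟨
              (K ⊗ N) i k + a * (L ⊗ N) i k                     ∎)
        }
      ; alternating = λ i≢j M Mi≈Mj → Alternating.alternating Det-alternating i≢j _ (λ k → ∑-cong λ l → *-congʳ (Mi≈Mj l))
      }

  scalar : ∀ {n} → Carrier → Matrix n
  scalar x = diagonal (λ _ → x)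

  scalar≈ : ∀ {n} x (i j : Fin n) → scalar x i j ≈ x * δ i j
  scalar≈ x i j with i ≟ꟳ j
  ... | yes _ = sym (*-identityʳ x)
  ... | no  _ = sym (zeroʳ x)

  scalar-⊗ : ∀ {m n} x (N : Fin m → Fin n → Carrier) i j → (scalar x ⊗ N) i j ≈ x * N i j
  scalar-⊗ x N i j = begin
    ∑ (λ k → scalar x i k * N k j)   ≈⟨ ∑-cong (λ k → trans (*-congʳ (scalar≈ x i k)) (*-assoc _ _ _)) ⟩
    ∑ (λ k → x * (δ i k * N k j))    ≈⟨ *-distribˡ-∑ x _ ⟨
    x * ∑ (λ k → δ i k * N k j)      ≈⟨ *-congˡ (δ-⊗ N i j) ⟩
    x * N i j                        ∎

  ⊗-scalar : ∀ {m n} x (N : Fin m → Fin n → Carrier) i j → (N ⊗ scalar x) i j ≈ N i j * x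
  ⊗-scalar x N i j = begin
    ∑ (λ k → N i k * scalar x k j)   ≈⟨ ∑-cong (λ k → trans (*-congˡ (scalar≈ x k j))
                                          (solve 3 (λ n x d → n :* (x :* d) := n :* d :* x) refl (N i k) x (δ k j))) ⟩
    ∑ (λ k → N i k * δ k j * x)      ≈⟨ *-distribʳ-∑ x _ ⟨
    ∑ (λ k → N i k * δ k j) * x      ≈⟨ *-congʳ (⊗-δ N i j) ⟩
    N i j * x                        ∎

  Det-scalar : ∀ n x → Det (scalar {n} x) ≈ x ^ n
  Det-scalar zero    x = Det-empty _
  Det-scalar (suc n) x = begin
    Det (scalar x)                                           ≈⟨ trans (Det-expand (scalar x)) (∑-suc _) ⟩
    1# * (x * Det (minor (scalar x) zero)) + ∑ (λ j → sign (suc j) * (0# * Det (minor (scalar x) (suc j))))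
      ≈⟨ +-cong (*-identityˡ _) (∑-zero (λ j → trans (*-congˡ (zeroˡ _)) (zeroʳ _))) ⟩
    x * Det (minor (scalar x) zero) + 0#                     ≈⟨ +-identityʳ _ ⟩
    x * Det (minor (scalar x) zero)                          ≈⟨ *-congˡ (Det-scalar n x) ⟩
    x ^ suc n                                                ∎

  1^ : ∀ n → 1# ^ n ≈ 1#
  1^ zero    = refl
  1^ (suc n) = trans (*-identityˡ _) (1^ n)

  ^-≉0 : ∀ {x} n → ¬ (x ≈ 0#) → ¬ (x ^ n ≈ 0#)
  ^-≉0 zero    x≉0 = λ 1≈0 → 0≉1 (sym 1≈0)
  ^-≉0 (suc n) x≉0 = *-≉0 x≉0 (^-≉0 n x≉0)

  Det-δ : ∀ n → Det (δ {n}) ≈ 1#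
  Det-δ n = trans (Det-scalar n 1#) (1^ n)

-- Block matrices and Schur complements

module Blocks {c ℓ₁ ℓ₂} (F : RealClosedField c ℓ₁ ℓ₂) where

  open RealClosedField F
  open Spectral F
  open Field F
  open Determinant F
  open Multiplicativity F
  open RingProperties ring
  open import Relation.Binary.Reasoning.Setoid setoid

  -- Over a disjoint sum of index sets the blocks are separated by constructors; `glue` carries the
  -- matrix over to `Fin (p + q)`, where determinants are defined.
  ⊎Matrix : ℕ → ℕ → Set c
  ⊎Matrix p q = Fin p ⊎ Fin q → Fin p ⊎ Fin q → Carrier

  glue : ∀ {p q} → ⊎Matrix p q → Matrix (p ℕ.+ q)
  glue {p} f i j = f (splitAt p i) (splitAt p j)

  block : ∀ {p q} → Matrix p → (Fin p → Fin q → Carrier) → (Fin q → Fin p → Carrier) → Matrix q → ⊎Matrix p q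
  block X Y Z W (inj₁ i) (inj₁ j) = X i j
  block X Y Z W (inj₁ i) (inj₂ j) = Y i j
  block X Y Z W (inj₂ i) (inj₁ j) = Z i j
  block X Y Z W (inj₂ i) (inj₂ j) = W i j

  infix 4 _≈ᴮ_
  _≈ᴮ_ : ∀ {p q} (f g : ⊎Matrix p q) → Set ℓ₁
  f ≈ᴮ g = ∀ x y → f x y ≈ g x y

  by-blocks : ∀ {p q} {f g : ⊎Matrix p q} →
    (∀ i j → f (inj₁ i) (inj₁ j) ≈ g (inj₁ i) (inj₁ j)) → (∀ i j → f (inj₁ i) (inj₂ j) ≈ g (inj₁ i) (inj₂ j)) →
    (∀ i j → f (inj₂ i) (inj₁ j) ≈ g (inj₂ i) (inj₁ j)) → (∀ i j → f (inj₂ i) (inj₂ j) ≈ g (inj₂ i) (inj₂ j)) →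
    f ≈ᴮ g
  by-blocks p₁₁ p₁₂ p₂₁ p₂₂ (inj₁ i) (inj₁ j) = p₁₁ i j
  by-blocks p₁₁ p₁₂ p₂₁ p₂₂ (inj₁ i) (inj₂ j) = p₁₂ i j
  by-blocks p₁₁ p₁₂ p₂₁ p₂₂ (inj₂ i) (inj₁ j) = p₂₁ i j
  by-blocks p₁₁ p₁₂ p₂₁ p₂₂ (inj₂ i) (inj₂ j) = p₂₂ i j

  _⊡_ : ∀ {p q} → ⊎Matrix p q → ⊎Matrix p q → ⊎Matrix p q
  (f ⊡ g) x z = ∑ (λ i → f x (inj₁ i) * g (inj₁ i) z) + ∑ (λ j → f x (inj₂ j) * g (inj₂ j) z)

  glue-⊗ : ∀ {p q} (f g : ⊎Matrix p q) → glue f ⊗ glue g ≈ᴹ glue (f ⊡ g)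
  glue-⊗ {p} f g i k = ∑-splitAt p (λ y → f (splitAt p i) y * g y (splitAt p k))

  Det-glue-cong : ∀ {p q} {f g : ⊎Matrix p q} → f ≈ᴮ g → Det (glue f) ≈ Det (glue g)
  Det-glue-cong {p} f≈g = Det-cong λ i j → f≈g (splitAt p i) (splitAt p j)

  Det-⊡ : ∀ {p q} (f g : ⊎Matrix p q) → Det (glue (f ⊡ g)) ≈ Det (glue f) * Det (glue g)
  Det-⊡ f g = trans (sym (Det-cong (glue-⊗ f g))) (Det-⊗ (glue f) (glue g))

  -- In the expansion along the first row only columns of the left block contribute, and deleting
  -- such a column leaves a matrix of the same shape, so induction on p applies.
  Det-lower : ∀ {p q} (f : ⊎Matrix p q) → (∀ i j → f (inj₁ i) (inj₂ j) ≈ 0#) →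
              Det (glue f) ≈ Det (λ i j → f (inj₁ i) (inj₁ j)) * Det (λ i j → f (inj₂ i) (inj₂ j))
  Det-lower {zero}  f f≈0 = sym (trans (*-congʳ (Det-empty _)) (*-identityˡ _))
  Det-lower {suc p} {q} f f≈0 = begin
    Det (glue f)                                                     ≈⟨ Det-expand (glue f) ⟩
    ∑ term                                                           ≈⟨ ∑-↑ (suc p) term ⟩
    ∑ (λ j → term (j ↑ˡ q)) + ∑ (λ j → term (suc p ↑ʳ j))            ≈⟨ +-cong (∑-cong left) (∑-zero right) ⟩
    ∑ (λ j → sign j * (f₁₁ zero j * Det (minor f₁₁ j)) * Det f₂₂) + 0#  ≈⟨ +-identityʳ _ ⟩
    ∑ (λ j → sign j * (f₁₁ zero j * Det (minor f₁₁ j)) * Det f₂₂)    ≈⟨ *-distribʳ-∑ (Det f₂₂) _ ⟨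
    ∑ (λ j → sign j * (f₁₁ zero j * Det (minor f₁₁ j))) * Det f₂₂    ≈⟨ *-congʳ (Det-expand f₁₁) ⟨
    Det f₁₁ * Det f₂₂                                                ∎
    where
    f₁₁ : Matrix (suc p)
    f₁₁ i j = f (inj₁ i) (inj₁ j)
    f₂₂ : Matrix q
    f₂₂ i j = f (inj₂ i) (inj₂ j)
    term : Fin (suc p ℕ.+ q) → Carrier
    term j = sign j * (glue f zero j * Det (minor (glue f) j))
    right : ∀ j → term (suc p ↑ʳ j) ≈ 0#
    right j = trans (*-congˡ (trans (*-congʳ (trans
      (reflexive (≡.cong (f (inj₁ zero)) (splitAt-↑ʳ (suc p) q j))) (f≈0 zero j))) (zeroˡ _))) (zeroʳ _)
    left : ∀ j → term (j ↑ˡ q) ≈ sign j * (f₁₁ zero j * Det (minor f₁₁ j)) * Det f₂₂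
    left j = begin
      sign (j ↑ˡ q) * (glue f zero (j ↑ˡ q) * Det (minor (glue f) (j ↑ˡ q)))
        ≈⟨ *-cong (reflexive (≡.cong ((- 1#) ^_) (toℕ-↑ˡ j q)))
             (*-cong (reflexive (≡.cong (f (inj₁ zero)) (splitAt-↑ˡ (suc p) j q)))
               (trans (Det-cong (λ k l → reflexive (≡.cong (f (Sum.map₁ suc (splitAt p k))) (splitAt-punchIn p j l))))
                 (Det-lower (λ x y → f (Sum.map₁ suc x) (Sum.map₁ (punchIn j) y)) (λ i → f≈0 (suc i))))) ⟩
      sign j * (f₁₁ zero j * (Det (minor f₁₁ j) * Det f₂₂))
        ≈⟨ solve 4 (λ s x y z → s :* (x :* (y :* z)) := s :* (x :* y) :* z) refl (sign j) (f₁₁ zero j) _ _ ⟩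
      sign j * (f₁₁ zero j * Det (minor f₁₁ j)) * Det f₂₂ ∎

  zeros : ∀ {p q} → Fin p → Fin q → Carrier
  zeros _ _ = 0#

  unipotent : ∀ {p q} → (Fin p → Fin q → Carrier) → ⊎Matrix p q
  unipotent S = block δ S zeros δ

  private
    ∑-0ˡ : ∀ {n} (f : Fin n → Carrier) → ∑ (λ i → 0# * f i) ≈ 0#
    ∑-0ˡ f = ∑-zero (λ i → zeroˡ (f i))

    ∑-0ʳ : ∀ {n} (f : Fin n → Carrier) → ∑ (λ i → f i * 0#) ≈ 0#
    ∑-0ʳ f = ∑-zero (λ i → zeroʳ (f i))

    +-0ʳ : ∀ {x y z} → x ≈ z → y ≈ 0# → x + y ≈ z
    +-0ʳ x≈z y≈0 = trans (+-cong x≈z y≈0) (+-identityʳ _)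

    +-0ˡ : ∀ {x y z} → x ≈ 0# → y ≈ z → x + y ≈ z
    +-0ˡ x≈0 y≈z = trans (+-cong x≈0 y≈z) (+-identityˡ _)

  -- Conjugation by diag(2, 1) shows det u(2S) = det u(S), and u(2S) = u(S)².
  Det-unipotent : ∀ {p q} (S : Fin p → Fin q → Carrier) → Det (glue (unipotent S)) ≈ 1#
  -- The two facts give u(S)² = u(S). Both cancellations are legitimate: u(-S) u(S) = 1 makes u(S)
  -- nonzero, and the determinant of diag(2, 1) is a power of 2, nonzero in an ordered field.
  Det-unipotent {p} {q} S = *-cancelˡ u≉0 (begin
    u S * u S     ≈⟨ *-cancelˡ d≉0 (trans (*-congˡ u²) (trans (*-comm _ _) (sym conjugate))) ⟩
    u S           ≈⟨ *-identityʳ _ ⟨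
    u S * 1#      ∎)
    where
    u : (Fin p → Fin q → Carrier) → Carrier
    u S = Det (glue (unipotent S))
    2S : Fin p → Fin q → Carrier
    2S i j = S i j + S i j
    t : ⊎Matrix p q
    t = block (scalar (ι 2)) zeros zeros δ

    d≉0 : ¬ (Det (glue t) ≈ 0#)
    d≉0 p≈0 = *-≉0 (^-≉0 p (proj₂ (ι-suc-positive 1))) (λ 1≈0 → 0≉1 (sym 1≈0))
      (trans (sym (trans (Det-lower t (λ _ _ → refl)) (*-cong (Det-scalar p (ι 2)) (Det-δ q)))) p≈0)

    u⁻¹ : u (λ i j → - S i j) * u S ≈ 1#
    u⁻¹ = begin
      u (λ i j → - S i j) * u S     ≈⟨ Det-⊡ (unipotent (λ i j → - S i j)) (unipotent S) ⟨
      Det (glue (unipotent (λ i j → - S i j) ⊡ unipotent S))  ≈⟨ Det-glue-cong {f = unipotent (λ i j → - S i j) ⊡ unipotent S} {block δ zeros zeros δ} (by-blocks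
        (λ i j → +-0ʳ (δ-⊗ δ i j) (∑-0ʳ _))
        (λ i j → trans (+-cong (δ-⊗ S i j) (⊗-δ (λ i j → - S i j) i j)) (-‿inverseʳ _))
        (λ i j → +-0ʳ (∑-0ˡ _) (∑-0ʳ _))
        (λ i j → +-0ˡ (∑-0ˡ _) (δ-⊗ δ i j))) ⟩
      Det (glue (block (δ {p}) zeros zeros (δ {q})))      ≈⟨ Det-lower (block (δ {p}) zeros zeros (δ {q})) (λ _ _ → refl) ⟩
      Det (δ {p}) * Det (δ {q})     ≈⟨ *-cong (Det-δ p) (Det-δ q) ⟩
      1# * 1#                       ≈⟨ *-identityˡ _ ⟩
      1#                            ∎

    u≉0 : ¬ (u S ≈ 0#)
    u≉0 p≈0 = 0≉1 (trans (sym (trans (*-congˡ p≈0) (zeroʳ _))) u⁻¹)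

    u² : u S * u S ≈ u 2S
    u² = trans (sym (Det-⊡ (unipotent S) (unipotent S))) (Det-glue-cong {f = unipotent S ⊡ unipotent S} {unipotent 2S} (by-blocks
      (λ i j → +-0ʳ (δ-⊗ δ i j) (∑-0ʳ _))
      (λ i j → +-cong (δ-⊗ S i j) (⊗-δ S i j))
      (λ i j → +-0ʳ (∑-0ˡ _) (∑-0ʳ _))
      (λ i j → +-0ˡ (∑-0ˡ _) (δ-⊗ δ i j))))

    conjugate : Det (glue t) * u S ≈ u 2S * Det (glue t)
    conjugate = trans (sym (Det-⊡ t (unipotent S))) (trans
      (Det-glue-cong {f = t ⊡ unipotent S} {unipotent 2S ⊡ t} (by-blocks
        (λ i j → trans (+-0ʳ (⊗-δ (scalar (ι 2)) i j) (∑-0ʳ (λ _ → 0#))) (sym (+-0ʳ (δ-⊗ (scalar (ι 2)) i j) (∑-0ʳ _))))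
        (λ i j → trans (+-0ʳ (scalar-⊗ (ι 2) S i j) (∑-0ˡ _)) (trans
          (solve 1 (λ s → :2 :* s := s :+ s) refl (S i j))
          (sym (+-0ˡ (∑-0ʳ _) (⊗-δ 2S i j)))))
        (λ i j → trans (+-0ʳ (∑-0ˡ _) (∑-0ʳ _)) (sym (+-0ʳ (∑-0ˡ _) (∑-0ʳ _))))
        (λ i j → trans (+-0ˡ (∑-0ˡ _) (δ-⊗ δ i j)) (sym (+-0ˡ (∑-0ˡ _) (δ-⊗ δ i j))))))
      (Det-⊡ (unipotent 2S) t))

  module _ {p q} (X : Matrix p) (Y : Fin p → Fin q → Carrier) (Z : Fin q → Fin p → Carrier) (W : Matrix q)
           (S : Fin p → Fin q → Carrier) where

    private
      -S : Fin p → Fin q → Carrier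
      -S i j = - S i j

      -S⊗ : ∀ {n} (N : Fin q → Fin n → Carrier) i j → (-S ⊗ N) i j ≈ - (S ⊗ N) i j
      -S⊗ N i j = trans (∑-cong (λ k → sym (-‿distribˡ-* _ _))) (∑-neg _)

      ⊗-S : ∀ {n} (N : Fin n → Fin p → Carrier) i j → (N ⊗ -S) i j ≈ - (N ⊗ S) i j
      ⊗-S N i j = trans (∑-cong (λ k → sym (-‿distribʳ-* _ _))) (∑-neg _)

    -- Left multiplication by the unipotent matrix of -S replaces Y by Y - S W = 0 and X by X - S Z.
    -- Here S plays the part of Y W⁻¹; passing it as data avoids inverting a matrix.
    Det-schurʳ : Y ≈ᴹ S ⊗ W → Det (glue (block X Y Z W)) ≈ Det (λ i j → X i j - (S ⊗ Z) i j) * Det W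
    Det-schurʳ Y≈SW = begin
      Det (glue (block X Y Z W))                                ≈⟨ *-identityˡ _ ⟨
      1# * Det (glue (block X Y Z W))                           ≈⟨ *-congʳ (Det-unipotent -S) ⟨
      Det (glue (unipotent -S)) * Det (glue (block X Y Z W))    ≈⟨ Det-⊡ (unipotent -S) (block X Y Z W) ⟨
      Det (glue (unipotent -S ⊡ block X Y Z W))                 ≈⟨ Det-lower (unipotent -S ⊡ block X Y Z W) (λ i j →
        trans (+-cong (δ-⊗ Y i j) (-S⊗ W i j)) (trans (+-congʳ (Y≈SW i j)) (-‿inverseʳ _))) ⟩
      Det (λ i j → (δ ⊗ X) i j + (-S ⊗ Z) i j) * Det (λ i j → (zeros ⊗ Y) i j + (δ ⊗ W) i j)
        ≈⟨ *-cong (Det-cong λ i j → +-cong (δ-⊗ X i j) (-S⊗ Z i j)) (Det-cong λ i j → +-0ˡ (∑-0ˡ _) (δ-⊗ W i j)) ⟩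
      Det (λ i j → X i j - (S ⊗ Z) i j) * Det W                 ∎

    -- The column version: right multiplication by the same unipotent matrix, with S in the part of
    -- X⁻¹ Y.
    Det-schurˡ : Y ≈ᴹ X ⊗ S → Det (glue (block X Y Z W)) ≈ Det X * Det (λ i j → W i j - (Z ⊗ S) i j)
    Det-schurˡ Y≈XS = begin
      Det (glue (block X Y Z W))                                ≈⟨ *-identityʳ _ ⟨
      Det (glue (block X Y Z W)) * 1#                           ≈⟨ *-congˡ (Det-unipotent -S) ⟨
      Det (glue (block X Y Z W)) * Det (glue (unipotent -S))    ≈⟨ Det-⊡ (block X Y Z W) (unipotent -S) ⟨
      Det (glue (block X Y Z W ⊡ unipotent -S))                 ≈⟨ Det-lower (block X Y Z W ⊡ unipotent -S) (λ i j →
        trans (+-cong (⊗-S X i j) (⊗-δ Y i j)) (trans (+-congˡ (Y≈XS i j)) (-‿inverseˡ _))) ⟩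
      Det (λ i j → (X ⊗ δ) i j + (Y ⊗ zeros) i j) * Det (λ i j → (Z ⊗ -S) i j + (W ⊗ δ) i j)
        ≈⟨ *-cong (Det-cong λ i j → +-0ʳ (⊗-δ X i j) (∑-0ʳ _))
                  (Det-cong λ i j → trans (+-cong (⊗-S Z i j) (⊗-δ W i j)) (+-comm _ _)) ⟩
      Det X * Det (λ i j → W i j - (Z ⊗ S) i j)                 ∎

  Det-1×1 : ∀ (M : Matrix 1) → Det M ≈ M zero zero
  Det-1×1 M = begin
    Det M                                            ≈⟨ trans (Det-expand M) (∑-suc _) ⟩
    1# * (M zero zero * Det (minor M zero)) + ∑ {0} _  ≈⟨ +-0ʳ (*-identityˡ _) (∑-empty _) ⟩
    M zero zero * Det (minor M zero)                 ≈⟨ *-congˡ (Det-empty _) ⟩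
    M zero zero * 1#                                 ≈⟨ *-identityʳ _ ⟩
    M zero zero                                      ∎

  -- Both Schur complements of [[1, -a 1ᵀ], [1, I]].
  Det-δ+const : ∀ n a → Det {n} (λ i j → δ i j + a) ≈ 1# + ι n * a
  Det-δ+const n a = begin
    Det {n} (λ i j → δ i j + a)                    ≈⟨ *-identityˡ _ ⟨
    1# * Det (λ i j → δ i j + a)                   ≈⟨ *-cong (Det-δ 1) (Det-cong λ i j → +-congˡ (begin
                                                        - ((λ _ (_ : Fin 1) → 1#) ⊗ (λ _ _ → - a)) i j  ≈⟨ -‿cong (trans (∑-const 1 _) (+-0)) ⟩
                                                        - - a                                ≈⟨ -‿involutive a ⟩
                                                        a                                    ∎)) ⟨
    Det {1} δ * Det (λ i j → δ i j - ((λ _ (_ : Fin 1) → 1#) ⊗ (λ _ _ → - a)) i j)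
      ≈⟨ Det-schurˡ δ -a (λ _ _ → 1#) δ -a (λ i j → sym (δ-⊗ -a i j)) ⟨
    Det (glue (block {1} {n} δ -a (λ _ _ → 1#) δ))  ≈⟨ Det-schurʳ δ -a (λ _ _ → 1#) δ -a (λ i j → sym (⊗-δ -a i j)) ⟩
    Det {1} (λ i j → δ i j - (-a ⊗ (λ _ _ → 1#)) i j) * Det {n} δ  ≈⟨ *-cong (Det-1×1 _) (Det-δ n) ⟩
    (1# - ∑ {n} (λ _ → - a * 1#)) * 1#             ≈⟨ *-congʳ (+-congˡ (-‿cong (∑-const n _))) ⟩
    (1# - ι n * (- a * 1#)) * 1#                   ≈⟨ solve 2 (λ n a → (:1 :- n :* (:- a :* :1)) :* :1 := :1 :+ n :* a) refl (ι n) a ⟩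
    1# + ι n * a                                   ∎
    where
    -a : ∀ {p q} → Fin p → Fin q → Carrier
    -a _ _ = - a
    +-0 : ι 1 * (1# * - a) ≈ - a
    +-0 = solve 1 (λ a → (:1 :+ con +0) :* (:1 :* :- a) := :- a) refl a

-- Polynomial functions are determined by their values at large arguments

module PolynomialFunctions {c ℓ₁ ℓ₂} (F : RealClosedField c ℓ₁ ℓ₂) where

  open RealClosedField F
  open Spectral F
  open Field F
  open Determinant F
  open RingProperties ring
  open import Relation.Binary.Reasoning.Setoid setoid

  IsPolynomial : (Carrier → Carrier) → Set (c ⊔ ℓ₁)
  IsPolynomial f = ∃ λ p → ∀ x → f x ≈ eval p x

  private
    add : List Carrier → List Carrier → List Carrier
    add []      q       = q
    add (a ∷ p) []      = a ∷ p
    add (a ∷ p) (b ∷ q) = a + b ∷ add p q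

    eval-add : ∀ p q x → eval (add p q) x ≈ eval p x + eval q x
    eval-add []      q       x = sym (+-identityˡ _)
    eval-add (a ∷ p) []      x = sym (+-identityʳ _)
    eval-add (a ∷ p) (b ∷ q) x = trans (+-congˡ (*-congˡ (eval-add p q x)))
      (solve 5 (λ a b x y z → a :+ b :+ x :* (y :+ z) := (a :+ x :* y) :+ (b :+ x :* z)) refl a b x (eval p x) (eval q x))

    eval-scale : ∀ a p x → eval (map (a *_) p) x ≈ a * eval p x
    eval-scale a []      x = sym (zeroʳ a)
    eval-scale a (b ∷ p) x = trans (+-congˡ (*-congˡ (eval-scale a p x)))
      (solve 4 (λ a b x y → a :* b :+ x :* (a :* y) := a :* (b :+ x :* y)) refl a b x (eval p x))

    mul : List Carrier → List Carrier → List Carrier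
    mul []      q = []
    mul (a ∷ p) q = add (map (a *_) q) (0# ∷ mul p q)

    eval-mul : ∀ p q x → eval (mul p q) x ≈ eval p x * eval q x
    eval-mul []      q x = sym (zeroˡ _)
    eval-mul (a ∷ p) q x = begin
      eval (add (map (a *_) q) (0# ∷ mul p q)) x          ≈⟨ eval-add (map (a *_) q) (0# ∷ mul p q) x ⟩
      eval (map (a *_) q) x + (0# + x * eval (mul p q) x) ≈⟨ +-cong (eval-scale a q x) (+-congˡ (*-congˡ (eval-mul p q x))) ⟩
      a * eval q x + (0# + x * (eval p x * eval q x))
        ≈⟨ solve 4 (λ a x p q → a :* q :+ (con +0 :+ x :* (p :* q)) := (a :+ x :* p) :* q) refl a x (eval p x) (eval q x) ⟩
      (a + x * eval p x) * eval q x                       ∎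

  polynomial-resp : ∀ {f g} → (∀ x → f x ≈ g x) → IsPolynomial f → IsPolynomial g
  polynomial-resp f≈g (p , f≈p) = p , λ x → trans (sym (f≈g x)) (f≈p x)

  polynomial-const : ∀ a → IsPolynomial (λ _ → a)
  polynomial-const a = a ∷ [] , λ x → solve 2 (λ a x → a := a :+ x :* con +0) refl a x

  polynomial-var : IsPolynomial (λ x → x)
  polynomial-var = 0# ∷ 1# ∷ [] , λ x → solve 1 (λ x → x := con +0 :+ x :* (:1 :+ x :* con +0)) refl x

  polynomial-+ : ∀ {f g} → IsPolynomial f → IsPolynomial g → IsPolynomial (λ x → f x + g x)
  polynomial-+ (p , f≈p) (q , g≈q) = add p q , λ x → trans (+-cong (f≈p x) (g≈q x)) (sym (eval-add p q x))

  polynomial-* : ∀ {f g} → IsPolynomial f → IsPolynomial g → IsPolynomial (λ x → f x * g x)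
  polynomial-* (p , f≈p) (q , g≈q) = mul p q , λ x → trans (*-cong (f≈p x) (g≈q x)) (sym (eval-mul p q x))

  polynomial-sub : ∀ {f g} → IsPolynomial f → IsPolynomial g → IsPolynomial (λ x → f x - g x)
  polynomial-sub f g = polynomial-+ f (polynomial-resp (λ x → -1*x≈-x _) (polynomial-* (polynomial-const (- 1#)) g))

  polynomial-∑ : ∀ {n} {f : Fin n → Carrier → Carrier} → (∀ i → IsPolynomial (f i)) → IsPolynomial (λ x → ∑ (λ i → f i x))
  polynomial-∑ {zero}  _ = polynomial-resp (λ x → sym (∑-empty _)) (polynomial-const 0#)
  polynomial-∑ {suc n} p = polynomial-resp (λ x → sym (∑-suc _)) (polynomial-+ (p zero) (polynomial-∑ (p ∘ suc)))

  polynomial-Det : ∀ {n} {M : Carrier → Matrix n} → (∀ i j → IsPolynomial (λ x → M x i j)) → IsPolynomial (λ x → Det (M x))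
  polynomial-Det {zero}  _ = polynomial-resp (λ x → sym (Det-empty _)) (polynomial-const 1#)
  polynomial-Det {suc n} p = polynomial-resp (λ x → sym (Det-expand _)) (polynomial-∑ λ j →
    polynomial-* (polynomial-const (sign j)) (polynomial-* (p zero j) (polynomial-Det λ k l → p (suc k) _)))

  monic : List Carrier → Carrier → Carrier
  monic ρs x = foldr (λ ρ v → (x - ρ) * v) 1# ρs

  polynomial-monic : ∀ ρs → IsPolynomial (monic ρs)
  polynomial-monic []       = polynomial-const 1#
  polynomial-monic (ρ ∷ ρs) = polynomial-* (polynomial-sub polynomial-var (polynomial-const ρ)) (polynomial-monic ρs)

  private
    -- The quotient of a ∷ p on division by x - t, which does not depend on a.
    quotient : List Carrier → Carrier → List Carrier
    quotient []      t = []
    quotient (b ∷ p) t = eval (b ∷ p) t ∷ quotient p t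

    length-quotient : ∀ p t → length (quotient p t) ≡ length p
    length-quotient []      t = ≡.refl
    length-quotient (b ∷ p) t = ≡.cong suc (length-quotient p t)

    division : ∀ a p t x → eval (a ∷ p) x ≈ eval (a ∷ p) t + (x - t) * eval (quotient p t) x
    division a []      t x = solve 3 (λ a t x → a :+ x :* con +0 := a :+ t :* con +0 :+ (x :- t) :* con +0) refl a t x
    division a (b ∷ p) t x = trans (+-congˡ (*-congˡ (division b p t x)))
      (solve 5 (λ a t x e q → a :+ x :* (e :+ (x :- t) :* q) := a :+ t :* e :+ (x :- t) :* (e :+ x :* q)) refl
        a t x (eval (b ∷ p) t) (eval (quotient p t) x))

    -- Since t is a zero, the polynomial is (x - t) times its quotient, which has one coefficient
    -- fewer. The quotient vanishes for x ≥ t + 1, where x - t is at least 1 and can be cancelled,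
    -- and hence everywhere by induction. Raising the threshold by 1 is what excludes x = t.
    eventually-zero : ∀ n p → length p ≡ n → ∀ t → (∀ x → t ≤ x → eval p x ≈ 0#) → ∀ x → eval p x ≈ 0#
    eventually-zero n       []      _  t _   x = refl
    eventually-zero (suc n) (a ∷ p) |p| t p≈0 x = begin
      eval (a ∷ p) x                                     ≈⟨ division a p t x ⟩
      eval (a ∷ p) t + (x - t) * eval (quotient p t) x   ≈⟨ +-cong (p≈0 t ≤.refl) (*-congˡ (q≈0 x)) ⟩
      0# + (x - t) * 0#                                  ≈⟨ solve 1 (λ x → con +0 :+ x :* con +0 := con +0) refl (x - t) ⟩
      0#                                                 ∎
      where
      q≈0 : ∀ x → eval (quotient p t) x ≈ 0#
      q≈0 = eventually-zero n (quotient p t) (≡.trans (length-quotient p t) (≡.cong ℕ.pred |p|)) (t + 1#) λ x t+1≤x →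
        let x-t>0 = positive-resp (solve 2 (λ t x → :1 :+ (x :- (t :+ :1)) := x :- t) refl t x)
                      (positive-+-nonneg 1-positive (x≤y⇒0≤y-x t+1≤x))
        in *-cancelˡ-0 (proj₂ x-t>0) (begin
          (x - t) * eval (quotient p t) x                   ≈⟨ +-identityˡ _ ⟨
          0# + (x - t) * eval (quotient p t) x              ≈⟨ +-congʳ (p≈0 t ≤.refl) ⟨
          eval (a ∷ p) t + (x - t) * eval (quotient p t) x  ≈⟨ division a p t x ⟨
          eval (a ∷ p) x                                    ≈⟨ p≈0 x (0≤y-x⇒x≤y (proj₁ x-t>0)) ⟩
          0#                                                ∎)

  eventually-equal : ∀ {f g} → IsPolynomial f → IsPolynomial g → ∀ t → (∀ x → t ≤ x → f x ≈ g x) → ∀ x → f x ≈ g x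
  eventually-equal {f} {g} f-poly g-poly t f≈g x = x∙y⁻¹≈ε⇒x≈y (f x) (g x)
    (trans (f-g≈p x) (eventually-zero _ p ≡.refl t
      (λ y t≤y → trans (sym (f-g≈p y)) (trans (+-congʳ (f≈g y t≤y)) (-‿inverseʳ _))) x))
    where
    p = proj₁ (polynomial-sub f-poly g-poly)
    f-g≈p = proj₂ (polynomial-sub f-poly g-poly)

-- The largest signless Laplacian eigenvalue of a regular graph

module RegularSpectrum {c ℓ₁ ℓ₂} (F : RealClosedField c ℓ₁ ℓ₂) where

  open RealClosedField F
  open Spectral F
  open Field F
  open Determinant F
  open Multiplicativity F
  open Blocks F
  open PolynomialFunctions F
  open RingProperties ring
  open import Relation.Binary.Reasoning.Setoid setoid

  ∑-single : (f : Fin 1 → Carrier) → ∑ f ≈ f zero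
  ∑-single f = trans (∑-suc f) (trans (+-congˡ (∑-empty _)) (+-identityʳ _))

  ∑-nonneg : ∀ {n} {f : Fin n → Carrier} → (∀ i → 0# ≤ f i) → 0# ≤ ∑ f
  ∑-nonneg {zero}  _   = ≤.reflexive (sym (∑-empty _))
  ∑-nonneg {suc n} 0≤f = ≤-resp refl (sym (∑-suc _)) (+-nonneg (0≤f zero) (∑-nonneg (0≤f ∘ suc)))

  -- The two hypotheses (M is a nonsingular M-matrix) are inherited by the Schur complement of the first entry.
  M-matrix-Det≉0 : ∀ {n} (M : Matrix n) → (∀ {i j} → i ≢ j → M i j ≤ 0#) → (∀ i → Positive (∑ (M i))) → ¬ (Det M ≈ 0#)
  M-matrix-Det≉0 {zero}  M _     _    p = 0≉1 (trans (sym p) (Det-empty M))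
  M-matrix-Det≉0 {suc n} M M≤0 rows>0 p =
    *-≉0 (proj₂ pivot>0) (M-matrix-Det≉0 N N≤0 N-rows>0) (trans (sym Det-M) p)
    where
    pivot = M zero zero
    pivot>0 : Positive pivot
    pivot>0 = positive-resp
      (begin
        ∑ (M zero) + ∑ (λ j → - M zero (suc j))              ≈⟨ +-cong (∑-suc (M zero)) (∑-neg _) ⟩
        pivot + ∑ (M zero ∘ suc) - ∑ (M zero ∘ suc)          ≈⟨ solve 2 (λ x y → x :+ y :- y := x) refl pivot _ ⟩
        pivot                                                ∎)
      (positive-+-nonneg (rows>0 zero) (∑-nonneg λ j → x≤0⇒0≤-x (M≤0 λ ())))
    m = pivot ⁻¹⟨ proj₂ pivot>0 ⟩
    0≤m = inverse-nonneg pivot>0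

    N : Matrix n
    N i j = M (suc i) (suc j) - M (suc i) zero * (m * M zero (suc j))

    Det-M : Det M ≈ pivot * Det N
    Det-M = begin
      Det M                           ≈⟨ Det-cong {N = glue {1} (block X Y Z W)} (λ
                                           { zero zero → refl ; zero (suc j) → refl
                                           ; (suc i) zero → refl ; (suc i) (suc j) → refl }) ⟩
      Det (glue {1} (block X Y Z W))  ≈⟨ Det-schurˡ X Y Z W S (λ { zero j → begin
        M zero (suc j)                  ≈⟨ *-identityˡ _ ⟨
        1# * M zero (suc j)             ≈⟨ *-congʳ (*-inverseʳ (proj₂ pivot>0)) ⟨
        pivot * m * M zero (suc j)      ≈⟨ *-assoc _ _ _ ⟩
        pivot * (m * M zero (suc j))    ≈⟨ ∑-single _ ⟨
        (X ⊗ S) zero j                  ∎ }) ⟩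
      Det X * Det (λ i j → W i j - (Z ⊗ S) i j)
        ≈⟨ *-cong (Det-1×1 X) (Det-cong λ i j → +-congˡ (-‿cong (∑-single _))) ⟩
      pivot * Det N                   ∎
      where
      X : Matrix 1
      X _ _ = pivot
      Y S : Fin 1 → Fin n → Carrier
      Y _ j = M zero (suc j)
      S _ j = m * M zero (suc j)
      Z : Fin n → Fin 1 → Carrier
      Z i _ = M (suc i) zero
      W : Matrix n
      W i j = M (suc i) (suc j)

    N≤0 : ∀ {i j} → i ≢ j → N i j ≤ 0#
    N≤0 {i} {j} i≢j = 0≤-x⇒x≤0 (≤-resp refl
      (solve 4 (λ x y m z → :- x :+ :- y :* (m :* :- z) := :- (x :- y :* (m :* z))) refl
        (M (suc i) (suc j)) (M (suc i) zero) m (M zero (suc j)))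
      (+-nonneg (x≤0⇒0≤-x (M≤0 (i≢j ∘ suc-injective)))
        (*-nonneg (x≤0⇒0≤-x (M≤0 λ ())) (*-nonneg 0≤m (x≤0⇒0≤-x (M≤0 λ ()))))))

    N-rows>0 : ∀ i → Positive (∑ (N i))
    N-rows>0 i = positive-resp (sym (begin
      ∑ (N i)                                         ≈⟨ trans (∑-+ _ _) (+-congˡ (∑-neg _)) ⟩
      t - ∑ (λ j → a * (m * M zero (suc j)))          ≈⟨ +-congˡ (-‿cong (trans (*-congˡ (*-distribˡ-∑ m _)) (*-distribˡ-∑ a _))) ⟨
      t - a * (m * u)
        -- Because a = a m `pivot`, the missing first entries can be added to both row tails. The
        -- sum then consists of the full sums of row i + 1 and row 0 of M, the latter with the
        -- nonnegative weight - a m.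
        ≈⟨ solve 5 (λ t a m u p → t :- a :* (m :* u) := a :+ t :+ :- a :* (m :* (p :+ u)) :- a :* (:1 :- p :* m)) refl t a m u pivot ⟩
      a + t + - a * (m * (pivot + u)) - a * (1# - pivot * m)
        ≈⟨ +-congˡ (-‿cong (*-congˡ (trans (+-congˡ (-‿cong (*-inverseʳ (proj₂ pivot>0)))) (-‿inverseʳ 1#)))) ⟩
      a + t + - a * (m * (pivot + u)) - a * 0#        ≈⟨ solve 2 (λ x a → x :- a :* con +0 := x) refl _ a ⟩
      a + t + - a * (m * (pivot + u))                 ≈⟨ +-cong (∑-suc _) (*-congˡ (*-congˡ (∑-suc _))) ⟨
      ∑ (M (suc i)) + - a * (m * ∑ (M zero))          ∎))
      (positive-+-nonneg (rows>0 (suc i)) (*-nonneg (x≤0⇒0≤-x (M≤0 λ ())) (*-nonneg 0≤m (proj₁ (rows>0 zero)))))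
      where
      a = M (suc i) zero
      t = ∑ (M (suc i) ∘ suc)
      u = ∑ (M zero ∘ suc)

  -- M (I + J) = M when the rows of M sum to zero.
  zero-rows-Det≈0 : ∀ {n} (M : Matrix (suc n)) → (∀ i → ∑ (M i) ≈ 0#) → Det M ≈ 0#
  zero-rows-Det≈0 {n} M rows≈0 = *-cancelˡ-0 (proj₂ (ι-suc-positive n)) (begin
    ι (suc n) * Det M                       ≈⟨ solve 2 (λ n d → n :* d := d :* (:1 :+ n :* :1) :- d) refl (ι (suc n)) (Det M) ⟩
    Det M * (1# + ι (suc n) * 1#) - Det M   ≈⟨ +-congʳ (*-congˡ (Det-δ+const (suc n) 1#)) ⟨
    Det M * Det I+J - Det M                 ≈⟨ +-congʳ (Det-⊗ M I+J) ⟨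
    Det (M ⊗ I+J) - Det M                   ≈⟨ +-congʳ (Det-cong λ i j → begin
      ∑ (λ k → M i k * (δ k j + 1#))          ≈⟨ trans (∑-cong (λ k → distribˡ _ _ _)) (∑-+ _ _) ⟩
      (M ⊗ δ) i j + ∑ (λ k → M i k * 1#)      ≈⟨ +-cong (⊗-δ M i j) (trans (∑-cong (λ k → *-identityʳ _)) (rows≈0 i)) ⟩
      M i j + 0#                              ≈⟨ +-identityʳ _ ⟩
      M i j                                   ∎) ⟩
    Det M - Det M                           ≈⟨ -‿inverseʳ _ ⟩
    0#                                      ∎)
    where
    I+J : Matrix (suc n)
    I+J i j = δ i j + 1#

  indicator : Bool → Carrier
  indicator b = if b then 1# else 0#

  ι-count : ∀ {n} (f : Fin n → Bool) → ι ∣ Vec.tabulate f ∣ ≈ ∑ (λ j → indicator (f j))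
  ι-count {zero}  f = sym (∑-empty _)
  ι-count {suc n} f = trans (go (f zero)) (sym (∑-suc _))
    where
    go : ∀ b → ι ∣ b Vec.∷ Vec.tabulate (f ∘ suc) ∣ ≈ indicator b + ∑ (λ j → indicator (f (suc j)))
    go true  = +-congˡ (ι-count (f ∘ suc))
    go false = trans (ι-count (f ∘ suc)) (sym (+-identityˡ _))

  ι-degree : ∀ {n} (G : Graph (Fin n)) i → ι (degree G i) ≈ ∑ (adjacency G i)
  ι-degree G i = ι-count (adj G i)

  diagonal≈ : ∀ {n} (d : Fin n → Carrier) i j → diagonal d i j ≈ d i * δ i j
  diagonal≈ d i j with i ≟ꟳ j
  ... | yes _ = sym (*-identityʳ _)
  ... | no  _ = sym (zeroʳ _)

  -- The diagonal is written as x times δ so that entrywise identities are polynomial identities in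
  -- δ i j, within reach of the ring solver.
  charMatrix : ∀ {n} → Matrix n → Carrier → Matrix n
  charMatrix M x i j = x * δ i j - M i j

  charPoly≈ : ∀ {n} (M : Matrix n) x → charPoly M x ≈ Det (charMatrix M x)
  charPoly≈ M x = trans (sym (Det≈det _)) (Det-cong λ i j → +-congʳ (scalar≈ x i j))

  ∑-charMatrix : ∀ {n} (M : Matrix n) x i → ∑ (charMatrix M x i) ≈ x - ∑ (M i)
  ∑-charMatrix M x i = begin
    ∑ (λ j → x * δ i j - M i j)             ≈⟨ trans (∑-+ _ _) (+-cong (sym (*-distribˡ-∑ x _)) (∑-neg _)) ⟩
    x * ∑ (δ i) - ∑ (M i)                   ≈⟨ +-congʳ (*-congˡ (trans (∑-cong (λ j → sym (*-identityʳ _))) (∑-δˡ i (λ _ → 1#)))) ⟩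
    x * 1# - ∑ (M i)                        ≈⟨ +-congʳ (*-identityʳ x) ⟩
    x - ∑ (M i)                             ∎

  polynomial-charPoly : ∀ {n} (M : Matrix n) → IsPolynomial (charPoly M)
  polynomial-charPoly M = polynomial-resp (λ x → sym (charPoly≈ M x)) (polynomial-Det λ i j →
    polynomial-sub (polynomial-* polynomial-var (polynomial-const _)) (polynomial-const _))

  module _ {n r} (G : Graph (Fin n)) (G-regular : Regular G r) where

    ∑-adjacency : ∀ i → ∑ (adjacency G i) ≈ ι r
    ∑-adjacency i = trans (sym (ι-degree G i)) (reflexive (≡.cong ι (G-regular i)))

    signlessLaplacian≈ : ∀ i j → signlessLaplacian G i j ≈ ι r * δ i j + adjacency G i j
    signlessLaplacian≈ i j = +-congʳ (trans (diagonal≈ (λ u → ι (degree G u)) i j) (*-congʳ (reflexive (≡.cong ι (G-regular i)))))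

    ∑-signlessLaplacian : ∀ i → ∑ (signlessLaplacian G i) ≈ ι 2 * ι r
    ∑-signlessLaplacian i = begin
      ∑ (signlessLaplacian G i)                         ≈⟨ trans (∑-cong (signlessLaplacian≈ i)) (∑-+ _ _) ⟩
      ∑ (λ j → ι r * δ i j) + ∑ (adjacency G i)         ≈⟨ +-cong (trans (∑-cong (λ j → *-comm _ _)) (∑-δˡ i _)) (∑-adjacency i) ⟩
      ι r + ι r                                         ≈⟨ solve 1 (λ r → r :+ r := :2 :* r) refl (ι r) ⟩
      ι 2 * ι r                                         ∎

    charPoly-shift : ∀ x → charPoly (signlessLaplacian G) (x + ι r) ≈ Det (charMatrix (adjacency G) x)
    charPoly-shift x = trans (charPoly≈ _ _) (Det-cong λ i j → trans (+-congˡ (-‿cong (signlessLaplacian≈ i j)))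
      (solve 4 (λ x r d a → (x :+ r) :* d :- (r :* d :+ a) := x :* d :- a) refl x (ι r) (δ i j) (adjacency G i j)))

  monic-zero : ∀ {n} (ν : Fin n → Carrier) {x} → monic (tabulate ν) x ≈ 0# → ∃ λ i → x ≈ ν i
  monic-zero {zero}  ν p = contradiction (sym p) 0≉1
  monic-zero {suc n} ν {x} p with x - ν zero ≟ 0#
  ... | yes q = zero , x∙y⁻¹≈ε⇒x≈y _ _ q
  ... | no ¬q = let (i , x≈νi) = monic-zero (ν ∘ suc) (*-cancelˡ-0 ¬q p) in suc i , x≈νi

  -- The rows of 2r I - Q sum to zero, so 2r is among the ν i and 2r ≤ ν₁. If ν₁ differed from 2r,
  -- the matrix ν₁ I - Q would have positive row sums ν₁ - 2r and nonpositive entries off the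
  -- diagonal, hence nonzero determinant, although ν₁ is a root.
  largest-eigenvalue : ∀ {m r} (G : Graph (Fin (suc m))) → Regular G r → (ν : Fin (suc m) → Carrier) →
                       Spectrum (signlessLaplacian G) (tabulate ν) → Decreasing ν → ν zero ≈ ι 2 * ι r
  largest-eigenvalue {m} {r} G G-regular ν spectrum decreasing with ν zero ≟ ι 2 * ι r
  ... | yes p = p
  ... | no ¬p = contradiction Det≈0 (M-matrix-Det≉0 (charMatrix Q (ν zero)) off-diagonal rows>0)
    where
    Q = signlessLaplacian G
    rows : ∀ x i → ∑ (charMatrix Q x i) ≈ x - ι 2 * ι r
    rows x i = trans (∑-charMatrix Q x i) (+-congˡ (-‿cong (∑-signlessLaplacian G G-regular i)))

    2r≤ν₀ : ι 2 * ι r ≤ ν zero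
    2r≤ν₀ = let
        (i , 2r≈νi) = monic-zero ν (trans (sym (spectrum (ι 2 * ι r))) (trans (charPoly≈ Q _)
          (zero-rows-Det≈0 _ (λ i → trans (rows _ i) (-‿inverseʳ _)))))
      in ≤-resp (sym 2r≈νi) refl (decreasing {zero} {i} z≤n)

    Det≈0 : Det (charMatrix Q (ν zero)) ≈ 0#
    Det≈0 = trans (sym (charPoly≈ Q _)) (trans (spectrum (ν zero)) (trans (*-congʳ (-‿inverseʳ _)) (zeroˡ _)))

    rows>0 : ∀ i → Positive (∑ (charMatrix Q (ν zero) i))
    rows>0 i = positive-resp (sym (rows (ν zero) i))
      (x≤y⇒0≤y-x 2r≤ν₀ , λ q → ¬p (x∙y⁻¹≈ε⇒x≈y _ _ q))

    off-diagonal : ∀ {i j} → i ≢ j → charMatrix Q (ν zero) i j ≤ 0#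
    off-diagonal {i} {j} i≢j = 0≤-x⇒x≤0 (≤-resp refl (sym (begin
      - (ν zero * δ i j - Q i j)                ≈⟨ -‿cong (+-congˡ (-‿cong (signlessLaplacian≈ G G-regular i j))) ⟩
      - (ν zero * δ i j - (ι r * δ i j + adjacency G i j))
        ≈⟨ -‿cong (+-cong (*-congˡ δij≈0) (-‿cong (+-congʳ (*-congˡ δij≈0)))) ⟩
      - (ν zero * 0# - (ι r * 0# + adjacency G i j))
        ≈⟨ solve 3 (λ x r a → :- (x :* con +0 :- (r :* con +0 :+ a)) := a) refl (ν zero) (ι r) _ ⟩
      adjacency G i j                           ∎)) (indicator-nonneg (adj G i j)))
      where
      δij≈0 : δ i j ≈ 0#
      δij≈0 with i ≟ꟳ j
      ... | yes i≡j = contradiction i≡j i≢j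
      ... | no  _   = refl
      indicator-nonneg : ∀ b → 0# ≤ indicator b
      indicator-nonneg true  = 0≤1
      indicator-nonneg false = ≤.refl

-- Splitting quadratics and cubics

module PolynomialRoots {c ℓ₁ ℓ₂} (F : RealClosedField c ℓ₁ ℓ₂) where

  open RealClosedField F
  open Spectral F
  open Field F
  open RingProperties ring
  open import Relation.Binary.Reasoning.Setoid setoid

  opaque
    -- The quadratic formula, stated through sum and product because these are all that the
    -- reduction of the join uses about p and q.
    quadratic-vieta : ∀ {p q} → 0# ≤ p * p - ι 4 * q → ∃[ α ] ∃[ β ] α + β ≈ - p × α * β ≈ q
    quadratic-vieta {p} {q} 0≤d = half * (- p + z) , half * (- p - z) , sum≈ , product≈
      where
      z : Carrier
      z = proj₁ (square-root 0≤d)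
      z² : z * z ≈ p * p - ι 4 * q
      z² = proj₂ (square-root 0≤d)
      2≉0 : ¬ (ι 2 ≈ 0#)
      2≉0 = proj₂ (ι-suc-positive 1)
      half : Carrier
      half = ι 2 ⁻¹⟨ 2≉0 ⟩

      sum≈ : half * (- p + z) + half * (- p - z) ≈ - p
      sum≈ = begin
        half * (- p + z) + half * (- p - z)  ≈⟨ solve 3 (λ h p z → h :* (:- p :+ z) :+ h :* (:- p :- z) := :2 :* h :* :- p) refl half p z ⟩
        ι 2 * half * - p                     ≈⟨ *-congʳ (*-inverseʳ 2≉0) ⟩
        1# * - p                             ≈⟨ *-identityˡ _ ⟩
        - p                                  ∎

      product≈ : half * (- p + z) * (half * (- p - z)) ≈ q
      product≈ = begin
        half * (- p + z) * (half * (- p - z))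
          ≈⟨ solve 3 (λ h p z → h :* (:- p :+ z) :* (h :* (:- p :- z)) := h :* h :* (p :* p :- z :* z)) refl half p z ⟩
        half * half * (p * p - z * z)                      ≈⟨ *-congˡ (+-congˡ (-‿cong z²)) ⟩
        half * half * (p * p - (p * p - ι 4 * q))
          ≈⟨ solve 3 (λ h p q → h :* h :* (p :* p :- (p :* p :- con (+ 4) :* q)) := :2 :* h :* (:2 :* h) :* q) refl half p q ⟩
        ι 2 * half * (ι 2 * half) * q                      ≈⟨ *-congʳ (*-cong (*-inverseʳ 2≉0) (*-inverseʳ 2≉0)) ⟩
        1# * 1# * q                                        ≈⟨ trans (*-congʳ (*-identityˡ 1#)) (*-identityˡ q) ⟩
        q                                                  ∎

  quadratic-roots : ∀ {p q} → 0# ≤ p * p - ι 4 * q → ∃[ α ] ∃[ β ] Roots (λ x → x * x + p * x + q) (α ∷ β ∷ [])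
  quadratic-roots {p} {q} 0≤d = factor (quadratic-vieta 0≤d)
    where
    factor : (∃[ α ] ∃[ β ] α + β ≈ - p × α * β ≈ q) → ∃[ α ] ∃[ β ] Roots (λ x → x * x + p * x + q) (α ∷ β ∷ [])
    factor (α , β , α+β , αβ) = α , β , λ x → begin
      x * x + p * x + q                   ≈⟨ solve 3 (λ x p q → x :* x :+ p :* x :+ q := x :* x :- :- p :* x :+ q) refl x p q ⟩
      x * x - - p * x + q                 ≈⟨ +-cong (+-congˡ (-‿cong (*-congʳ α+β))) αβ ⟨
      x * x - (α + β) * x + α * β
        ≈⟨ solve 3 (λ x α β → x :* x :- (α :+ β) :* x :+ α :* β := (x :- α) :* ((x :- β) :* :1)) refl x α β ⟩
      (x - α) * ((x - β) * 1#)            ∎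

  cubic : (c₂ c₁ c₀ x : Carrier) → Carrier
  cubic c₂ c₁ c₀ x = x * x * x + c₂ * (x * x) + c₁ * x + c₀

  private
    :cubic : ∀ {n} (c₂ c₁ c₀ x : Polynomial n) → Polynomial n
    :cubic c₂ c₁ c₀ x = x :* x :* x :+ c₂ :* (x :* x) :+ c₁ :* x :+ c₀

  module _ (c₂ c₁ c₀ : Carrier) where

    private
      f = cubic c₂ c₁ c₀

      f-cong : ∀ {x y} → x ≈ y → f x ≈ f y
      f-cong p = +-congʳ (+-cong (+-cong (*-cong (*-cong p p) p) (*-congˡ (*-cong p p))) (*-congˡ p))

    -- Division by x - y leaves a monic quadratic g. It vanishes at z because z differs from y, and
    -- its other root is forced by the sum of the three roots being - c₂.
    third-root : ∀ {y z} → ¬ (z - y ≈ 0#) → f y ≈ 0# → f z ≈ 0# → Roots f (y ∷ - c₂ - y - z ∷ z ∷ [])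
    third-root {y} {z} z-y≉0 fy≈0 fz≈0 x = begin
      f x                                      ≈⟨ remainder x ⟩
      f y + (x - y) * g x                      ≈⟨ +-cong fy≈0 (*-congˡ (begin
        g x
          ≈⟨ solve 5 (λ c₂ c₁ x y z → :g c₂ c₁ y x :=
               :g c₂ c₁ y z :+ (x :- (:- c₂ :- y :- z)) :* ((x :- z) :* :1)) refl c₂ c₁ x y z ⟩
        g z + (x - (- c₂ - y - z)) * ((x - z) * 1#)  ≈⟨ trans (+-congʳ gz≈0) (+-identityˡ _) ⟩
        (x - (- c₂ - y - z)) * ((x - z) * 1#)  ∎)) ⟩
      0# + (x - y) * ((x - (- c₂ - y - z)) * ((x - z) * 1#))  ≈⟨ +-identityˡ _ ⟩
      (x - y) * ((x - (- c₂ - y - z)) * ((x - z) * 1#))  ∎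
      where
      g : Carrier → Carrier
      g x = x * x + x * y + y * y + c₂ * (x + y) + c₁
      :g : ∀ {n} (c₂ c₁ y x : Polynomial n) → Polynomial n
      :g c₂ c₁ y x = x :* x :+ x :* y :+ y :* y :+ c₂ :* (x :+ y) :+ c₁

      remainder : ∀ x → f x ≈ f y + (x - y) * g x
      remainder x = solve 5 (λ c₂ c₁ c₀ x y → :cubic c₂ c₁ c₀ x := :cubic c₂ c₁ c₀ y :+ (x :- y) :* :g c₂ c₁ y x)
        refl c₂ c₁ c₀ x y

      gz≈0 : g z ≈ 0#
      gz≈0 = *-cancelˡ-0 z-y≉0 (begin
        (z - y) * g z          ≈⟨ +-identityˡ _ ⟨
        0# + (z - y) * g z     ≈⟨ +-congʳ fy≈0 ⟨
        f y + (z - y) * g z    ≈⟨ remainder z ⟨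
        f z                    ≈⟨ fz≈0 ⟩
        0#                     ∎)

    opaque
      -- Sign changes give two distinct roots.
      cubic-roots : ∀ {k b t} → k ≤ b → b ≤ t → 0# ≤ f k → Positive (- f b) → 0# ≤ f t →
                    ∃[ γ₁ ] ∃[ γ₂ ] ∃[ γ₃ ] Roots f (γ₁ ∷ γ₂ ∷ γ₃ ∷ [])
      cubic-roots {k} {b} {t} k≤b b≤t 0≤fk fb<0 0≤ft = conclude
        -- On [k, b] the cubic falls from nonnegative to negative, so the intermediate value
        -- property, stated for rising sign changes, is applied to its negative.
        (intermediateValue (- c₀ ∷ - c₁ ∷ - c₂ ∷ - 1# ∷ []) k≤b
           (0≤-x⇒x≤0 (≤-resp refl (trans (sym (-‿involutive _)) (-‿cong (neg k))) 0≤fk))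
           (≤-resp refl (neg b) (proj₁ fb<0)))
        (intermediateValue (c₀ ∷ c₁ ∷ c₂ ∷ 1# ∷ []) b≤t
           (≤-resp (pos b) refl (0≤-x⇒x≤0 (proj₁ fb<0))) (≤-resp refl (pos t) 0≤ft))
        where
        neg : ∀ x → - f x ≈ eval (- c₀ ∷ - c₁ ∷ - c₂ ∷ - 1# ∷ []) x
        neg = solve 4 (λ c₂ c₁ c₀ x → :- :cubic c₂ c₁ c₀ x :=
          :- c₀ :+ x :* (:- c₁ :+ x :* (:- c₂ :+ x :* (:- :1 :+ x :* con +0)))) refl c₂ c₁ c₀
        pos : ∀ x → f x ≈ eval (c₀ ∷ c₁ ∷ c₂ ∷ 1# ∷ []) x
        pos = solve 4 (λ c₂ c₁ c₀ x → :cubic c₂ c₁ c₀ x :=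
          c₀ :+ x :* (c₁ :+ x :* (c₂ :+ x :* (:1 :+ x :* con +0)))) refl c₂ c₁ c₀

        conclude : (∃ λ y → k ≤ y × y ≤ b × eval (- c₀ ∷ - c₁ ∷ - c₂ ∷ - 1# ∷ []) y ≈ 0#) →
                   (∃ λ z → b ≤ z × z ≤ t × eval (c₀ ∷ c₁ ∷ c₂ ∷ 1# ∷ []) z ≈ 0#) →
                   ∃[ γ₁ ] ∃[ γ₂ ] ∃[ γ₃ ] Roots f (γ₁ ∷ γ₂ ∷ γ₃ ∷ [])
        conclude (y , _ , y≤b , p) (z , b≤z , _ , q) = y , - c₂ - y - z , z , third-root z-y≉0 fy≈0 fz≈0
          where
          fy≈0 : f y ≈ 0#
          fy≈0 = trans (sym (-‿involutive _)) (trans (-‿cong (trans (neg y) p)) -0#≈0#)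
          fz≈0 : f z ≈ 0#
          fz≈0 = trans (pos z) q
          -- From y ≤ b ≤ z, equality of y and z would make b a root.
          z-y≉0 : ¬ (z - y ≈ 0#)
          z-y≉0 z-y≈0 = proj₂ fb<0 (trans (-‿cong (trans (f-cong b≈z) fz≈0)) -0#≈0#)
            where
            b≈z : b ≈ z
            b≈z = ≤.antisym b≤z (≤-resp (sym (x∙y⁻¹≈ε⇒x≈y z y z-y≈0)) refl y≤b)

  -- The characteristic polynomial of [[a, N, k], [1, b, 0], [k, 0, k]].
  opaque
    quotientCubic-roots : ∀ {a b k N} → 0# ≤ a → 0# ≤ b → Positive (b - k) → Positive N →
      ∃[ γ₁ ] ∃[ γ₂ ] ∃[ γ₃ ]
        Roots (cubic (- (a + b + k)) (a * b + (a + b) * k - N - k * k) (N * k + k * k * b - a * b * k))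
          (γ₁ ∷ γ₂ ∷ γ₃ ∷ [])
    -- The sign changes are read off `shape` and its rearrangements: the value at k is k² (b - k) ≥
    -- 0, the value at b is - N (b - k) < 0, and the value at t is nonnegative.
    quotientCubic-roots {a} {b} {k} {N} 0≤a 0≤b b-k>0@(0≤b-k , _) N>0 = cubic-roots _ _ _
      (0≤y-x⇒x≤y 0≤b-k)
      (0≤y-x⇒x≤y (≤-resp refl (solve 3 (λ a b L → a :+ L := a :+ b :+ L :- b) refl a b L) (+-nonneg 0≤a 0≤L)))
      (≤-resp refl (sym (trans (shape k)
        (solve 4 (λ k y K d → (k :- k) :* y :+ K :* d := K :* d) refl k _ (k * k) (b - k)))) 0≤k²d)
      (positive-resp (sym (trans (-‿cong (shape b))
        (solve 5 (λ b a N K d → :- (d :* ((b :- a) :* (b :- b) :- (N :+ K)) :+ K :* d) := N :* d) refl b a N (k * k) (b - k))))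
        (*-positive N>0 b-k>0))
      (≤-resp refl (sym (shape t)) (+-nonneg (*-nonneg
        (≤-resp refl (solve 4 (λ a b k L → a :+ L :+ (b :- k) := a :+ b :+ L :- k) refl a b k L)
          (+-nonneg (+-nonneg 0≤a 0≤L) 0≤b-k))
        (≤-resp refl (solve 3 (λ a b M → :1 :+ M :+ M :* M :+ (:1 :+ M) :* (a :+ b) :+ a :* b :=
            (a :+ b :+ (:1 :+ M) :- a) :* (a :+ b :+ (:1 :+ M) :- b) :- M) refl a b M)
          (+-nonneg (+-nonneg (+-nonneg 0≤L (*-nonneg 0≤M 0≤M)) (*-nonneg 0≤L (+-nonneg 0≤a 0≤b))) (*-nonneg 0≤a 0≤b))))
        0≤k²d))
      where
      M L t : Carrier
      M = N + k * k
      L = 1# + M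
      -- Chosen so that (t - a)(t - b) = (b + L)(a + L) ≥ L² ≥ M, which makes the bracket in `shape`
      -- nonnegative at t.
      t = a + b + L
      0≤M : 0# ≤ M
      0≤M = +-nonneg (proj₁ N>0) (square-nonneg k)
      0≤L : 0# ≤ L
      0≤L = +-nonneg 0≤1 0≤M
      0≤k²d : 0# ≤ k * k * (b - k)
      0≤k²d = *-nonneg (square-nonneg k) 0≤b-k
      shape : ∀ x → cubic (- (a + b + k)) (a * b + (a + b) * k - N - k * k) (N * k + k * k * b - a * b * k) x ≈
                    (x - k) * ((x - a) * (x - b) - (N + k * k)) + k * k * (b - k)
      shape = solve 5 (λ a b k N x →
        x :* x :* x :+ :- (a :+ b :+ k) :* (x :* x) :+ (a :* b :+ (a :+ b) :* k :- N :- k :* k) :* x :+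
          (N :* k :+ k :* k :* b :- a :* b :* k) :=
        (x :- k) :* ((x :- a) :* (x :- b) :- (N :+ k :* k)) :+ k :* k :* (b :- k)) refl a b k N

-- The characteristic polynomial of the join at a fixed large argument

module NNSJoin {c ℓ₁ ℓ₂} (F : RealClosedField c ℓ₁ ℓ₂) where

  open RealClosedField F
  open Spectral F
  open Field F
  open Determinant F
  open Multiplicativity F
  open Blocks F
  open PolynomialFunctions F
  open RegularSpectrum F
  open RingProperties ring
  open import Relation.Binary.Reasoning.Setoid setoid

  glue-δ : ∀ p {q} → glue {p} {q} (block δ zeros zeros δ) ≈ᴹ δ
  glue-δ zero    i       j       = refl
  glue-δ (suc p) zero    zero    = refl
  glue-δ (suc p) zero    (suc j) with splitAt p j
  ... | inj₁ _ = refl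
  ... | inj₂ _ = refl
  glue-δ (suc p) (suc i) zero    with splitAt p i
  ... | inj₁ _ = refl
  ... | inj₂ _ = refl
  glue-δ (suc p) (suc i) (suc j) = trans (go (splitAt p i) (splitAt p j)) (glue-δ p i j)
    where
    go : ∀ x y → block δ zeros zeros δ (Sum.map₁ suc x) (Sum.map₁ suc y) ≈ block δ zeros zeros δ x y
    go (inj₁ _) (inj₁ _) = refl
    go (inj₁ _) (inj₂ _) = refl
    go (inj₂ _) (inj₁ _) = refl
    go (inj₂ _) (inj₂ _) = refl

  module _ {n m r s} (G : Graph (Fin n)) (H : Graph (Fin m)) (G-regular : Regular G r) (H-regular : Regular H s) where

    private
      A = adjacency G
      C = adjacency H

    -- The adjacency matrix of the complement of G.
    B : Matrix n
    B i j = indicator (nonNeighbour G i j)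

    B≈ : ∀ i j → B i j ≈ 1# - δ i j - A i j
    B≈ i j with i ≟ꟳ j
    ... | yes ≡.refl = trans (solve 0 (con +0 := :1 :- :1 :- con +0) refl)
                             (+-congˡ (-‿cong (reflexive (≡.cong indicator (≡.sym (adj-irrefl G i))))))
    ... | no _ with adj G i j
    ...   | true  = solve 0 (con +0 := :1 :- con +0 :- :1) refl
    ...   | false = solve 0 (:1 := :1 :- con +0 :- con +0) refl

    B-sym : ∀ i j → B i j ≈ B j i
    B-sym i j = reflexive (≡.cong indicator (nonNeighbour-sym G i j))

    ∑-B : ∀ i → ∑ (B i) ≈ ι n - 1# - ι r
    ∑-B i = begin
      ∑ (B i)                                        ≈⟨ trans (∑-cong (B≈ i)) (∑-+ _ _) ⟩
      ∑ (λ j → 1# - δ i j) + ∑ (λ j → - A i j)       ≈⟨ +-cong (∑-+ _ _) (∑-neg _) ⟩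
      ∑ (λ (_ : Fin n) → 1#) + ∑ (λ j → - δ i j) - ∑ (A i)
        ≈⟨ +-cong (+-cong (trans (∑-const n 1#) (*-identityʳ _))
             (trans (∑-neg _) (-‿cong (trans (∑-cong (λ j → sym (*-identityʳ _))) (∑-δˡ i (λ _ → 1#))))))
             (-‿cong (∑-adjacency G G-regular i)) ⟩
      ι n - 1# - ι r                                 ∎

    -- This is (J - I - A)² = (n - 2 - 2r) J + (I + A)², by A J = J A = r J and J² = n J.
    B⊗B : ∀ i j → (B ⊗ B) i j ≈ (ι n - ι 2 - ι 2 * ι r) + (δ i j + ι 2 * A i j + (A ⊗ A) i j)
    B⊗B i j = begin
      ∑ (λ k → B i k * B k j)
        ≈⟨ ∑-cong (λ k → trans (*-congʳ (B≈ i k))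
             (solve 3 (λ d a b → (:1 :- d :- a) :* b := b :- d :* b :- a :* b) refl (δ i k) (A i k) (B k j))) ⟩
      ∑ (λ k → B k j - δ i k * B k j - A i k * B k j)
        ≈⟨ trans (∑-+ _ _) (+-cong (trans (∑-+ _ _) (+-congˡ (∑-neg _))) (∑-neg _)) ⟩
      ∑ (λ k → B k j) - (δ ⊗ B) i j - (A ⊗ B) i j
        ≈⟨ +-cong (+-cong (trans (∑-cong (λ k → B-sym k j)) (∑-B j)) (-‿cong (trans (δ-⊗ B i j) (B≈ i j)))) (-‿cong A⊗B) ⟩
      ι n - 1# - ι r - (1# - δ i j - A i j) - (ι r - A i j - (A ⊗ A) i j)
        ≈⟨ solve 5 (λ n r d a q → n :- :1 :- r :- (:1 :- d :- a) :- (r :- a :- q) :=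
             (n :- :2 :- :2 :* r) :+ (d :+ :2 :* a :+ q)) refl (ι n) (ι r) (δ i j) (A i j) ((A ⊗ A) i j) ⟩
      (ι n - ι 2 - ι 2 * ι r) + (δ i j + ι 2 * A i j + (A ⊗ A) i j) ∎
      where
      A⊗B : (A ⊗ B) i j ≈ ι r - A i j - (A ⊗ A) i j
      A⊗B = begin
        ∑ (λ k → A i k * B k j)
          ≈⟨ ∑-cong (λ k → trans (*-congˡ (B≈ k j))
               (solve 3 (λ d a b → b :* (:1 :- d :- a) := b :- b :* d :- b :* a) refl (δ k j) (A k j) (A i k))) ⟩
        ∑ (λ k → A i k - A i k * δ k j - A i k * A k j)
          ≈⟨ trans (∑-+ _ _) (+-cong (trans (∑-+ _ _) (+-congˡ (∑-neg _))) (∑-neg _)) ⟩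
        ∑ (A i) - (A ⊗ δ) i j - (A ⊗ A) i j
          ≈⟨ +-congʳ (+-cong (∑-adjacency G G-regular i) (-‿cong (⊗-δ A i j))) ⟩
        ι r - A i j - (A ⊗ A) i j ∎

    Vertex : Set
    Vertex = (Fin n ⊎ Fin m) ⊎ Fin n

    -- At uᵢ the r neighbours in G and the n - 1 - r new ones add up to n - 1, so r drops out.
    vertexDegree : Vertex → Carrier
    vertexDegree (inj₁ (inj₁ _)) = ι n + ι m - 1#
    vertexDegree (inj₁ (inj₂ _)) = ι n + ι s
    vertexDegree (inj₂ _)        = ι n - 1# - ι r

    vertex : Fin (n ℕ.+ m ℕ.+ n) → Vertex
    vertex i = Sum.map₁ (splitAt n) (splitAt (n ℕ.+ m) i)

    ι-degree-nnsJoin : ∀ i → ι (degree (nnsJoin G H) i) ≈ vertexDegree (vertex i)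
    ι-degree-nnsJoin i = begin
      ι (degree (nnsJoin G H) i)       ≈⟨ ι-degree (nnsJoin G H) i ⟩
      ∑ (λ j → a (vertex j))           ≈⟨ ∑-splitAt (n ℕ.+ m) (a ∘ Sum.map₁ (splitAt n)) ⟩
      ∑ (λ j → a (inj₁ (splitAt n j))) + ∑ (λ j → a (inj₂ j))  ≈⟨ +-congʳ (∑-splitAt n (a ∘ inj₁)) ⟩
      ∑ (λ j → a (inj₁ (inj₁ j))) + ∑ (λ j → a (inj₁ (inj₂ j))) + ∑ (λ j → a (inj₂ j))  ≈⟨ row (vertex i) ⟩
      vertexDegree (vertex i)          ∎
      where
      a : Vertex → Carrier
      a v = indicator (nnsAdj G H (vertex i) v)
      row : ∀ v → ∑ (λ j → indicator (nnsAdj G H v (inj₁ (inj₁ j)))) + ∑ (λ j → indicator (nnsAdj G H v (inj₁ (inj₂ j))))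
                  + ∑ (λ j → indicator (nnsAdj G H v (inj₂ j))) ≈ vertexDegree v
      row (inj₁ (inj₁ i)) = trans
        (+-cong (+-cong (∑-adjacency G G-regular i) (trans (∑-const m 1#) (*-identityʳ _)))
                (trans (∑-cong (λ j → B-sym j i)) (∑-B i)))
        (solve 3 (λ n m r → r :+ m :+ (n :- :1 :- r) := n :+ m :- :1) refl (ι n) (ι m) (ι r))
      row (inj₁ (inj₂ i)) = trans
        (+-cong (+-cong (trans (∑-const n 1#) (*-identityʳ _)) (∑-adjacency H H-regular i)) (∑-zero λ _ → refl))
        (+-identityʳ _)
      row (inj₂ i) = trans
        (+-cong (trans (+-cong (∑-B i) (∑-zero λ _ → refl)) (+-identityʳ _)) (∑-zero λ _ → refl))
        (+-identityʳ _)

    module _ (x : Carrier) where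

      private
        -- x₀, x₁ and w are x minus the degree of a vertex of G, of H and of a new vertex; y is the
        -- common column sum of the block x₁ I - C of H.
        x₀ x₁ w y : Carrier
        x₀ = x - (ι n + ι m - 1#)
        x₁ = x - ι n - ι s
        w  = x - (ι n - 1# - ι r)
        y  = x₁ - ι s

      -E : Fin n → Fin n ⊎ Fin m → Carrier
      -E i (inj₁ j) = - B i j
      -E i (inj₂ _) = 0#

      inner : ⊎Matrix n m
      inner = block (charMatrix A x₀) (λ _ _ → - 1#) (λ _ _ → - 1#) (charMatrix C x₁)

      outer : ⊎Matrix (n ℕ.+ m) n
      outer = block (glue inner) (λ i j → -E j (splitAt n i)) (λ i j → -E i (splitAt n j)) (scalar w)

      charPoly-outer : charPoly (signlessLaplacian (nnsJoin G H)) x ≈ Det (glue outer)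
      charPoly-outer = trans (charPoly≈ _ x) (Det-cong λ i j → begin
        x * δ i j - (diagonal (λ u → ι (degree (nnsJoin G H) u)) i j + a (vertex i) (vertex j))
          ≈⟨ +-congˡ (-‿cong (+-congʳ (trans (diagonal≈ (λ u → ι (degree (nnsJoin G H) u)) i j) (*-congʳ (ι-degree-nnsJoin i))))) ⟩
        x * δ i j - (vertexDegree (vertex i) * δ i j + a (vertex i) (vertex j))
          ≈⟨ solve 4 (λ x d t a → x :* t :- (d :* t :+ a) := (x :- d) :* t :- a) refl x _ (δ i j) _ ⟩
        (x - vertexDegree (vertex i)) * δ i j - a (vertex i) (vertex j)
          ≈⟨ +-congʳ (*-congˡ (glue-δ (n ℕ.+ m) i j)) ⟨
        (x - vertexDegree (vertex i)) * glue {n ℕ.+ m} (block δ zeros zeros δ) i j - a (vertex i) (vertex j)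
          ≈⟨ outer≈ (splitAt (n ℕ.+ m) i) (splitAt (n ℕ.+ m) j) ⟩
        glue outer i j ∎)
        where
        a : Vertex → Vertex → Carrier
        a u v = indicator (nnsAdj G H u v)
        d : Fin n ⊎ Fin m → Carrier
        d u = vertexDegree (inj₁ u)

        off : ∀ y a → y * 0# - a ≈ - a
        off y a = solve 2 (λ y a → y :* con +0 :- a := :- a) refl y a

        inner≈ : ∀ u v → (x - d u) * block δ zeros zeros δ u v - a (inj₁ u) (inj₁ v) ≈ inner u v
        inner≈ (inj₁ i) (inj₁ j) = refl
        inner≈ (inj₁ i) (inj₂ j) = off _ _
        inner≈ (inj₂ i) (inj₁ j) = off _ _
        inner≈ (inj₂ i) (inj₂ j) = +-congʳ (*-congʳ (solve 3 (λ x n s → x :- (n :+ s) := x :- n :- s) refl x (ι n) (ι s)))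

        -E≈ : ∀ u k y → y * 0# - a (inj₁ u) (inj₂ k) ≈ -E k u
        -E≈ (inj₁ i) k y = off _ _
        -E≈ (inj₂ i) k y = trans (off y 0#) -0#≈0#

        -Eᵀ≈ : ∀ u k y → y * 0# - a (inj₂ k) (inj₁ u) ≈ -E k u
        -Eᵀ≈ (inj₁ i) k y = off _ _
        -Eᵀ≈ (inj₂ i) k y = trans (off y 0#) -0#≈0#

        outer≈ : ∀ u v → (x - vertexDegree (Sum.map₁ (splitAt n) u)) * block δ zeros zeros δ u v
                         - a (Sum.map₁ (splitAt n) u) (Sum.map₁ (splitAt n) v) ≈ outer u v
        outer≈ (inj₁ i) (inj₁ j) = trans (+-congʳ (*-congˡ (sym (glue-δ n i j)))) (inner≈ (splitAt n i) (splitAt n j))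
        outer≈ (inj₁ i) (inj₂ j) = -E≈ (splitAt n i) j _
        outer≈ (inj₂ i) (inj₁ j) = -Eᵀ≈ (splitAt n j) i _
        outer≈ (inj₂ i) (inj₂ j) = trans (+-congˡ -0#≈0#) (trans (+-identityʳ _) (sym (scalar≈ w i j)))

      module _ (w≉0 : ¬ (w ≈ 0#)) (y≉0 : ¬ (y ≈ 0#)) where

        private
          w⁻¹ = w ⁻¹⟨ w≉0 ⟩
          y⁻¹ = y ⁻¹⟨ y≉0 ⟩

        X₁ X₂ : Matrix n
        X₁ i j = charMatrix A x₀ i j - (B ⊗ B) i j * w⁻¹
        X₂ i j = X₁ i j - ι m * y⁻¹

        -- The new vertices are pairwise nonadjacent and adjacent to vertices of G only. Eliminating
        -- their block w I therefore changes just the block of G, by - B² / w.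
        Det-outer : Det (glue outer) ≈ Det (glue (block X₁ (λ _ _ → - 1#) (λ _ _ → - 1#) (charMatrix C x₁))) * w ^ n
        Det-outer = begin
          Det (glue outer)
            ≈⟨ Det-schurʳ (glue inner) (λ i j → -E j (splitAt n i)) (λ i j → -E i (splitAt n j)) (scalar w) S (λ i j → begin
                 -E j (splitAt n i)                  ≈⟨ *-identityʳ _ ⟨
                 -E j (splitAt n i) * 1#             ≈⟨ *-congˡ (*-inverseʳ w≉0) ⟨
                 -E j (splitAt n i) * (w * w⁻¹)      ≈⟨ solve 3 (λ e w v → e :* (w :* v) := e :* v :* w) refl _ w w⁻¹ ⟩
                 S i j * w                           ≈⟨ ⊗-scalar w S i j ⟨
                 (S ⊗ scalar w) i j                  ∎) ⟩
          Det (λ i j → glue inner i j - ∑ (λ k → S i k * -E k (splitAt n j))) * Det (scalar {n} w)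
            ≈⟨ *-cong (Det-cong λ i j → reduced (splitAt n i) (splitAt n j)) (Det-scalar n w) ⟩
          Det (glue (block X₁ (λ _ _ → - 1#) (λ _ _ → - 1#) (charMatrix C x₁))) * w ^ n ∎
          where
          S : Fin (n ℕ.+ m) → Fin n → Carrier
          S i j = -E j (splitAt n i) * w⁻¹
          -0+ : ∀ z {t} → t ≈ 0# → z - t ≈ z
          -0+ z t≈0 = trans (+-congˡ (trans (-‿cong t≈0) -0#≈0#)) (+-identityʳ z)
          reduced : ∀ u v → inner u v - ∑ (λ k → -E k u * w⁻¹ * -E k v) ≈ block X₁ (λ _ _ → - 1#) (λ _ _ → - 1#) (charMatrix C x₁) u v
          reduced (inj₁ i) (inj₁ j) = +-congˡ (-‿cong (trans
            (∑-cong (λ k → trans (*-congʳ (*-congʳ (-‿cong (B-sym k i))))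
              (solve 3 (λ a b v → :- a :* v :* :- b := a :* b :* v) refl (B i k) (B k j) w⁻¹)))
            (sym (*-distribʳ-∑ w⁻¹ _))))
          reduced (inj₁ i) (inj₂ j) = -0+ _ (∑-zero λ k → zeroʳ _)
          reduced (inj₂ i) (inj₁ j) = -0+ _ (∑-zero λ k → trans (*-congʳ (zeroˡ _)) (zeroˡ _))
          reduced (inj₂ i) (inj₂ j) = -0+ _ (∑-zero λ k → zeroʳ _)

        -- The row vector of ones times the block of H is y times itself, so the border - 1 is (- 1
        -- / y) times that block. The correction to X₁ is then a sum of m equal terms 1 / y.
        Det-inner : Det (glue (block X₁ (λ _ _ → - 1#) (λ _ _ → - 1#) (charMatrix C x₁))) ≈ Det X₂ * Det (charMatrix C x₁)
        Det-inner = trans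
          (Det-schurʳ X₁ (λ _ _ → - 1#) (λ _ _ → - 1#) (charMatrix C x₁) (λ _ _ → - y⁻¹) (λ _ j → sym (begin
            ∑ (λ k → - y⁻¹ * charMatrix C x₁ k j)    ≈⟨ *-distribˡ-∑ (- y⁻¹) _ ⟨
            - y⁻¹ * ∑ (λ k → charMatrix C x₁ k j)    ≈⟨ *-congˡ (column j) ⟩
            - y⁻¹ * y                                ≈⟨ solve 2 (λ y v → :- v :* y := :- (y :* v)) refl y y⁻¹ ⟩
            - (y * y⁻¹)                              ≈⟨ -‿cong (*-inverseʳ y≉0) ⟩
            - 1#                                     ∎)))
          (*-congʳ (Det-cong λ i j → +-congˡ (-‿cong (trans (∑-const m _)
            (*-congˡ (solve 1 (λ v → :- v :* :- :1 := v) refl y⁻¹))))))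
          where
          column : ∀ j → ∑ (λ k → charMatrix C x₁ k j) ≈ y
          column j = begin
            ∑ (λ k → x₁ * δ k j - C k j)            ≈⟨ trans (∑-+ _ _) (+-congˡ (∑-neg _)) ⟩
            ∑ (λ k → x₁ * δ k j) - ∑ (λ k → C k j)
              ≈⟨ +-cong (∑-δʳ j (λ _ → x₁)) (-‿cong (trans (∑-cong (λ k → reflexive (≡.cong indicator (adj-sym H k j))))
                   (∑-adjacency H H-regular j))) ⟩
            x₁ - ι s                                ∎

        -- w X₂ = - ((p I - A) (q I - A) + e J) with p, q the roots of λ² + (w + 2) λ + (1 - w x₀).
        module _ {p q : Carrier} (p+q : p + q ≈ - (w + ι 2)) (pq : p * q ≈ 1# - w * x₀)
                 (p-r≉0 : ¬ ((p - ι r) * (q - ι r) ≈ 0#)) where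

          private
            -- h is the row sum of PQ = (p I - A)(q I - A), hence PQ J = h J and PQ + e J = PQ (I +
            -- g J) with g = e / h. In e the first summand comes from B² and the second from
            -- eliminating H.
            h e g : Carrier
            h = (p - ι r) * (q - ι r)
            e = (ι n - ι 2 - ι 2 * ι r) + w * (ι m * y⁻¹)
            g = e * h ⁻¹⟨ p-r≉0 ⟩
            hg≈e : h * g ≈ e
            hg≈e = begin
              h * (e * h ⁻¹⟨ p-r≉0 ⟩)  ≈⟨ solve 3 (λ h e v → h :* (e :* v) := h :* v :* e) refl h e _ ⟩
              h * h ⁻¹⟨ p-r≉0 ⟩ * e    ≈⟨ *-congʳ (*-inverseʳ p-r≉0) ⟩
              1# * e                   ≈⟨ *-identityˡ e ⟩
              e                        ∎

            PQ : Matrix n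
            PQ = charMatrix A p ⊗ charMatrix A q

            I+gJ : Matrix n
            I+gJ i j = δ i j + g

            PQ≈ : ∀ i j → PQ i j ≈ p * q * δ i j - (p + q) * A i j + (A ⊗ A) i j
            PQ≈ i j = begin
              ∑ (λ k → (p * δ i k - A i k) * (q * δ k j - A k j))
                ≈⟨ ∑-cong (λ k → solve 6 (λ p q d a d′ a′ → (p :* d :- a) :* (q :* d′ :- a′) :=
                     d :* (p :* (q :* d′ :- a′)) :+ (:- q :* (a :* d′) :+ a :* a′)) refl p q (δ i k) (A i k) (δ k j) (A k j)) ⟩
              ∑ (λ k → δ i k * (p * (q * δ k j - A k j)) + (- q * (A i k * δ k j) + A i k * A k j))
                ≈⟨ trans (∑-+ _ _) (+-cong (∑-δˡ i (λ k → p * (q * δ k j - A k j))) (trans (∑-+ _ _) (+-congʳ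
                     (trans (sym (*-distribˡ-∑ (- q) _)) (*-congˡ (⊗-δ A i j)))))) ⟩
              p * (q * δ i j - A i j) + (- q * A i j + (A ⊗ A) i j)
                ≈⟨ solve 5 (λ p q d a t → p :* (q :* d :- a) :+ (:- q :* a :+ t) := p :* q :* d :- (p :+ q) :* a :+ t)
                     refl p q (δ i j) (A i j) _ ⟩
              p * q * δ i j - (p + q) * A i j + (A ⊗ A) i j ∎

            ∑-PQ : ∀ i → ∑ (PQ i) ≈ h
            ∑-PQ i = begin
              ∑ (λ j → ∑ (λ k → charMatrix A p i k * charMatrix A q k j))  ≈⟨ ∑-swap _ ⟩
              ∑ (λ k → ∑ (λ j → charMatrix A p i k * charMatrix A q k j))
                ≈⟨ ∑-cong (λ k → trans (sym (*-distribˡ-∑ _ _)) (*-congˡ (row q k))) ⟩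
              ∑ (λ k → charMatrix A p i k * (q - ι r))    ≈⟨ *-distribʳ-∑ _ _ ⟨
              ∑ (charMatrix A p i) * (q - ι r)            ≈⟨ *-congʳ (row p i) ⟩
              h                                           ∎
              where
              row : ∀ t i → ∑ (charMatrix A t i) ≈ t - ι r
              row t i = trans (∑-charMatrix A t i) (+-congˡ (-‿cong (∑-adjacency G G-regular i)))

          -- The factor w ^ n supplied by `Det-outer` is spent on multiplying X₂ by w, which clears
          -- the inverse of w in B² / w and leaves a quadratic polynomial in A plus a multiple of J.
          w^n*Det-X₂ : w ^ n * Det X₂ ≈ (- 1#) ^ n * (Det (charMatrix A p) * Det (charMatrix A q) * (1# + ι n * g))
          w^n*Det-X₂ = begin
            w ^ n * Det X₂                                  ≈⟨ *-congʳ (Det-scalar n w) ⟨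
            Det (scalar {n} w) * Det X₂                     ≈⟨ Det-⊗ (scalar w) X₂ ⟨
            Det (scalar w ⊗ X₂)                             ≈⟨ Det-cong entry ⟩
            Det (scalar (- 1#) ⊗ (PQ ⊗ I+gJ))               ≈⟨ trans (Det-⊗ (scalar (- 1#)) (PQ ⊗ I+gJ)) (*-congˡ (trans (Det-⊗ PQ I+gJ)
                                                                 (*-congʳ (Det-⊗ (charMatrix A p) (charMatrix A q))))) ⟩
            Det (scalar {n} (- 1#)) * (Det (charMatrix A p) * Det (charMatrix A q) * Det I+gJ)
              ≈⟨ *-cong (Det-scalar n (- 1#)) (*-congˡ (Det-δ+const n g)) ⟩
            (- 1#) ^ n * (Det (charMatrix A p) * Det (charMatrix A q) * (1# + ι n * g)) ∎
            where
            PQ[I+gJ]≈ : ∀ i j → (PQ ⊗ I+gJ) i j ≈ PQ i j + e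
            PQ[I+gJ]≈ i j = begin
              ∑ (λ k → PQ i k * (δ k j + g))              ≈⟨ trans (∑-cong (λ k → distribˡ _ _ _)) (∑-+ _ _) ⟩
              (PQ ⊗ δ) i j + ∑ (λ k → PQ i k * g)         ≈⟨ +-cong (⊗-δ PQ i j) (trans (sym (*-distribʳ-∑ g _)) (*-congʳ (∑-PQ i))) ⟩
              PQ i j + h * g                              ≈⟨ +-congˡ hg≈e ⟩
              PQ i j + e                                  ∎

            entry : ∀ i j → (scalar w ⊗ X₂) i j ≈ (scalar (- 1#) ⊗ (PQ ⊗ I+gJ)) i j
            entry i j = begin
              (scalar w ⊗ X₂) i j                           ≈⟨ scalar-⊗ w X₂ i j ⟩
              w * (x₀ * δ i j - A i j - b * w⁻¹ - ι m * y⁻¹)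
                ≈⟨ solve 6 (λ w z a b v c → w :* (z :- a :- b :* v :- c) := w :* z :- w :* a :- b :* (w :* v) :- w :* c)
                     refl w (x₀ * δ i j) (A i j) b w⁻¹ (ι m * y⁻¹) ⟩
              w * (x₀ * δ i j) - w * A i j - b * (w * w⁻¹) - w * (ι m * y⁻¹)
                ≈⟨ +-congʳ (+-congˡ (-‿cong (trans (*-cong (B⊗B i j) (*-inverseʳ w≉0)) (*-identityʳ _)))) ⟩
              w * (x₀ * δ i j) - w * A i j - (t + (δ i j + ι 2 * A i j + (A ⊗ A) i j)) - w * (ι m * y⁻¹)
                ≈⟨ +-congʳ (solve 6 (λ w z d a t k → w :* (z :* d) :- w :* a :- (t :+ (d :+ :2 :* a :+ k)) :=
                     :- :1 :* ((:1 :- w :* z) :* d :- :- (w :+ :2) :* a :+ k) :- t) refl w x₀ (δ i j) (A i j) t ((A ⊗ A) i j)) ⟩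
              - 1# * ((1# - w * x₀) * δ i j - - (w + ι 2) * A i j + (A ⊗ A) i j) - t - w * (ι m * y⁻¹)
                ≈⟨ +-congʳ (+-congʳ (*-congˡ (+-congʳ (+-cong (*-congʳ pq) (-‿cong (*-congʳ p+q)))))) ⟨
              - 1# * (p * q * δ i j - (p + q) * A i j + (A ⊗ A) i j) - t - w * (ι m * y⁻¹)
                ≈⟨ +-congʳ (+-congʳ (*-congˡ (PQ≈ i j))) ⟨
              - 1# * PQ i j - t - w * (ι m * y⁻¹)
                ≈⟨ solve 3 (λ z t c → :- :1 :* z :- t :- c := :- :1 :* (z :+ (t :+ c))) refl (PQ i j) t _ ⟩
              - 1# * (PQ i j + e)                           ≈⟨ *-congˡ (PQ[I+gJ]≈ i j) ⟨
              - 1# * (PQ ⊗ I+gJ) i j                        ≈⟨ scalar-⊗ (- 1#) (PQ ⊗ I+gJ) i j ⟨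
              (scalar (- 1#) ⊗ (PQ ⊗ I+gJ)) i j             ∎
              where
              b t : Carrier
              b = (B ⊗ B) i j
              t = ι n - ι 2 - ι 2 * ι r

          -- The factor of the all-ones directions, cleared of y⁻¹ and h⁻¹.
          y*h*[1+ng] : y * (h * (1# + ι n * g)) ≈ y * (h + ι n * (ι n - ι 2 - ι 2 * ι r)) + ι n * (w * ι m)
          y*h*[1+ng] = begin
            y * (h * (1# + ι n * g))        ≈⟨ solve 4 (λ y h n g → y :* (h :* (:1 :+ n :* g)) := y :* (h :+ n :* (h :* g))) refl y h (ι n) g ⟩
            y * (h + ι n * (h * g))         ≈⟨ *-congˡ (+-congˡ (*-congˡ hg≈e)) ⟩
            y * (h + ι n * (t + w * (ι m * y⁻¹)))
              ≈⟨ solve 7 (λ y h n t w m v → y :* (h :+ n :* (t :+ w :* (m :* v))) :=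
                   y :* (h :+ n :* t) :+ n :* (w :* m) :* (y :* v)) refl y h (ι n) t w (ι m) y⁻¹ ⟩
            y * (h + ι n * t) + ι n * (w * ι m) * (y * y⁻¹)
              ≈⟨ +-congˡ (trans (*-congˡ (*-inverseʳ y≉0)) (*-identityʳ _)) ⟩
            y * (h + ι n * t) + ι n * (w * ι m) ∎
            where
            t = ι n - ι 2 - ι 2 * ι r

          charPoly-nnsJoin : charPoly (signlessLaplacian (nnsJoin G H)) x ≈
            (- 1#) ^ n * (charPoly (signlessLaplacian G) (p + ι r) * charPoly (signlessLaplacian G) (q + ι r) * (1# + ι n * g))
            * charPoly (signlessLaplacian H) (x - ι n)
          charPoly-nnsJoin = begin
            charPoly (signlessLaplacian (nnsJoin G H)) x      ≈⟨ trans charPoly-outer (trans Det-outer (*-congʳ Det-inner)) ⟩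
            Det X₂ * Det (charMatrix C x₁) * w ^ n
              ≈⟨ solve 3 (λ d c w → d :* c :* w := w :* d :* c) refl (Det X₂) _ (w ^ n) ⟩
            w ^ n * Det X₂ * Det (charMatrix C x₁)            ≈⟨ *-congʳ w^n*Det-X₂ ⟩
            (- 1#) ^ n * (Det (charMatrix A p) * Det (charMatrix A q) * (1# + ι n * g)) * Det (charMatrix C x₁)
              ≈⟨ *-cong (*-congˡ (*-congʳ (*-cong (charPoly-shift G G-regular p) (charPoly-shift G G-regular q))))
                   (trans (charPoly-cong (solve 3 (λ x n s → x :- n := x :- n :- s :+ s) refl x (ι n) (ι s)))
                     (charPoly-shift H H-regular x₁)) ⟨
            (- 1#) ^ n * (charPoly (signlessLaplacian G) (p + ι r) * charPoly (signlessLaplacian G) (q + ι r) * (1# + ι n * g))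
            * charPoly (signlessLaplacian H) (x - ι n) ∎
            where
            charPoly-cong : ∀ {x y} → x ≈ y → charPoly (signlessLaplacian H) x ≈ charPoly (signlessLaplacian H) y
            charPoly-cong {x} {y} x≈y = trans (charPoly≈ (signlessLaplacian H) x)
              (trans (Det-cong λ i j → +-congʳ (*-congʳ x≈y)) (sym (charPoly≈ (signlessLaplacian H) y)))

-- Matching the factors with the quadratics and the cubic

module NNSSpectrum {c ℓ₁ ℓ₂} (F : RealClosedField c ℓ₁ ℓ₂) where

  open RealClosedField F
  open Spectral F
  open Field F
  open Determinant F using (_^_)
  open PolynomialFunctions F
  open PolynomialRoots F
  open RegularSpectrum F using (largest-eigenvalue; polynomial-charPoly)
  open NNSJoin F
  open RingProperties ring
  open CommutativeMonoidSum *-commutativeMonoid using ()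
    renaming (sum to ∏; sum-cong-≋ to ∏-cong; ∑-distrib-+ to ∏-distrib-*; sum-replicate to ∏-replicate)
  open import Relation.Binary.Reasoning.Setoid setoid

  monic-tabulate : ∀ {n} (f : Fin n → Carrier) x → monic (tabulate f) x ≈ ∏ (λ i → x - f i)
  monic-tabulate {zero}  f x = refl
  monic-tabulate {suc n} f x = *-congˡ (monic-tabulate (f ∘ suc) x)

  monic-++ : ∀ ρs σs x → monic (ρs ++ σs) x ≈ monic ρs x * monic σs x
  monic-++ []       σs x = sym (*-identityˡ _)
  monic-++ (ρ ∷ ρs) σs x = trans (*-congˡ (monic-++ ρs σs x)) (sym (*-assoc _ _ _))

  monic-concat : ∀ {n} (f : Fin n → List Carrier) x → monic (concat (tabulate f)) x ≈ ∏ (λ i → monic (f i) x)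
  monic-concat {zero}  f x = refl
  monic-concat {suc n} f x = trans (monic-++ (f zero) _ x) (*-congˡ (monic-concat (f ∘ suc) x))

  module _ (n m r : Carrier) where

    quadratic₁ quadratic₀ : Carrier → Carrier
    quadratic₁ ν = ι 2 * r - ι 2 * n - m - ν + ι 2
    quadratic₀ ν = n * n - ι 2 * r * n - ι 2 * n + n * m - r * m - m + ι 4 * r + ν * (n + r - ι 3 - ν)

    quadratic : Carrier → Carrier → Carrier
    quadratic ν x = x * x + quadratic₁ ν * x + quadratic₀ ν

    private
      :quadratic₁ :quadratic₀ : ∀ {k} (n m r ν : Polynomial k) → Polynomial k
      :quadratic₁ n m r ν = :2 :* r :- :2 :* n :- m :- ν :+ :2
      :quadratic₀ n m r ν = n :* n :- :2 :* r :* n :- :2 :* n :+ n :* m :- r :* m :- m :+ con (+ 4) :* r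
                            :+ ν :* (n :+ r :- con (+ 3) :- ν)

    -- (a - d)² + (2b)² for the 2×2 matrix [[a, b], [b, d]] of the eigenvalue ν.
    discriminant≥0 : ∀ ν → 0# ≤ quadratic₁ ν * quadratic₁ ν - ι 4 * quadratic₀ ν
    discriminant≥0 ν = ≤-resp refl
      (solve 4 (λ n m r ν →
        (m :+ ν) :* (m :+ ν) :+ (:2 :* (:1 :+ ν :- r)) :* (:2 :* (:1 :+ ν :- r)) :=
        :quadratic₁ n m r ν :* :quadratic₁ n m r ν :- con (+ 4) :* :quadratic₀ n m r ν) refl n m r ν)
      (+-nonneg (square-nonneg (m + ν)) (square-nonneg (ι 2 * (1# + ν - r))))

    module _ (x : Carrier) where

      w x₀ : Carrier
      w  = x - (n - 1# - r)
      x₀ = x - (n + m - 1#)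

      -- With λ = ν - r, an eigenvalue of A, the left side is w (x₀ - λ) - (1 + λ)². This is the
      -- characteristic determinant of the 2×2 block in which B acts on an eigenvector orthogonal to
      -- the ones as - (1 + λ).
      quadratic-factors : ∀ {p q} → p + q ≈ - (w + ι 2) → p * q ≈ 1# - w * x₀ →
                          ∀ ν → - 1# * ((p + r - ν) * (q + r - ν)) ≈ quadratic ν x
      quadratic-factors {p} {q} p+q pq ν = begin
        - 1# * ((p + r - ν) * (q + r - ν))
          ≈⟨ solve 4 (λ p q r ν → :- :1 :* ((p :+ r :- ν) :* (q :+ r :- ν)) :=
               (p :+ q) :* (ν :- r) :- p :* q :- (ν :- r) :* (ν :- r)) refl p q r ν ⟩
        (p + q) * (ν - r) - p * q - (ν - r) * (ν - r)
          ≈⟨ +-congʳ (+-cong (*-congʳ p+q) (-‿cong pq)) ⟩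
        - (w + ι 2) * (ν - r) - (1# - w * x₀) - (ν - r) * (ν - r)
          ≈⟨ solve 5 (λ n m r ν x →
               :- (x :- (n :- :1 :- r) :+ :2) :* (ν :- r)
               :- (:1 :- (x :- (n :- :1 :- r)) :* (x :- (n :+ m :- :1))) :- (ν :- r) :* (ν :- r) :=
               x :* x :+ :quadratic₁ n m r ν :* x :+ :quadratic₀ n m r ν) refl n m r ν x ⟩
        quadratic ν x ∎

    module _ (s : Carrier) where

      cubic₂ cubic₁ cubic₀ : Carrier
      cubic₂ = ι 2 - ι 3 * n - m - ι 2 * s
      cubic₁ = n * m - m * r - m + ι 2 * (n * n) + ι 2 * r * n - ι 2 * n - ι 2 * r - ι 2 * (r * r)
               + ι 4 * s * n - ι 4 * s + ι 2 * s * m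
      cubic₀ = ι 2 * n * (r * r) + ι 2 * r * n - ι 2 * r * (n * n) - ι 2 * s * n * m + ι 2 * r * s * m
               + ι 2 * s * m + ι 4 * s * (r * r) + ι 4 * r * s - ι 4 * r * s * n

      private
        -- Entries of the quotient matrix of Q for the partition into V(G₁), V(G₂) and the new
        -- vertices: a, b and k are the diagonal, and k is also the number of edges from a vertex uᵢ
        -- to new vertices and conversely. The entries m and n between the first two classes matter
        -- only through their product.
        a b k : Carrier
        a = n + m - 1# + r
        b = n + s + s
        k = n - 1# - r

        :a :b :k : ∀ {j} (n m r s : Polynomial j) → Polynomial j
        :a n m r s = n :+ m :- :1 :+ r
        :b n m r s = n :+ s :+ s
        :k n m r s = n :- :1 :- r

        cubic₂≈ : - (a + b + k) ≈ cubic₂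
        cubic₂≈ = solve 4 (λ n m r s → :- (:a n m r s :+ :b n m r s :+ :k n m r s) :=
          :2 :- con (+ 3) :* n :- m :- :2 :* s) refl n m r s

        cubic₁≈ : a * b + (a + b) * k - n * m - k * k ≈ cubic₁
        cubic₁≈ = solve 4 (λ n m r s →
          :a n m r s :* :b n m r s :+ (:a n m r s :+ :b n m r s) :* :k n m r s :- n :* m :- :k n m r s :* :k n m r s :=
          n :* m :- m :* r :- m :+ :2 :* (n :* n) :+ :2 :* r :* n :- :2 :* n :- :2 :* r :- :2 :* (r :* r)
            :+ con (+ 4) :* s :* n :- con (+ 4) :* s :+ :2 :* s :* m) refl n m r s

        cubic₀≈ : n * m * k + k * k * b - a * b * k ≈ cubic₀
        cubic₀≈ = solve 4 (λ n m r s →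
          n :* m :* :k n m r s :+ :k n m r s :* :k n m r s :* :b n m r s :- :a n m r s :* :b n m r s :* :k n m r s :=
          :2 :* n :* (r :* r) :+ :2 :* r :* n :- :2 :* r :* (n :* n) :- :2 :* s :* n :* m :+ :2 :* r :* s :* m
            :+ :2 :* s :* m :+ con (+ 4) :* s :* (r :* r) :+ con (+ 4) :* r :* s :- con (+ 4) :* r :* s :* n) refl n m r s

        cubic-cong : ∀ {c₂ c₁ c₀ d₂ d₁ d₀} → c₂ ≈ d₂ → c₁ ≈ d₁ → c₀ ≈ d₀ → ∀ x → cubic c₂ c₁ c₀ x ≈ cubic d₂ d₁ d₀ x
        cubic-cong p₂ p₁ p₀ x = +-cong (+-cong (+-congˡ (*-congʳ p₂)) (*-congʳ p₁)) p₀

      cubic-shape : ∀ x → cubic cubic₂ cubic₁ cubic₀ x ≈ (x - b) * ((x - a) * (x - k) - k * k) - n * m * (x - k)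
      cubic-shape x = trans (sym (cubic-cong cubic₂≈ cubic₁≈ cubic₀≈ x))
        (solve 5 (λ a b k N x →
          x :* x :* x :+ :- (a :+ b :+ k) :* (x :* x) :+ (a :* b :+ (a :+ b) :* k :- N :- k :* k) :* x
            :+ (N :* k :+ k :* k :* b :- a :* b :* k) :=
          (x :- b) :* ((x :- a) :* (x :- k) :- k :* k) :- N :* (x :- k)) refl a b k (n * m) x)

      opaque
        roots-cubic : 0# ≤ n + m - 1# → 0# ≤ r → 0# ≤ s → Positive n → Positive m →
          ∃[ γ₁ ] ∃[ γ₂ ] ∃[ γ₃ ] Roots (cubic cubic₂ cubic₁ cubic₀) (γ₁ ∷ γ₂ ∷ γ₃ ∷ [])
        roots-cubic 0≤n+m-1 0≤r 0≤s n>0 m>0 = restate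
          (quotientCubic-roots {a} {b} {k} {n * m} (+-nonneg 0≤n+m-1 0≤r)
            (+-nonneg (+-nonneg (proj₁ n>0) 0≤s) 0≤s)
            (positive-resp (solve 3 (λ n r s → :1 :+ (r :+ s :+ s) := n :+ s :+ s :- (n :- :1 :- r)) refl n r s)
              (positive-+-nonneg 1-positive (+-nonneg (+-nonneg 0≤r 0≤s) 0≤s)))
            (*-positive n>0 m>0))
          where
          restate : (∃[ γ₁ ] ∃[ γ₂ ] ∃[ γ₃ ]
                      Roots (cubic (- (a + b + k)) (a * b + (a + b) * k - n * m - k * k) (n * m * k + k * k * b - a * b * k))
                            (γ₁ ∷ γ₂ ∷ γ₃ ∷ [])) →
                    ∃[ γ₁ ] ∃[ γ₂ ] ∃[ γ₃ ] Roots (cubic cubic₂ cubic₁ cubic₀) (γ₁ ∷ γ₂ ∷ γ₃ ∷ [])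
          restate (γ₁ , γ₂ , γ₃ , roots) = γ₁ , γ₂ , γ₃ , λ x →
            trans (sym (cubic-cong cubic₂≈ cubic₁≈ cubic₀≈ x)) (roots x)

      module _ (x : Carrier) where

        y : Carrier
        y = x - n - s - s

        -- On the all-ones vector B acts as k, and k² = (1 + r)² + n (n - 2 - 2r). Hence (x - a) w -
        -- k² is minus the sum of h = (p - r)(q - r) and the J part of B².
        cubic-factor : ∀ {p q} → p + q ≈ - (w x + ι 2) → p * q ≈ 1# - w x * x₀ x →
          - 1# * (y * ((p - r) * (q - r) + n * (n - ι 2 - ι 2 * r)) + n * (w x * m)) ≈ cubic cubic₂ cubic₁ cubic₀ x
        cubic-factor {p} {q} p+q pq = sym (begin
          cubic cubic₂ cubic₁ cubic₀ x  ≈⟨ cubic-shape x ⟩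
          (x - b) * ((x - a) * w x - k * k) - n * m * w x
            ≈⟨ +-cong (*-cong (solve 3 (λ x n s → x :- (n :+ s :+ s) := x :- n :- s :- s) refl x n s) (begin
                 (x - a) * w x - k * k
                   ≈⟨ solve 5 (λ n m r x w → (x :- (n :+ m :- :1 :+ r)) :* w :- (n :- :1 :- r) :* (n :- :1 :- r) :=
                        :- (:1 :- w :* (x :- (n :+ m :- :1)) :- :- (w :+ :2) :* r :+ r :* r :+ n :* (n :- :2 :- :2 :* r)))
                        refl n m r x (w x) ⟩
                 - (1# - w x * x₀ x - - (w x + ι 2) * r + r * r + n * (n - ι 2 - ι 2 * r))
                   ≈⟨ -‿cong (+-congʳ (+-congʳ (+-cong pq (-‿cong (*-congʳ p+q))))) ⟨
                 - (p * q - (p + q) * r + r * r + n * (n - ι 2 - ι 2 * r))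
                   ≈⟨ -‿cong (+-congʳ (solve 3 (λ p q r → p :* q :- (p :+ q) :* r :+ r :* r := (p :- r) :* (q :- r)) refl p q r)) ⟩
                 - ((p - r) * (q - r) + n * (n - ι 2 - ι 2 * r)) ∎)) refl ⟩
          y * - ((p - r) * (q - r) + n * (n - ι 2 - ι 2 * r)) - n * m * w x
            ≈⟨ solve 5 (λ y h n m w → y :* :- h :- n :* m :* w := :- :1 :* (y :* h :+ n :* (w :* m))) refl y _ n m (w x) ⟩
          - 1# * (y * ((p - r) * (q - r) + n * (n - ι 2 - ι 2 * r)) + n * (w x * m)) ∎)

      module Large (0≤m : 0# ≤ m) (0≤r : 0# ≤ r) (0≤s : 0# ≤ s) where

        -- Large enough to make w and y positive and x₀ nonnegative. The summand (1 + r)² serves (p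
        -- - r)(q - r) ≠ 0, since its negative is w (x₀ - r) - (1 + r)².
        bound : Carrier
        bound = n + m + s + s + r + (1# + r) * (1# + r) + 1#

        module _ {x} (bound≤x : bound ≤ x) where

          private
            z ρ W V : Carrier
            z = x - bound
            ρ = (1# + r) * (1# + r)
            W = m + s + s + r + ρ + 1# + r + z
            V = 1# + (1# + s + s + z)
            0≤z : 0# ≤ z
            0≤z = x≤y⇒0≤y-x bound≤x
            0≤ρ : 0# ≤ ρ
            0≤ρ = square-nonneg (1# + r)
            0≤W : 0# ≤ W
            0≤W = +-nonneg (+-nonneg (+-nonneg (+-nonneg (+-nonneg (+-nonneg (+-nonneg 0≤m 0≤s) 0≤s) 0≤r) 0≤ρ) 0≤1) 0≤r) 0≤z
            V>0 : Positive V
            V>0 = positive-+-nonneg 1-positive (+-nonneg (+-nonneg (+-nonneg 0≤1 0≤s) 0≤s) 0≤z)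

            :z : ∀ {j} (n m r s ρ x : Polynomial j) → Polynomial j
            :z n m r s ρ x = x :- (n :+ m :+ s :+ s :+ r :+ ρ :+ :1)

            w≈ : 1# + W ≈ w x
            w≈ = solve 6 (λ n m r s ρ x → :1 :+ (m :+ s :+ s :+ r :+ ρ :+ :1 :+ r :+ :z n m r s ρ x) := x :- (n :- :1 :- r))
                   refl n m r s ρ x

            x₀≈ : ρ + V + r ≈ x₀ x
            x₀≈ = solve 6 (λ n m r s ρ x → ρ :+ (:1 :+ (:1 :+ s :+ s :+ :z n m r s ρ x)) :+ r := x :- (n :+ m :- :1))
                    refl n m r s ρ x

          opaque
            w>0 : Positive (w x)
            w>0 = positive-resp w≈ (positive-+-nonneg 1-positive 0≤W)

            y>0 : Positive (y x)
            y>0 = positive-resp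
              (solve 6 (λ n m r s ρ x → :1 :+ (m :+ r :+ ρ :+ :z n m r s ρ x) := x :- n :- s :- s) refl n m r s ρ x)
              (positive-+-nonneg 1-positive (+-nonneg (+-nonneg (+-nonneg 0≤m 0≤r) 0≤ρ) 0≤z))

            0≤x₀ : 0# ≤ x₀ x
            0≤x₀ = ≤-resp refl x₀≈ (+-nonneg (+-nonneg 0≤ρ (proj₁ V>0)) 0≤r)

            -- The discriminant is w² + 4w + 4 w x₀, nonnegative together with w and x₀.
            p,q : ∃[ p ] ∃[ q ] p + q ≈ - (w x + ι 2) × p * q ≈ 1# - w x * x₀ x
            p,q = quadratic-vieta (≤-resp refl
              (solve 2 (λ w z → w :* w :+ con (+ 4) :* w :+ con (+ 4) :* (w :* z) :=
                (w :+ :2) :* (w :+ :2) :- con (+ 4) :* (:1 :- w :* z)) refl (w x) (x₀ x))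
              (+-nonneg (+-nonneg (square-nonneg (w x)) (*-nonneg (ι-nonneg 4) (proj₁ w>0)))
                        (*-nonneg (ι-nonneg 4) (*-nonneg (proj₁ w>0) 0≤x₀))))

            -- In terms of w = 1 + W and x₀ = ρ + V + r with ρ = (1 + r)², the negative of the
            -- product is (1 + W)(ρ + V) - ρ = V + W (ρ + V), and V is positive.
            [p-r][q-r]≉0 : ∀ {p q} → p + q ≈ - (w x + ι 2) → p * q ≈ 1# - w x * x₀ x → ¬ ((p - r) * (q - r) ≈ 0#)
            [p-r][q-r]≉0 {p} {q} p+q pq ≈0 = proj₂ -h>0 (trans (-‿cong ≈0) -0#≈0#)
              where
              -h>0 : Positive (- ((p - r) * (q - r)))
              -h>0 = positive-resp (sym (begin
                - ((p - r) * (q - r))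
                  ≈⟨ solve 3 (λ p q r → :- ((p :- r) :* (q :- r)) := (p :+ q) :* r :- p :* q :- r :* r) refl p q r ⟩
                (p + q) * r - p * q - r * r
                  ≈⟨ +-congʳ (+-cong (*-congʳ p+q) (-‿cong pq)) ⟩
                - (w x + ι 2) * r - (1# - w x * x₀ x) - r * r
                  ≈⟨ +-congʳ (+-cong (*-congʳ (-‿cong (+-congʳ (sym w≈)))) (-‿cong (+-congˡ (-‿cong (*-cong (sym w≈) (sym x₀≈)))))) ⟩
                - (1# + W + ι 2) * r - (1# - (1# + W) * (ρ + V + r)) - r * r
                  ≈⟨ solve 3 (λ W V r → let ρ = (:1 :+ r) :* (:1 :+ r) in
                       :- (:1 :+ W :+ :2) :* r :- (:1 :- (:1 :+ W) :* (ρ :+ V :+ r)) :- r :* r := V :+ W :* (ρ :+ V)) refl W V r ⟩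
                V + W * (ρ + V) ∎))
                (positive-+-nonneg V>0 (*-nonneg 0≤W (+-nonneg 0≤ρ (proj₁ V>0))))

  -- The spectrum of the join

  module Eigenvalues
    {m₁ m₂ r₁ r₂ : ℕ} (G₁ : Graph (Fin (suc m₁))) (G₂ : Graph (Fin (suc m₂)))
    (regular₁ : Regular G₁ r₁) (regular₂ : Regular G₂ r₂)
    (ν : Fin (suc m₁) → Carrier) (μ : Fin (suc m₂) → Carrier)
    (spectrum₁ : Spectrum (signlessLaplacian G₁) (tabulate ν)) (ν-decreasing : Decreasing ν)
    (spectrum₂ : Spectrum (signlessLaplacian G₂) (tabulate μ)) (μ-decreasing : Decreasing μ) where

    private
      n m r s : Carrier
      n = ι (suc m₁)
      m = ι (suc m₂)
      r = ι r₁
      s = ι r₂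

      n>0 = ι-suc-positive m₁
      m>0 = ι-suc-positive m₂

      αβ : ∀ i → ∃[ α ] ∃[ β ] Roots (quadratic n m r (ν (suc i))) (α ∷ β ∷ [])
      αβ i = quadratic-roots (discriminant≥0 n m r (ν (suc i)))

      γs = roots-cubic n m r s
        (≤-resp refl (solve 2 (λ n m → n :+ m := :1 :+ n :+ m :- :1) refl (ι m₁) m) (+-nonneg (ι-nonneg m₁) (proj₁ m>0)))
        (ι-nonneg r₁) (ι-nonneg r₂) n>0 m>0

    α β : Fin m₁ → Carrier
    α i = proj₁ (αβ i)
    β i = proj₁ (proj₂ (αβ i))

    γ₁ γ₂ γ₃ : Carrier
    γ₁ = proj₁ γs
    γ₂ = proj₁ (proj₂ γs)
    γ₃ = proj₁ (proj₂ (proj₂ γs))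

    quadratic-spectrum : ∀ i → Roots (quadratic n m r (ν (suc i))) (α i ∷ β i ∷ [])
    quadratic-spectrum i = proj₂ (proj₂ (αβ i))

    cubic-spectrum : Roots (cubic (cubic₂ n m r s) (cubic₁ n m r s) (cubic₀ n m r s)) (γ₁ ∷ γ₂ ∷ γ₃ ∷ [])
    cubic-spectrum = proj₂ (proj₂ (proj₂ γs))

    private
      pairs : Fin m₁ → List Carrier
      pairs i = α i ∷ β i ∷ []

      roots : List Carrier
      roots = tabulate (λ j → n + μ (suc j)) ++ concat (tabulate pairs) ++ γ₁ ∷ γ₂ ∷ γ₃ ∷ []

      module L = Large n m r s (proj₁ m>0) (ι-nonneg r₁) (ι-nonneg r₂)

      at-large : ∀ x → L.bound ≤ x → charPoly (signlessLaplacian (nnsJoin G₁ G₂)) x ≈ monic roots x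
      at-large x large = begin
        charPoly (signlessLaplacian (nnsJoin G₁ G₂)) x
          ≈⟨ charPoly-nnsJoin G₁ G₂ regular₁ regular₂ x w≉0 y≉0 p+q pq h≉0 ⟩
        (- 1#) ^ suc m₁ * (charPoly (signlessLaplacian G₁) (p + r) * charPoly (signlessLaplacian G₁) (q + r) * (1# + n * g))
          * charPoly (signlessLaplacian G₂) (x - n)
          ≈⟨ *-cong (*-congˡ (*-congʳ (*-cong (product₁ p) (product₁ q)))) product₂ ⟩
        (- 1#) ^ suc m₁ * (∏ (λ i → p + r - ν i) * ∏ (λ i → q + r - ν i) * (1# + n * g)) * (y′ * Y)
          ≈⟨ solve 6 (λ o P Q g y Y → o :* (P :* Q :* g) :* (y :* Y) := o :* (P :* Q) :* (g :* y :* Y)) refl _ _ _ _ y′ Y ⟩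
        (- 1#) ^ suc m₁ * (∏ (λ i → p + r - ν i) * ∏ (λ i → q + r - ν i)) * ((1# + n * g) * y′ * Y)
          ≈⟨ *-congʳ pairing ⟩
        - 1# * h * Z * ((1# + n * g) * y′ * Y)
          -- The leftover factor - h from ν₁, the factor y from μ₁ and 1 + n g are brought together:
          -- only their product is free of inverses, and it is the cubic.
          ≈⟨ solve 5 (λ h Z g y Y → :- :1 :* h :* Z :* (g :* y :* Y) := Y :* (Z :* (:- :1 :* (y :* (h :* g))))) refl h Z (1# + n * g) y′ Y ⟩
        Y * (Z * (- 1# * (y′ * (h * (1# + n * g)))))
          ≈⟨ *-congˡ (*-congˡ (trans (*-congˡ (y*h*[1+ng] G₁ G₂ regular₁ regular₂ x w≉0 y≉0 p+q pq h≉0))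
               (trans (cubic-factor n m r s x p+q pq) (cubic-spectrum x)))) ⟩
        Y * (Z * monic (γ₁ ∷ γ₂ ∷ γ₃ ∷ []) x)
          ≈⟨ *-cong (trans (monic-tabulate (λ j → n + μ (suc j)) x) (∏-cong λ j →
               solve 3 (λ x n μ → x :- (n :+ μ) := x :- n :- μ) refl x n (μ (suc j))))
               (trans (monic-++ (concat (tabulate pairs)) _ x) (*-congʳ (trans (monic-concat pairs x)
                 (∏-cong λ i → sym (quadratic-spectrum i x))))) ⟨
        monic (tabulate (λ j → n + μ (suc j))) x * monic (concat (tabulate pairs) ++ γ₁ ∷ γ₂ ∷ γ₃ ∷ []) x
          ≈⟨ monic-++ (tabulate (λ j → n + μ (suc j))) _ x ⟨
        monic roots x ∎
        where
        w≉0 = proj₂ (L.w>0 large)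
        y≉0 = proj₂ (L.y>0 large)
        p = proj₁ (L.p,q large)
        q = proj₁ (proj₂ (L.p,q large))
        p+q = proj₁ (proj₂ (proj₂ (L.p,q large)))
        pq = proj₂ (proj₂ (proj₂ (L.p,q large)))
        h≉0 = L.[p-r][q-r]≉0 large p+q pq
        h y′ g Y Z : Carrier
        h = (p - r) * (q - r)
        y′ = x - n - s - s
        g = ((n - ι 2 - ι 2 * r) + w n m r x * (m * y′ ⁻¹⟨ y≉0 ⟩)) * h ⁻¹⟨ h≉0 ⟩
        Y = ∏ (λ j → x - n - μ (suc j))
        Z = ∏ (λ i → quadratic n m r (ν (suc i)) x)

        product₁ : ∀ t → charPoly (signlessLaplacian G₁) (t + r) ≈ ∏ (λ i → t + r - ν i)
        product₁ t = trans (spectrum₁ (t + r)) (monic-tabulate ν (t + r))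

        product₂ : charPoly (signlessLaplacian G₂) (x - n) ≈ y′ * Y
        product₂ = trans (spectrum₂ (x - n)) (trans (monic-tabulate μ (x - n)) (*-congʳ (begin
          x - n - μ zero        ≈⟨ +-congˡ (-‿cong (largest-eigenvalue G₂ regular₂ μ spectrum₂ μ-decreasing)) ⟩
          x - n - ι 2 * s       ≈⟨ solve 3 (λ x n s → x :- n :- :2 :* s := x :- n :- s :- s) refl x n s ⟩
          x - n - s - s         ∎)))

        -- The sign is distributed, one - 1 to each of the n pairs of factors. The pair of ν₁ = 2r
        -- gives - h, and each of the others gives its quadratic.
        pairing : (- 1#) ^ suc m₁ * (∏ (λ i → p + r - ν i) * ∏ (λ i → q + r - ν i)) ≈ - 1# * h * Z
        pairing = begin
          (- 1#) ^ suc m₁ * (∏ (λ i → p + r - ν i) * ∏ (λ i → q + r - ν i))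
            ≈⟨ *-cong (∏-replicate (suc m₁)) (∏-distrib-* (λ i → p + r - ν i) (λ i → q + r - ν i)) ⟨
          ∏ {suc m₁} (λ _ → - 1#) * ∏ (λ i → (p + r - ν i) * (q + r - ν i))
            ≈⟨ ∏-distrib-* (λ _ → - 1#) (λ i → (p + r - ν i) * (q + r - ν i)) ⟨
          ∏ (λ i → - 1# * ((p + r - ν i) * (q + r - ν i)))
            ≈⟨ *-cong (*-congˡ (*-cong (top p) (top q))) (∏-cong λ i → quadratic-factors n m r x p+q pq (ν (suc i))) ⟩
          - 1# * h * Z ∎
          where
          top : ∀ t → t + r - ν zero ≈ t - r
          top t = begin
            t + r - ν zero      ≈⟨ +-congˡ (-‿cong (largest-eigenvalue G₁ regular₁ ν spectrum₁ ν-decreasing)) ⟩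
            t + r - ι 2 * r     ≈⟨ solve 2 (λ t r → t :+ r :- :2 :* r := t :- r) refl t r ⟩
            t - r               ∎

    nnsJoin-spectrum : Spectrum (signlessLaplacian (nnsJoin G₁ G₂)) roots
    nnsJoin-spectrum = eventually-equal (polynomial-charPoly (signlessLaplacian (nnsJoin G₁ G₂)))
      (polynomial-monic roots) L.bound at-large

-- Both orders are successors, so ν₁ and μ₁ exist and the indices `suc i` and `suc j` run over the
-- remaining eigenvalues. The roots α, β, γ are produced in the field, so the splitting of the
-- equations is part of the claim.
theorem6p3 :
  ∀ {c ℓ₁ ℓ₂} (F : RealClosedField c ℓ₁ ℓ₂) →
  let open RealClosedField F
      open Spectral F
  in
  (m₁ m₂ r₁ r₂ : ℕ)
  (G₁ : Graph (Fin (suc m₁))) (G₂ : Graph (Fin (suc m₂))) →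
  Regular G₁ r₁ → Regular G₂ r₂ →
  (ν : Fin (suc m₁) → Carrier) (μ : Fin (suc m₂) → Carrier) →
  Spectrum (signlessLaplacian G₁) (tabulate ν) → Decreasing ν →
  Spectrum (signlessLaplacian G₂) (tabulate μ) → Decreasing μ →
  let n₁ = ι (suc m₁)
      n₂ = ι (suc m₂)
      r  = ι r₁
      s  = ι r₂
  in
  Σ[ α ∈ (Fin m₁ → Carrier) ] Σ[ β ∈ (Fin m₁ → Carrier) ] ∃[ γ₁ ] ∃[ γ₂ ] ∃[ γ₃ ]
    ( (∀ (i : Fin m₁) → Roots
        (λ x →
          x * x
          + (ι 2 * r - ι 2 * n₁ - n₂ - ν (suc i) + ι 2) * x
          + ( n₁ * n₁ - ι 2 * r * n₁ - ι 2 * n₁ + n₁ * n₂ - r * n₂ - n₂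
            + ι 4 * r + ν (suc i) * (n₁ + r - ι 3 - ν (suc i))))
        (α i ∷ β i ∷ []))
    × Roots
        (λ x →
          x * x * x
          + (ι 2 - ι 3 * n₁ - n₂ - ι 2 * s) * (x * x)
          + ( n₁ * n₂ - n₂ * r - n₂ + ι 2 * (n₁ * n₁) + ι 2 * r * n₁
            - ι 2 * n₁ - ι 2 * r - ι 2 * (r * r) + ι 4 * s * n₁
            - ι 4 * s + ι 2 * s * n₂) * x
          + ( ι 2 * n₁ * (r * r) + ι 2 * r * n₁ - ι 2 * r * (n₁ * n₁)
            - ι 2 * s * n₁ * n₂ + ι 2 * r * s * n₂ + ι 2 * s * n₂
            + ι 4 * s * (r * r) + ι 4 * r * s - ι 4 * r * s * n₁))
        (γ₁ ∷ γ₂ ∷ γ₃ ∷ [])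
    × Spectrum (signlessLaplacian (nnsJoin G₁ G₂))
        ( tabulate (λ (j : Fin m₂) → n₁ + μ (suc j))
        ++ concat (tabulate (λ (i : Fin m₁) → α i ∷ β i ∷ []))
        ++ γ₁ ∷ γ₂ ∷ γ₃ ∷ []))
theorem6p3 F m₁ m₂ r₁ r₂ G₁ G₂ regular₁ regular₂ ν μ spectrum₁ ν-decreasing spectrum₂ μ-decreasing =
  α , β , γ₁ , γ₂ , γ₃ , quadratic-spectrum , cubic-spectrum , nnsJoin-spectrum
  where
  open NNSSpectrum.Eigenvalues F G₁ G₂ regular₁ regular₂ ν μ spectrum₁ ν-decreasing spectrum₂ μ-decreasing
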